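{- Let $n\ge2$, $k\ge3$, $\varepsilon>0$, and let $f:S_k^n\to[k]$ be a social choice function with $\mathbf{D}(f,\overline{\mathrm{NONMANIP}})\ge\varepsilon$. Let $\sigma\in S_k^n$ be uniformly random. Then $$\mathbb{P}(\sigma\in M(f))\ge\mathbb{P}(\sigma\in M_4(f))\ge\frac{\varepsilon^5}{10^9\,n^7\,k^{46}}.$$
   Context: $[k]=\{1,\dots,k\}$, $S_k$ is the set of total orderings of $[k]$, a social choice function is a map $f:S_k^n\to[k]$. Write $a\overset{\sigma_i}{>}b$ if $\sigma_i$ ranks $a$ above $b$. $\sigma$ is a manipulation point if there are $i$ and $\sigma'$ differing from $\sigma$ only in coordinate $i$ with $f(\sigma')\overset{\sigma_i}{>}f(\sigma)$; it is an $r$-manipulation point if such $\sigma'$ exists with $\sigma'_i$ obtained from $\sigma_i$ by permuting at most $r$ alternatives occupying adjacent positions in $\sigma_i$. $M(f)$, $M_r(f)$ denote these sets. $\overline{\mathrm{NONMANIP}}$ is the set of SCFs that depend on only one coordinate or take at most two values. $\mathbf{D}(f,g)=\mathbb{P}(f(\sigma)\ne g(\sigma))$ for uniform $\sigma$, $\mathbf{D}(f,G)=\min_{g\in G}\mathbf{D}(f,g)$. -}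

module Defs where

open import Data.Nat as ℕ using (ℕ; zero; suc)
open import Data.Fin as Fin using (Fin; toℕ)
open import Data.Fin.Properties as FinP using (any?; all?)
open import Data.Vec as Vec using (Vec; []; _∷_; lookup; _[_]≔_)
open import Data.List as List using (List; []; _∷_; length; filter; allFin; cartesianProductWith; mapMaybe)
open import Data.List.Relation.Unary.Any as Any using (Any)
open import Data.Maybe using (Maybe; just; nothing)
open import Data.Product using (Σ; ∃; _×_; _,_)
open import Data.Sum using (_⊎_)
open import Data.Integer as ℤ using (+_)
open import Data.Rational as ℚ using (ℚ)
open import Relation.Nullary using (¬_; Dec; yes; no)
open import Relation.Nullary.Decidable using (_×-dec_; _⊎-dec_; _→-dec_; ¬?)
import Agda.Primitive
open import Relation.Unary using (Pred; Decidable)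
open import Relation.Binary.PropositionalEquality using (_≡_)

-- Rankings (elements of S_k).  A ranking is the list of the k alternatives
-- from the top position (index 0) to the bottom (index k-1); all entries
-- distinct, hence a bijection Fin k → Fin k.  The distinctness proof is
-- irrelevant, so rankings are determined by their order vector.

AllDistinct : ∀ {k} → Vec (Fin k) k → Set
AllDistinct {k} v = ∀ (p q : Fin k) → lookup v p ≡ lookup v q → p ≡ q

allDistinct? : ∀ {k} (v : Vec (Fin k) k) → Dec (AllDistinct v)
allDistinct? v = all? λ p → all? λ q → (lookup v p Fin.≟ lookup v q) →-dec (p Fin.≟ q)

record Ranking (k : ℕ) : Set where
  constructor mkRanking
  field
    order     : Vec (Fin k) k
    .distinct : AllDistinct order
open Ranking public

vecsOf : ∀ {A : Set} → List A → (m : ℕ) → List (Vec A m)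
vecsOf xs zero    = [] ∷ []
vecsOf xs (suc m) = cartesianProductWith _∷_ xs (vecsOf xs m)

toRanking : ∀ {k} → Vec (Fin k) k → Maybe (Ranking k)
toRanking v with allDistinct? v
... | yes d = just (mkRanking v d)
... | no _  = nothing

Sk : (k : ℕ) → List (Ranking k)
Sk k = mapMaybe toRanking (vecsOf (allFin k) k)

Prefers : ∀ {k} → Ranking k → Fin k → Fin k → Set
Prefers {k} τ a b =
  Σ (Fin k) λ p → Σ (Fin k) λ q →
    (p Fin.< q) × (lookup (order τ) p ≡ a) × (lookup (order τ) q ≡ b)

prefers? : ∀ {k} (τ : Ranking k) (a b : Fin k) → Dec (Prefers τ a b)
prefers? τ a b = any? λ p → any? λ q →
  (p Fin.<? q) ×-dec (lookup (order τ) p Fin.≟ a) ×-dec (lookup (order τ) q Fin.≟ b)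

Profile : ℕ → ℕ → Set
Profile n k = Vec (Ranking k) n

profiles : (n k : ℕ) → List (Profile n k)
profiles n k = vecsOf (Sk k) n

SCF : ℕ → ℕ → Set
SCF n k = Profile n k → Fin k

Gain : ∀ {n k} → SCF n k → Profile n k → Fin n → Ranking k → Set
Gain f σ i τ = Prefers (lookup σ i) (f (σ [ i ]≔ τ)) (f σ)

gain? : ∀ {n k} (f : SCF n k) σ i τ → Dec (Gain f σ i τ)
gain? f σ i τ = prefers? (lookup σ i) (f (σ [ i ]≔ τ)) (f σ)

ManipPoint : ∀ {n k} → SCF n k → Profile n k → Set
ManipPoint {n} {k} f σ = Σ (Fin n) λ i → Any (λ τ → Gain f σ i τ) (Sk k)

manipPoint? : ∀ {n k} (f : SCF n k) → Decidable (ManipPoint f)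
manipPoint? f σ = any? λ i → Any.any? (gain? f σ i) _

-- τ is obtained from ρ by permuting at most r alternatives occupying
-- adjacent positions: ρ and τ agree at every position outside a window
-- of positions [j, j + r) (j ∈ {0,…,k}).
WindowPerm : ∀ {k} → ℕ → Ranking k → Ranking k → Set
WindowPerm {k} r ρ τ =
  Σ (Fin (suc k)) λ j → ∀ (p : Fin k) →
    (toℕ p ℕ.< toℕ j ⊎ toℕ j ℕ.+ r ℕ.≤ toℕ p) → lookup (order ρ) p ≡ lookup (order τ) p

windowPerm? : ∀ {k} r (ρ τ : Ranking k) → Dec (WindowPerm r ρ τ)
windowPerm? r ρ τ = any? λ j → all? λ p →
  ((toℕ p ℕ.<? toℕ j) ⊎-dec (toℕ j ℕ.+ r ℕ.≤? toℕ p)) →-dec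
  (lookup (order ρ) p Fin.≟ lookup (order τ) p)

RManipPoint : ∀ {n k} → ℕ → SCF n k → Profile n k → Set
RManipPoint {n} {k} r f σ =
  Σ (Fin n) λ i → Any (λ τ → WindowPerm r (lookup σ i) τ × Gain f σ i τ) (Sk k)

rManipPoint? : ∀ {n k} r (f : SCF n k) → Decidable (RManipPoint r f)
rManipPoint? r f σ = any? λ i →
  Any.any? (λ τ → windowPerm? r (lookup σ i) τ ×-dec gain? f σ i τ) _

frac : ℕ → ℕ → ℚ
frac c zero    = ℚ.0ℚ
frac c (suc d) = (+ c) ℚ./ suc d

Prob : ∀ {n k} {P : Pred (Profile n k) Agda.Primitive.lzero} → Decidable P → ℚ
Prob {n} {k} P? = frac (length (filter P? (profiles n k))) (length (profiles n k))

Dist : ∀ {n k} → SCF n k → SCF n k → ℚ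
Dist f g = Prob (λ σ → ¬? (f σ Fin.≟ g σ))

NonManipBar : ∀ {n k} → SCF n k → Set
NonManipBar {n} {k} g =
  (Σ (Fin n) λ i → ∀ (σ σ' : Profile n k) → lookup σ i ≡ lookup σ' i → g σ ≡ g σ')
  ⊎ (Σ (Fin k) λ a → Σ (Fin k) λ b → ∀ (σ : Profile n k) → (g σ ≡ a ⊎ g σ ≡ b))

-- Away from manipulation points, swapping two adjacent alternatives x > y of one voter can only change the
-- outcome from x to y; call (voter, x, y) pivotal at such a profile. Hence a pivot of voter i on {a, b} survives
-- adjacent swaps of the other voters as long as no preference between a and b is reversed, and by a Poincaré
-- inequality the pivot set of i is, up to few manipulation points, a union of fibres of the vector of a-b
-- preferences of the other voters.
--
-- If f is far from NONMANIP, two different voters i and j have large pivot sets on pairs {a, b} and {c, d} with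
-- a ∉ {c, d} and c ∉ {a, b}. For a uniform profile the bits "a > b" and "c > d" of a voter have correlation at
-- most 1/2, so reverse hypercontractivity gives both pivots on a common profile of the other n − 2 voters with
-- probability at least the square of the product of the two measures. On such a profile f is a function of the
-- rankings of i and j alone, and lowering b or d in these rankings forces the outcome to be both a and c, unless
-- a manipulation point is met on the way. All the paths used have (nearly) uniformly distributed vertices, so a
-- union bound over their steps, polynomially many in n and k, bounds the measure of manipulation points from below.

module Submission where

open import Defs
open import Data.Bool as Bool using (Bool; true; false; if_then_else_; not)
open import Data.Bool.Properties as BoolP using ()
open import Data.Empty using (⊥; ⊥-elim)
open import Data.Fin as Fin using (Fin; zero; suc; toℕ; fromℕ<)
open import Data.Fin.Permutation.Components using (transpose; transpose-inverse)
open import Data.Fin.Properties as FinP using (toℕ<n; toℕ-injective; toℕ-fromℕ<)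
open import Data.Integer as ℤ using (ℤ; -[1+_])
import Data.Integer.Properties as ℤP
open import Data.List using (List; []; _∷_; _++_; map; length; allFin; upTo; filter; cartesianProductWith; mapMaybe)
open import Data.List.Membership.Propositional using (_∈_)
import Data.List.Membership.Propositional.Properties as MembershipP
open import Data.List.Properties as ListP using (map-++; map-∘; map-cong; length-map; map-tabulate)
open import Data.List.Relation.Unary.All as All using (All; []; _∷_)
open import Data.List.Relation.Unary.Any as Any using (here; there)
import Data.List.Relation.Unary.Any.Properties as AnyP
open import Data.List.Relation.Unary.Unique.Propositional using (Unique; []; _∷_)
import Data.List.Relation.Unary.Unique.Propositional.Properties as UniqueP
open import Data.Maybe using (just; nothing)
open import Data.Maybe.Relation.Unary.Any using (just) renaming (Any to MaybeAny)
open import Data.Nat as ℕ using (ℕ; zero; suc; _+_; _*_; _∸_; _^_; _≤_; _<_; z≤n; s≤s)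
open import Data.Nat.ListAction using (sum)
open import Data.Nat.ListAction.Properties using (sum-++)
open import Data.Nat.Properties
open import Data.Nat.Tactic.RingSolver using (solve-∀)
open import Data.Product using (∃; _×_; _,_; proj₁; proj₂)
open import Data.Rational as ℚ using (ℚ)
import Data.Rational.Properties as ℚP
import Data.Rational.Unnormalised as ℚᵘ
import Data.Rational.Unnormalised.Properties as ℚᵘP
open import Data.Sum using (_⊎_; inj₁; inj₂; [_,_]′)
open import Data.Unit using (tt)
open import Data.Vec as Vec using (Vec; []; _∷_; lookup; _[_]≔_; zipWith)
open import Data.Vec.Membership.Propositional using () renaming (_∈_ to _∈ᵥ_)
import Data.Vec.Membership.Propositional.Properties as VecMembershipP
open import Data.Vec.Properties as VecP using ([]≔-commutes; []≔-idempotent; []≔-lookup; lookup∘update; lookup∘update′)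
open import Data.Vec.Relation.Unary.Any using () renaming (here to hereᵥ; there to thereᵥ)
open import Function using (_∘_; id; mk⇔)
open import Relation.Binary using (DecidableEquality; tri<; tri≈; tri>)
open import Relation.Binary.PropositionalEquality
open import Relation.Nullary using (¬_; Dec; yes; no; does; contradiction)
open import Relation.Nullary.Decidable using (_×-dec_; _⊎-dec_; ¬?; dec-true; dec-false; recompute; decidable-stable; does-⇔)
open import Relation.Unary using (Pred; Decidable)

-- Probabilities are cleared of denominators: sums over the enumerations of rankings and profiles
-- are compared in `ℕ`, and rational numbers enter only in the last section.
--
-- The coincidence b = d cannot be excluded, since pivots come in both directions and may share an
-- alternative. The two pivot events are then not independent, and their intersection must be
-- bounded below for arbitrary functions of correlated bits; this is what reverse hypercontractivity
-- is for.
--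
-- Lowering is indexed by a start position and a length, not by alternatives. For fixed indices it
-- is a bijection of rankings, so its images stay uniform, and the price is a union bound over k^2
-- index pairs for each of the two voters.
--
-- Origin of the constants: far from NONMANIP there are pivots of probability at least ε/(2nk^5),
-- unless manipulation points already abound. Two of them meet with weight at least (ε/(2nk^5))^4,
-- whereas each of the k^4 bad events has probability at most (1 + 32nk^3) P(M_4). This gives ε^4 ≤
-- 528 n^5 k^27 P(M_4), with 528 = 16 * 33, and the stated bound is weaker because ε ≤ 1.

private variable
  A B : Set
  P Q R : Set
  k : ℕ

-- Finite sums and indicators

∑ : List A → (A → ℕ) → ℕ
∑ xs F = sum (map F xs)

infix 5 ∑
syntax ∑ xs (λ x → e) = ∑[ x ∈ xs ] e

∑-cong : ∀ (xs : List A) {F G : A → ℕ} → (∀ x → F x ≡ G x) → ∑ xs F ≡ ∑ xs G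
∑-cong xs F≗G = cong sum (map-cong F≗G xs)

∑-mono : ∀ (xs : List A) {F G : A → ℕ} → (∀ x → F x ≤ G x) → ∑ xs F ≤ ∑ xs G
∑-mono []       F≤G = z≤n
∑-mono (x ∷ xs) F≤G = +-mono-≤ (F≤G x) (∑-mono xs F≤G)

∑-++ : ∀ (xs ys : List A) (F : A → ℕ) → ∑ (xs ++ ys) F ≡ ∑ xs F + ∑ ys F
∑-++ xs ys F = trans (cong sum (map-++ F xs ys)) (sum-++ (map F xs) (map F ys))

∑-map : ∀ (g : A → B) xs (F : B → ℕ) → ∑ (map g xs) F ≡ ∑ xs (F ∘ g)
∑-map g xs F = cong sum (sym (map-∘ xs))

∑-+ : ∀ (xs : List A) (F G : A → ℕ) → ∑[ x ∈ xs ] (F x + G x) ≡ ∑ xs F + ∑ xs G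
∑-+ []       F G = refl
∑-+ (x ∷ xs) F G rewrite ∑-+ xs F G = interchange (F x) (G x) (∑ xs F) (∑ xs G)
  where
  interchange : ∀ a b c d → a + b + (c + d) ≡ a + c + (b + d)
  interchange = solve-∀

∑-*ˡ : ∀ c (xs : List A) (F : A → ℕ) → ∑[ x ∈ xs ] (c * F x) ≡ c * ∑ xs F
∑-*ˡ c []       F = sym (*-zeroʳ c)
∑-*ˡ c (x ∷ xs) F rewrite ∑-*ˡ c xs F = sym (*-distribˡ-+ c (F x) (∑ xs F))

∑-*ʳ : ∀ (xs : List A) (F : A → ℕ) c → ∑[ x ∈ xs ] (F x * c) ≡ ∑ xs F * c
∑-*ʳ xs F c = trans (∑-cong xs λ x → *-comm (F x) c) (trans (∑-*ˡ c xs F) (*-comm c _))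

∑-const : ∀ (xs : List A) c → ∑[ x ∈ xs ] c ≡ length xs * c
∑-const []       c = refl
∑-const (x ∷ xs) c = cong (c +_) (∑-const xs c)

∑-swap : ∀ (xs : List A) (ys : List B) (F : A → B → ℕ) →
  ∑[ x ∈ xs ] (∑[ y ∈ ys ] F x y) ≡ ∑[ y ∈ ys ] (∑[ x ∈ xs ] F x y)
∑-swap []       ys F = sym (trans (∑-const ys 0) (*-zeroʳ (length ys)))
∑-swap (x ∷ xs) ys F = trans (cong (∑ ys (F x) +_) (∑-swap xs ys F)) (sym (∑-+ ys (F x) _))

∑-*-∑ : ∀ (xs : List A) (ys : List B) (F : A → ℕ) (G : B → ℕ) →
  ∑ xs F * ∑ ys G ≡ ∑[ x ∈ xs ] (∑[ y ∈ ys ] (F x * G y))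
∑-*-∑ xs ys F G =
  trans (sym (∑-*ʳ xs F (∑ ys G))) (∑-cong xs λ x → sym (∑-*ˡ (F x) ys G))

∑-allFin : ∀ n (F : Fin (suc n) → ℕ) → ∑ (allFin (suc n)) F ≡ F zero + ∑ (allFin n) (F ∘ suc)
∑-allFin n F = cong (F zero +_) (cong sum (trans (map-tabulate suc F) (sym (map-tabulate id (F ∘ suc)))))

∑-≥-term : ∀ {xs : List A} {x} (F : A → ℕ) → x ∈ xs → F x ≤ ∑ xs F
∑-≥-term F (here refl) = m≤m+n _ _
∑-≥-term {xs = y ∷ ys} F (there p) = ≤-trans (∑-≥-term F p) (m≤n+m _ (F y))

𝟙 : Dec P → ℕ
𝟙 d = if does d then 1 else 0

𝟙≤1 : (d : Dec P) → 𝟙 d ≤ 1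
𝟙≤1 (yes _) = ≤-refl
𝟙≤1 (no _)  = z≤n

𝟙-yes : (d : Dec P) → P → 𝟙 d ≡ 1
𝟙-yes (yes _) p = refl
𝟙-yes (no ¬p) p = contradiction p ¬p

𝟙-no : (d : Dec P) → ¬ P → 𝟙 d ≡ 0
𝟙-no (yes p) ¬p = contradiction p ¬p
𝟙-no (no _)  ¬p = refl

𝟙-mono : (d : Dec P) (e : Dec Q) → (P → Q) → 𝟙 d ≤ 𝟙 e
𝟙-mono (yes p) e P⇒Q = ≤-reflexive (sym (𝟙-yes e (P⇒Q p)))
𝟙-mono (no _)  e P⇒Q = z≤n

𝟙-cong : (d : Dec P) (e : Dec Q) → (P → Q) → (Q → P) → 𝟙 d ≡ 𝟙 e
𝟙-cong d e f g = ≤-antisym (𝟙-mono d e f) (𝟙-mono e d g)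

𝟙-× : (d : Dec P) (e : Dec Q) → 𝟙 (d ×-dec e) ≡ 𝟙 d * 𝟙 e
𝟙-× (yes _) (yes _) = refl
𝟙-× (yes _) (no _)  = refl
𝟙-× (no _)  (yes _) = refl
𝟙-× (no _)  (no _)  = refl

-- The form in which every union bound below is made: `m` is a sum of indicators of bad events, and
-- the event is refuted under the assumption that all of them fail.
𝟙-bound : (d : Dec P) {m : ℕ} → (P → m ≡ 0 → ⊥) → 𝟙 d ≤ m
𝟙-bound (no _)  {m}     h = z≤n
𝟙-bound (yes p) {zero}  h = ⊥-elim (h p refl)
𝟙-bound (yes p) {suc m} h = s≤s z≤n

𝟙≡0 : (d : Dec P) → 𝟙 d ≡ 0 → ¬ P
𝟙≡0 (no ¬p) _ = ¬p

does-true : (d : Dec P) → does d ≡ true → P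
does-true (yes p) _ = p

∑≡0 : ∀ (xs : List A) (F : A → ℕ) → ∑ xs F ≡ 0 → ∀ {x} → x ∈ xs → F x ≡ 0
∑≡0 xs F eq x∈xs = n≤0⇒n≡0 (≤-trans (∑-≥-term F x∈xs) (≤-reflexive eq))

length-filter : ∀ {P : Pred A _} (P? : Decidable P) xs → length (filter P? xs) ≡ ∑ xs (𝟙 ∘ P?)
length-filter P? []       = refl
length-filter P? (x ∷ xs) with does (P? x)
... | true  = cong suc (length-filter P? xs)
... | false = length-filter P? xs

-- A self-map that never increases a sum of natural numbers preserves all sums: apply the hypothesis
-- to the complement K ∸ G of a bounded function.
∑-preserving : ∀ (xs : List A) (g : A → A) → (∀ G → ∑ xs (G ∘ g) ≤ ∑ xs G) →
  (∀ x → x ∈ xs) → ∀ G → ∑ xs (G ∘ g) ≡ ∑ xs G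
∑-preserving xs g dec all G = ≤-antisym (dec G) (+-cancelˡ-≤ (∑ xs (λ x → K ∸ G x)) _ _ (begin
  ∑ xs (λ x → K ∸ G x) + ∑ xs G              ≡⟨ total id ⟩
  length xs * K                              ≡⟨ total g ⟨
  ∑ xs (λ x → K ∸ G (g x)) + ∑ xs (G ∘ g)    ≤⟨ +-monoˡ-≤ _ (dec (λ x → K ∸ G x)) ⟩
  ∑ xs (λ x → K ∸ G x) + ∑ xs (G ∘ g)        ∎))
  where
  open ≤-Reasoning
  K = ∑ xs G
  total : ∀ h → ∑ xs (λ x → K ∸ G (h x)) + ∑ xs (G ∘ h) ≡ length xs * K
  total h = trans (sym (∑-+ xs (λ x → K ∸ G (h x)) (G ∘ h)))
           (trans (∑-cong xs λ x → m∸n+n≡m (∑-≥-term G (all (h x)))) (∑-const xs K))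

-- Induction on `xs` deletes the matched occurrence from `ys`; uniqueness of `xs` ensures that later
-- elements survive the deletion.
∑-⊆ : ∀ {xs ys : List A} (F : A → ℕ) → Unique xs → (∀ {x} → x ∈ xs → x ∈ ys) → ∑ xs F ≤ ∑ ys F
∑-⊆ {xs = []}     F _         sub = z≤n
∑-⊆ {A = A} {xs = x ∷ xs} F (x∉ ∷ uxs) sub with split (sub (here refl))
  where
  split : ∀ {y : A} {ys} → y ∈ ys → ∃ λ zs → (∑ ys F ≡ F y + ∑ zs F) × (∀ {z} → z ∈ ys → z ≢ y → z ∈ zs)
  split {ys = _ ∷ zs} (here refl) = zs , refl , λ where
    (here z≡y)  z≢y → contradiction z≡y z≢y
    (there z∈) _    → z∈
  split {y} {w ∷ ys} (there y∈) with split y∈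
  ... | zs , eq , keep = w ∷ zs
      , trans (cong (F w +_) eq) (+-left-swap (F w) (F y) (∑ zs F))
      , λ where
          (here z≡w)  _   → here z≡w
          (there z∈)  z≢y → there (keep z∈ z≢y)
    where
    +-left-swap : ∀ a b c → a + (b + c) ≡ b + (a + c)
    +-left-swap = solve-∀
... | zs , eq , keep = ≤-trans
  (+-monoʳ-≤ (F x) (∑-⊆ F uxs λ z∈ → keep (sub (there z∈)) λ z≡x → All.lookup x∉ z∈ (sym z≡x)))
  (≤-reflexive (sym eq))

-- Injectivity yields only `≤`, through `∑-⊆`; `∑-preserving` upgrades it to equality, so no inverse
-- of `g` has to be exhibited.
∑-injective : ∀ (xs : List A) → Unique xs → (∀ x → x ∈ xs) → (g : A → A) → (∀ {x y} → g x ≡ g y → x ≡ y) →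
  ∀ G → ∑ xs (G ∘ g) ≡ ∑ xs G
∑-injective xs uniq all g inj = ∑-preserving xs g
  (λ G → ≤-trans (≤-reflexive (sym (∑-map g xs G)))
                 (∑-⊆ G (UniqueP.map⁺ inj uniq) (λ _ → all _))) all

-- Product spaces

∑-vecsOf : ∀ (S : List A) m (G : Vec A (suc m) → ℕ) →
  ∑ (vecsOf S (suc m)) G ≡ ∑[ a ∈ S ] (∑[ s ∈ vecsOf S m ] G (a ∷ s))
∑-vecsOf {A} S m G = go S
  where
  go : ∀ T → ∑ (cartesianProductWith _∷_ T (vecsOf S m)) G ≡ ∑[ a ∈ T ] (∑[ s ∈ vecsOf S m ] G (a ∷ s))
  go []      = refl
  go (a ∷ T) = trans (∑-++ (map (a ∷_) (vecsOf S m)) _ G) (cong₂ _+_ (∑-map (a ∷_) (vecsOf S m) G) (go T))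

length≡∑ : ∀ (xs : List A) → length xs ≡ ∑[ x ∈ xs ] 1
length≡∑ xs = sym (trans (∑-const xs 1) (*-identityʳ (length xs)))

length-vecsOf : ∀ (S : List A) n → length (vecsOf S n) ≡ length S ^ n
length-vecsOf S zero    = refl
length-vecsOf S (suc n) = begin
  length (vecsOf S (suc n))                 ≡⟨ length≡∑ (vecsOf S (suc n)) ⟩
  ∑ (vecsOf S (suc n)) (λ _ → 1)            ≡⟨ ∑-vecsOf S n (λ _ → 1) ⟩
  ∑ S (λ _ → ∑ (vecsOf S n) (λ _ → 1))      ≡⟨ ∑-const S _ ⟩
  length S * ∑ (vecsOf S n) (λ _ → 1)       ≡⟨ cong (length S *_) (length≡∑ (vecsOf S n)) ⟨
  length S * length (vecsOf S n)            ≡⟨ cong (length S *_) (length-vecsOf S n) ⟩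
  length S * length S ^ n                   ∎
  where open ≡-Reasoning

∈-vecsOf : ∀ {S : List A} {n} → (∀ a → a ∈ S) → (v : Vec A n) → v ∈ vecsOf S n
∈-vecsOf all []      = here refl
∈-vecsOf {S = S} {suc n} all (a ∷ v) =
  MembershipP.∈-cartesianProductWith⁺ _∷_ (all a) (∈-vecsOf all v)

vecsOf-unique : ∀ {S : List A} → Unique S → ∀ n → Unique (vecsOf S n)
vecsOf-unique u zero    = [] ∷ []
vecsOf-unique u (suc n) = UniqueP.cartesianProductWith⁺ _∷_ VecP.∷-injective u (vecsOf-unique u n)

-- The overwritten entry is summed over without being read, whence the factor `length S`.
∑-resample : ∀ (S : List A) {n} (i : Fin n) (G : Vec A n → ℕ) →
  ∑[ σ ∈ vecsOf S n ] (∑[ ρ ∈ S ] G (σ [ i ]≔ ρ)) ≡ length S * ∑ (vecsOf S n) G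
∑-resample S {suc n} zero G = begin
  ∑ (vecsOf S (suc n)) (λ σ → ∑[ ρ ∈ S ] G (σ [ zero ]≔ ρ))      ≡⟨ ∑-vecsOf S n _ ⟩
  ∑[ a ∈ S ] (∑[ s ∈ vecsOf S n ] (∑[ ρ ∈ S ] G (ρ ∷ s)))        ≡⟨ ∑-const S _ ⟩
  length S * (∑[ s ∈ vecsOf S n ] (∑[ ρ ∈ S ] G (ρ ∷ s)))        ≡⟨ cong (length S *_) (∑-swap (vecsOf S n) S _) ⟩
  length S * (∑[ ρ ∈ S ] (∑[ s ∈ vecsOf S n ] G (ρ ∷ s)))        ≡⟨ cong (length S *_) (∑-vecsOf S n G) ⟨
  length S * ∑ (vecsOf S (suc n)) G                              ∎
  where open ≡-Reasoning
∑-resample S {suc n} (suc i) G = begin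
  ∑ (vecsOf S (suc n)) (λ σ → ∑[ ρ ∈ S ] G (σ [ suc i ]≔ ρ))           ≡⟨ ∑-vecsOf S n _ ⟩
  ∑[ a ∈ S ] (∑[ s ∈ vecsOf S n ] (∑[ ρ ∈ S ] G (a ∷ (s [ i ]≔ ρ))))   ≡⟨ ∑-cong S (λ a → ∑-resample S i (G ∘ (a ∷_))) ⟩
  ∑[ a ∈ S ] (length S * ∑ (vecsOf S n) (G ∘ (a ∷_)))                  ≡⟨ ∑-*ˡ (length S) S _ ⟩
  length S * (∑[ a ∈ S ] ∑ (vecsOf S n) (G ∘ (a ∷_)))                  ≡⟨ cong (length S *_) (∑-vecsOf S n G) ⟨
  length S * ∑ (vecsOf S (suc n)) G                                    ∎
  where open ≡-Reasoning

∑-update : ∀ (S : List A) (g : A → A) → (∀ H → ∑ S (H ∘ g) ≡ ∑ S H) →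
  ∀ {n} (i : Fin n) (G : Vec A n → ℕ) → ∑[ σ ∈ vecsOf S n ] G (σ [ i ]≔ g (lookup σ i)) ≡ ∑ (vecsOf S n) G
∑-update S g pres {suc n} zero G =
  trans (∑-vecsOf S n _) (trans (pres (λ a → ∑[ s ∈ vecsOf S n ] G (a ∷ s))) (sym (∑-vecsOf S n G)))
∑-update S g pres {suc n} (suc i) G =
  trans (∑-vecsOf S n _) (trans (∑-cong S λ a → ∑-update S g pres i (G ∘ (a ∷_))) (sym (∑-vecsOf S n G)))

-- The hypothesis says that `T a a'` is uniform when `a` and `a'` are, and this passes to products
-- one coordinate at a time.
∑-zipWith : ∀ (S : List A) (T : A → A → A) → (∀ H → ∑[ a ∈ S ] (∑[ a' ∈ S ] H (T a a')) ≡ length S * ∑ S H) →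
  ∀ n (G : Vec A n → ℕ) →
  ∑[ σ ∈ vecsOf S n ] (∑[ σ' ∈ vecsOf S n ] G (zipWith T σ σ')) ≡ length S ^ n * ∑ (vecsOf S n) G
∑-zipWith S T pres zero    G = trans (+-identityʳ _) (sym (*-identityˡ _))
∑-zipWith S T pres (suc n) G = begin
  ∑ (vecsOf S (suc n)) (λ σ → ∑ (vecsOf S (suc n)) (λ σ' → G (zipWith T σ σ')))
    ≡⟨ ∑-vecsOf S n _ ⟩
  ∑[ a ∈ S ] (∑[ s ∈ V ] ∑ (vecsOf S (suc n)) (λ σ' → G (zipWith T (a ∷ s) σ')))
    ≡⟨ ∑-cong S (λ a → ∑-cong V λ s → ∑-vecsOf S n _) ⟩
  ∑[ a ∈ S ] (∑[ s ∈ V ] (∑[ a' ∈ S ] (∑[ s' ∈ V ] G (T a a' ∷ zipWith T s s'))))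
    ≡⟨ ∑-cong S (λ a → ∑-swap V S _) ⟩
  ∑[ a ∈ S ] (∑[ a' ∈ S ] (∑[ s ∈ V ] (∑[ s' ∈ V ] G (T a a' ∷ zipWith T s s'))))
    ≡⟨ pres (λ b → ∑[ s ∈ V ] (∑[ s' ∈ V ] G (b ∷ zipWith T s s'))) ⟩
  length S * (∑[ b ∈ S ] (∑[ s ∈ V ] (∑[ s' ∈ V ] G (b ∷ zipWith T s s'))))
    ≡⟨ cong (length S *_) (∑-cong S λ b → ∑-zipWith S T pres n (G ∘ (b ∷_))) ⟩
  length S * (∑[ b ∈ S ] (length S ^ n * ∑ V (G ∘ (b ∷_))))
    ≡⟨ cong (length S *_) (∑-*ˡ (length S ^ n) S _) ⟩
  length S * (length S ^ n * (∑[ b ∈ S ] ∑ V (G ∘ (b ∷_))))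
    ≡⟨ *-assoc (length S) (length S ^ n) _ ⟨
  length S ^ suc n * (∑[ b ∈ S ] ∑ V (G ∘ (b ∷_)))
    ≡⟨ cong (length S ^ suc n *_) (∑-vecsOf S n G) ⟨
  length S ^ suc n * ∑ (vecsOf S (suc n)) G ∎
  where
  open ≡-Reasoning
  V = vecsOf S n

module _ {B : Set} (_≟_ : DecidableEquality B) where

  ≢-indicator : B → B → ℕ
  ≢-indicator x y = 𝟙 (¬? (x ≟ y))

  ≢-indicator-triangle : ∀ x y z → ≢-indicator x z ≤ ≢-indicator x y + ≢-indicator y z
  ≢-indicator-triangle x y z = 𝟙-bound (¬? (x ≟ z)) λ x≢z eq0 → x≢z (trans
    (equal x y (m+n≡0⇒m≡0 _ eq0)) (equal y z (m+n≡0⇒n≡0 (≢-indicator x y) eq0)))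
    where
    equal : ∀ x y → ≢-indicator x y ≡ 0 → x ≡ y
    equal x y eq with x ≟ y
    ... | yes x≡y = x≡y

  -- Replacing the coordinates of σ one at a time, each intermediate profile is again uniformly distributed.
  hybrid : ∀ {A I : Set} (S : List A) (T : A → A → A) (idx : List I) (act : I → A → A)
    (W : I → A → ℕ) (c : ℕ) →
    (∀ H → ∑[ a ∈ S ] (∑[ a' ∈ S ] H (T a a')) ≡ length S * ∑ S H) →
    (∀ (H : A → B) → ∑[ a ∈ S ] (∑[ a' ∈ S ] ≢-indicator (H a) (H (T a a')))
       ≤ length S * (c * (∑[ t ∈ idx ] (∑[ a ∈ S ] (W t a * ≢-indicator (H a) (H (act t a))))))) →
    ∀ n (F : Vec A n → B) →
    ∑[ σ ∈ vecsOf S n ] (∑[ σ' ∈ vecsOf S n ] ≢-indicator (F σ) (F (zipWith T σ σ')))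
    ≤ length S ^ n * (c * (∑[ l ∈ allFin n ] (∑[ t ∈ idx ] (∑[ σ ∈ vecsOf S n ]
        (W t (lookup σ l) * ≢-indicator (F σ) (F (σ [ l ]≔ act t (lookup σ l))))))))
  hybrid S T idx act W c pres one zero F with F [] ≟ F []
  ... | yes _ = z≤n
  ... | no ≢ = contradiction refl ≢
  hybrid {A} {I} S T idx act W c pres one (suc n) F = begin
    ∑ (vecsOf S (suc n)) (λ σ → ∑ (vecsOf S (suc n)) (λ σ' → ne (F σ) (F (zipWith T σ σ'))))
      ≡⟨ ∑-vecsOf S n _ ⟩
    ∑[ a ∈ S ] (∑[ s ∈ V ] ∑ (vecsOf S (suc n)) (λ σ' → ne (F (a ∷ s)) (F (zipWith T (a ∷ s) σ'))))
      ≡⟨ ∑-cong S (λ a → ∑-cong V λ s → ∑-vecsOf S n _) ⟩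
    ∑[ a ∈ S ] (∑[ s ∈ V ] (∑[ a' ∈ S ] (∑[ s' ∈ V ] ne (F (a ∷ s)) (F (T a a' ∷ zipWith T s s')))))
      -- The intermediate profile has only its first entry replaced: `head` changes one coordinate
      -- over a fixed `s`, `tail` changes the others over a fixed new entry.
      ≤⟨ ∑-mono S (λ a → ∑-mono V λ s → ∑-mono S λ a' → ∑-mono V λ s' → ≢-indicator-triangle _ (F (T a a' ∷ s)) _) ⟩
    ∑[ a ∈ S ] (∑[ s ∈ V ] (∑[ a' ∈ S ] (∑[ s' ∈ V ] (head a s a' + tail a s a' s'))))
      ≡⟨ ∑-cong S (λ a → ∑-cong V λ s → ∑-cong S λ a' → ∑-+ V _ _) ⟩
    ∑[ a ∈ S ] (∑[ s ∈ V ] (∑[ a' ∈ S ] ((∑[ s' ∈ V ] head a s a') + (∑[ s' ∈ V ] tail a s a' s'))))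
      ≡⟨ ∑-cong S (λ a → ∑-cong V λ s → ∑-+ S _ _) ⟩
    ∑[ a ∈ S ] (∑[ s ∈ V ] ((∑[ a' ∈ S ] (∑[ s' ∈ V ] head a s a')) + (∑[ a' ∈ S ] (∑[ s' ∈ V ] tail a s a' s'))))
      ≡⟨ ∑-cong S (λ a → ∑-+ V _ _) ⟩
    ∑[ a ∈ S ] ((∑[ s ∈ V ] (∑[ a' ∈ S ] (∑[ s' ∈ V ] head a s a'))) + (∑[ s ∈ V ] (∑[ a' ∈ S ] (∑[ s' ∈ V ] tail a s a' s'))))
      ≡⟨ ∑-+ S _ _ ⟩
    (∑[ a ∈ S ] (∑[ s ∈ V ] (∑[ a' ∈ S ] (∑[ s' ∈ V ] head a s a'))))
      + (∑[ a ∈ S ] (∑[ s ∈ V ] (∑[ a' ∈ S ] (∑[ s' ∈ V ] tail a s a' s'))))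
      ≤⟨ +-mono-≤ head-bound tail-bound ⟩
    K * (c * first) + K * (c * rest)
      ≡⟨ *-distribˡ-+ K (c * first) (c * rest) ⟨
    K * (c * first + c * rest)
      ≡⟨ cong (K *_) (*-distribˡ-+ c first rest) ⟨
    K * (c * (first + rest))
      ≡⟨ cong (λ z → K * (c * z)) (∑-allFin n _) ⟨
    K * (c * (∑[ l ∈ allFin (suc n) ] (∑[ t ∈ idx ] (∑[ σ ∈ vecsOf S (suc n) ]
        (W t (lookup σ l) * ne (F σ) (F (σ [ l ]≔ act t (lookup σ l)))))))) ∎
    where
    open ≤-Reasoning
    V = vecsOf S n
    K = length S ^ suc n
    ne = ≢-indicator
    head : A → Vec A n → A → ℕ
    head a s a' = ne (F (a ∷ s)) (F (T a a' ∷ s))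
    tail : A → Vec A n → A → Vec A n → ℕ
    tail a s a' s' = ne (F (T a a' ∷ s)) (F (T a a' ∷ zipWith T s s'))
    first = ∑[ t ∈ idx ] (∑[ σ ∈ vecsOf S (suc n) ] (W t (lookup σ zero) * ne (F σ) (F (σ [ zero ]≔ act t (lookup σ zero)))))
    rest = ∑[ l ∈ allFin n ] (∑[ t ∈ idx ] (∑[ σ ∈ vecsOf S (suc n) ]
        (W t (lookup σ (suc l)) * ne (F σ) (F (σ [ suc l ]≔ act t (lookup σ (suc l)))))))

    edge : Vec A n → I → A → ℕ
    edge s t a = W t a * ne (F (a ∷ s)) (F (act t a ∷ s))

    head-bound : ∑[ a ∈ S ] (∑[ s ∈ V ] (∑[ a' ∈ S ] (∑[ s' ∈ V ] head a s a'))) ≤ K * (c * first)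
    head-bound = begin
      ∑[ a ∈ S ] (∑[ s ∈ V ] (∑[ a' ∈ S ] (∑[ s' ∈ V ] head a s a')))
        ≡⟨ ∑-swap S V _ ⟩
      ∑[ s ∈ V ] (∑[ a ∈ S ] (∑[ a' ∈ S ] (∑[ s' ∈ V ] head a s a')))
        ≡⟨ ∑-cong V (λ s → ∑-cong S λ a → trans (∑-cong S λ a' → ∑-const V _) (∑-*ˡ (length V) S _)) ⟩
      ∑[ s ∈ V ] (∑[ a ∈ S ] (length V * (∑[ a' ∈ S ] head a s a')))
        ≡⟨ ∑-cong V (λ s → ∑-*ˡ (length V) S _) ⟩
      ∑[ s ∈ V ] (length V * (∑[ a ∈ S ] (∑[ a' ∈ S ] head a s a')))
        ≡⟨ ∑-*ˡ (length V) V _ ⟩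
      length V * (∑[ s ∈ V ] (∑[ a ∈ S ] (∑[ a' ∈ S ] head a s a')))
        ≤⟨ *-monoʳ-≤ (length V) (∑-mono V λ s → one (λ a → F (a ∷ s))) ⟩
      length V * (∑[ s ∈ V ] (length S * (c * (∑[ t ∈ idx ] (∑[ a ∈ S ] edge s t a)))))
        ≡⟨ cong (length V *_) (∑-*ˡ (length S) V _) ⟩
      length V * (length S * (∑[ s ∈ V ] (c * (∑[ t ∈ idx ] (∑[ a ∈ S ] edge s t a)))))
        ≡⟨ cong (λ z → length V * (length S * z)) (∑-*ˡ c V _) ⟩
      length V * (length S * (c * (∑[ s ∈ V ] (∑[ t ∈ idx ] (∑[ a ∈ S ] edge s t a)))))
        ≡⟨ cong (λ z → length V * (length S * (c * z))) (trans (∑-swap V idx _) (∑-cong idx λ t →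
             trans (∑-swap V S _) (sym (∑-vecsOf S n _)))) ⟩
      length V * (length S * (c * first))
        ≡⟨ *-assoc (length V) (length S) _ ⟨
      length V * length S * (c * first)
        ≡⟨ cong (_* (c * first)) (trans (*-comm (length V) (length S)) (cong (length S *_) (length-vecsOf S n))) ⟩
      K * (c * first) ∎

    later : A → ℕ
    later b = ∑[ l ∈ allFin n ] (∑[ t ∈ idx ] (∑[ s ∈ V ]
        (W t (lookup s l) * ne (F (b ∷ s)) (F (b ∷ (s [ l ]≔ act t (lookup s l)))))))

    later-sum : ∑[ b ∈ S ] later b ≡ rest
    later-sum = trans (∑-swap S (allFin n) _) (∑-cong (allFin n) λ l →
      trans (∑-swap S idx _) (∑-cong idx λ t → sym (∑-vecsOf S n _)))

    tail-bound : ∑[ a ∈ S ] (∑[ s ∈ V ] (∑[ a' ∈ S ] (∑[ s' ∈ V ] tail a s a' s'))) ≤ K * (c * rest)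
    tail-bound = begin
      ∑[ a ∈ S ] (∑[ s ∈ V ] (∑[ a' ∈ S ] (∑[ s' ∈ V ] tail a s a' s')))
        ≡⟨ ∑-cong S (λ a → ∑-swap V S _) ⟩
      ∑[ a ∈ S ] (∑[ a' ∈ S ] (∑[ s ∈ V ] (∑[ s' ∈ V ] tail a s a' s')))
        -- The new first entry is again uniform, so it can be renamed `b` and frozen for the
        -- induction.
        ≡⟨ pres (λ b → ∑[ s ∈ V ] (∑[ s' ∈ V ] ne (F (b ∷ s)) (F (b ∷ zipWith T s s')))) ⟩
      length S * (∑[ b ∈ S ] (∑[ s ∈ V ] (∑[ s' ∈ V ] ne (F (b ∷ s)) (F (b ∷ zipWith T s s')))))
        ≤⟨ *-monoʳ-≤ (length S) (∑-mono S λ b → hybrid S T idx act W c pres one n (F ∘ (b ∷_))) ⟩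
      length S * (∑[ b ∈ S ] (length S ^ n * (c * later b)))
        ≡⟨ cong (length S *_) (∑-*ˡ (length S ^ n) S _) ⟩
      length S * (length S ^ n * (∑[ b ∈ S ] (c * later b)))
        ≡⟨ *-assoc (length S) (length S ^ n) _ ⟨
      K * (∑[ b ∈ S ] (c * later b))
        ≡⟨ cong (K *_) (trans (∑-*ˡ c S later) (cong (c *_) later-sum)) ⟩
      K * (c * rest) ∎

-- Reverse hypercontractivity

2xy≤x²+y² : ∀ x y → 2 * (x * y) ≤ x * x + y * y
2xy≤x²+y² x y = [ ordered , (λ y≤x → subst₂ _≤_ (cong (2 *_) (*-comm y x)) (+-comm (y * y) (x * x)) (ordered y≤x)) ]′
  (≤-total x y)
  where
  expand : ∀ x d → 2 * (x * (x + d)) + d * d ≡ x * x + (x + d) * (x + d)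
  expand = solve-∀
  ordered : ∀ {x y} → x ≤ y → 2 * (x * y) ≤ x * x + y * y
  ordered {x} {y} x≤y = subst (λ y → 2 * (x * y) ≤ x * x + y * y) (m+[n∸m]≡n x≤y)
    (≤-trans (m≤m+n _ _) (≤-reflexive (expand x (y ∸ x))))

-- Stands in for subtraction: the difference of `l` and `r` is that of `d` and `c`, so an inequality
-- by sums of squares becomes a ring identity over `ℕ`.
≤-from-excess : ∀ {l r c d} → l + c ≡ r + d → c ≤ d → r ≤ l
≤-from-excess {l} {r} {c} {d} eq c≤d = +-cancelʳ-≤ d r l (≤-trans (≤-reflexive (sym eq)) (+-monoʳ-≤ l c≤d))

-- The difference of the two sides is 4 (p₁q₁ − p₀q₀)² + (p₁ − p₀)² (q₁ − q₀)².
two-point-extreme : ∀ p₁ p₀ q₁ q₀ →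
  (p₁ + p₀) * (p₁ + p₀) * ((q₁ + q₀) * (q₁ + q₀)) ≤
  6 * (p₁ * p₁ * (q₁ * q₁) + p₀ * p₀ * (q₀ * q₀)) + 2 * (p₁ * p₁ * (q₀ * q₀) + p₀ * p₀ * (q₁ * q₁))
two-point-extreme p₁ p₀ q₁ q₀ = ≤-from-excess (identity p₁ p₀ q₁ q₀)
  (+-mono-≤ (*-monoʳ-≤ 4 (2xy≤x²+y² (p₁ * q₁) (p₀ * q₀)))
            (2xy≤x²+y² (p₁ * q₁ + p₀ * q₀) (p₁ * q₀ + p₀ * q₁)))
  where
  identity : ∀ p₁ p₀ q₁ q₀ →
    6 * (p₁ * p₁ * (q₁ * q₁) + p₀ * p₀ * (q₀ * q₀)) + 2 * (p₁ * p₁ * (q₀ * q₀) + p₀ * p₀ * (q₁ * q₁))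
      + (4 * (2 * (p₁ * q₁ * (p₀ * q₀))) + 2 * ((p₁ * q₁ + p₀ * q₀) * (p₁ * q₀ + p₀ * q₁)))
    ≡ (p₁ + p₀) * (p₁ + p₀) * ((q₁ + q₀) * (q₁ + q₀))
      + (4 * (p₁ * q₁ * (p₁ * q₁) + p₀ * q₀ * (p₀ * q₀))
         + ((p₁ * q₁ + p₀ * q₀) * (p₁ * q₁ + p₀ * q₀) + (p₁ * q₀ + p₀ * q₁) * (p₁ * q₀ + p₀ * q₁)))
  identity = solve-∀

-- Both sides are linear in the weights (a, b), and the admissible weights form the cone spanned by
-- (3, 1) and (1, 3), the correlations 1/2 and -1/2. Since 8 (a, b) = u (3, 1) + v (1, 3), the two
-- extreme cases suffice; they differ by exchanging `q₁` and `q₀`.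
two-point : ∀ a b p₁ p₀ q₁ q₀ → a ≤ 3 * b → b ≤ 3 * a →
  (a + b) * ((p₁ + p₀) * (p₁ + p₀) * ((q₁ + q₀) * (q₁ + q₀))) ≤
  8 * (a * (p₁ * p₁ * (q₁ * q₁) + p₀ * p₀ * (q₀ * q₀)) + b * (p₁ * p₁ * (q₀ * q₀) + p₀ * p₀ * (q₁ * q₁)))
two-point a b p₁ p₀ q₁ q₀ a≤3b b≤3a = *-cancelˡ-≤ 2 (begin
  2 * ((a + b) * r)                              ≡⟨ left a b u v r (m∸n+n≡m b≤3a) (m∸n+n≡m a≤3b) ⟩
  u * r + v * r                                  ≤⟨ +-mono-≤ (*-monoʳ-≤ u (two-point-extreme p₁ p₀ q₁ q₀)) (*-monoʳ-≤ v flipped) ⟩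
  u * (6 * x + 2 * y) + v * (6 * y + 2 * x)      ≡⟨ right a b u v x y (m∸n+n≡m b≤3a) (m∸n+n≡m a≤3b) ⟩
  2 * (8 * (a * x + b * y))                      ∎)
  where
  open ≤-Reasoning
  r = (p₁ + p₀) * (p₁ + p₀) * ((q₁ + q₀) * (q₁ + q₀))
  x = p₁ * p₁ * (q₁ * q₁) + p₀ * p₀ * (q₀ * q₀)
  y = p₁ * p₁ * (q₀ * q₀) + p₀ * p₀ * (q₁ * q₁)
  u = 3 * a ∸ b
  v = 3 * b ∸ a
  flipped : r ≤ 6 * y + 2 * x
  flipped = subst (λ z → (p₁ + p₀) * (p₁ + p₀) * (z * z) ≤ 6 * y + 2 * x) (+-comm q₀ q₁) (two-point-extreme p₁ p₀ q₀ q₁)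
  left : ∀ a b u v r → u + b ≡ 3 * a → v + a ≡ 3 * b → 2 * ((a + b) * r) ≡ u * r + v * r
  left a b u v r e₁ e₂ = +-cancelʳ-≡ ((a + b) * r) _ _ (begin-equality
    2 * ((a + b) * r) + (a + b) * r    ≡⟨ s₁ a b r ⟩
    (3 * a + 3 * b) * r                ≡⟨ cong (_* r) (cong₂ _+_ e₁ e₂) ⟨
    (u + b + (v + a)) * r              ≡⟨ s₂ a b u v r ⟩
    u * r + v * r + (a + b) * r        ∎)
    where
    s₁ : ∀ a b r → 2 * ((a + b) * r) + (a + b) * r ≡ (3 * a + 3 * b) * r
    s₁ = solve-∀
    s₂ : ∀ a b u v r → (u + b + (v + a)) * r ≡ u * r + v * r + (a + b) * r
    s₂ = solve-∀
  right : ∀ a b u v x y → u + b ≡ 3 * a → v + a ≡ 3 * b →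
    u * (6 * x + 2 * y) + v * (6 * y + 2 * x) ≡ 2 * (8 * (a * x + b * y))
  right a b u v x y e₁ e₂ = +-cancelʳ-≡ (b * (6 * x + 2 * y) + a * (6 * y + 2 * x)) _ _ (begin-equality
    u * (6 * x + 2 * y) + v * (6 * y + 2 * x) + (b * (6 * x + 2 * y) + a * (6 * y + 2 * x))
      ≡⟨ s₁ a b u v x y ⟩
    (u + b) * (6 * x + 2 * y) + (v + a) * (6 * y + 2 * x)
      ≡⟨ cong₂ (λ s t → s * (6 * x + 2 * y) + t * (6 * y + 2 * x)) e₁ e₂ ⟩
    3 * a * (6 * x + 2 * y) + 3 * b * (6 * y + 2 * x)
      ≡⟨ s₂ a b x y ⟩
    2 * (8 * (a * x + b * y)) + (b * (6 * x + 2 * y) + a * (6 * y + 2 * x)) ∎)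
    where
    s₁ : ∀ a b u v x y → u * (6 * x + 2 * y) + v * (6 * y + 2 * x) + (b * (6 * x + 2 * y) + a * (6 * y + 2 * x))
      ≡ (u + b) * (6 * x + 2 * y) + (v + a) * (6 * y + 2 * x)
    s₁ = solve-∀
    s₂ : ∀ a b x y → 3 * a * (6 * x + 2 * y) + 3 * b * (6 * y + 2 * x)
      ≡ 2 * (8 * (a * x + b * y)) + (b * (6 * x + 2 * y) + a * (6 * y + 2 * x))
    s₂ = solve-∀

module _ {A : Set} (S : List A) (α β : A → Bool) where

  count : Bool → Bool → ℕ
  count x y = ∑[ a ∈ S ] (𝟙 (α a Bool.≟ x) * 𝟙 (β a Bool.≟ y))

  ∑-by-bits : ∀ (G : Bool → Bool → ℕ) → ∑[ a ∈ S ] G (α a) (β a) ≡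
    count true true * G true true + count true false * G true false
    + (count false true * G false true + count false false * G false false)
  ∑-by-bits G = begin
    ∑[ a ∈ S ] G (α a) (β a)
      ≡⟨ ∑-cong S (λ a → pointwise (α a) (β a)) ⟩
    ∑[ a ∈ S ] (t true true a + t true false a + (t false true a + t false false a))
      ≡⟨ ∑-+ S _ _ ⟩
    (∑[ a ∈ S ] (t true true a + t true false a)) + (∑[ a ∈ S ] (t false true a + t false false a))
      ≡⟨ cong₂ _+_ (∑-+ S _ _) (∑-+ S _ _) ⟩
    ∑ S (t true true) + ∑ S (t true false) + (∑ S (t false true) + ∑ S (t false false))
      ≡⟨ cong₂ _+_ (cong₂ _+_ (∑-*ʳ S _ _) (∑-*ʳ S _ _)) (cong₂ _+_ (∑-*ʳ S _ _) (∑-*ʳ S _ _)) ⟩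
    count true true * G true true + count true false * G true false
      + (count false true * G false true + count false false * G false false) ∎
    where
    open ≡-Reasoning
    t : Bool → Bool → A → ℕ
    t x y a = 𝟙 (α a Bool.≟ x) * 𝟙 (β a Bool.≟ y) * G x y
    pointwise : ∀ p q → G p q ≡
      𝟙 (p Bool.≟ true) * 𝟙 (q Bool.≟ true) * G true true + 𝟙 (p Bool.≟ true) * 𝟙 (q Bool.≟ false) * G true false
      + (𝟙 (p Bool.≟ false) * 𝟙 (q Bool.≟ true) * G false true + 𝟙 (p Bool.≟ false) * 𝟙 (q Bool.≟ false) * G false false)
    pointwise true  true  = sym (trans (+-identityʳ _) (trans (+-identityʳ _) (+-identityʳ _)))
    pointwise true  false = sym (trans (+-identityʳ _) (+-identityʳ _))
    pointwise false true  = sym (trans (+-identityʳ _) (+-identityʳ _))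
    pointwise false false = sym (+-identityʳ _)

  -- Two unbiased bits whose correlation lies in [−1/2, 1/2], the range in which p = q = 1/2 is admissible
  -- in the reverse hypercontractive inequality.
  record Balanced : Set where
    field
      agree    : count true true ≡ count false false
      disagree : count true false ≡ count false true
      agree≤   : count true true ≤ 3 * count true false
      disagree≤ : count true false ≤ 3 * count true true

  module _ (bal : Balanced) where
    open Balanced bal
    private
      m = count true true
      d = count true false
      N = length S

    ∑-balanced : ∀ (G : Bool → Bool → ℕ) →
      ∑[ a ∈ S ] G (α a) (β a) ≡ m * (G true true + G false false) + d * (G true false + G false true)
    ∑-balanced G = trans (∑-by-bits G)
      (trans (cong₂ (λ x y → m * G true true + d * G true false + (x * G false true + y * G false false))
                    (sym disagree) (sym agree))
             (regroup m d (G true true) (G true false) (G false true) (G false false)))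
      where
      regroup : ∀ m d g₁ g₂ g₃ g₄ → m * g₁ + d * g₂ + (d * g₃ + m * g₄) ≡ m * (g₁ + g₄) + d * (g₂ + g₃)
      regroup = solve-∀

    one-voter-reverse : ∀ (P Q : Bool → ℕ) →
      ∑ S (P ∘ α) * ∑ S (P ∘ α) * (∑ S (Q ∘ β) * ∑ S (Q ∘ β))
      ≤ N * N * N * (∑[ a ∈ S ] (P (α a) * P (α a) * (Q (β a) * Q (β a))))
    one-voter-reverse P Q = begin
      ∑ S (P ∘ α) * ∑ S (P ∘ α) * (∑ S (Q ∘ β) * ∑ S (Q ∘ β))
        ≡⟨ cong₂ (λ s t → s * s * (t * t)) (trans (∑-balanced (λ x _ → P x)) (left m d p₁ p₀)) (trans (∑-balanced (λ _ y → Q y)) (right m d q₁ q₀)) ⟩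
      (m + d) * (p₁ + p₀) * ((m + d) * (p₁ + p₀)) * ((m + d) * (q₁ + q₀) * ((m + d) * (q₁ + q₀)))
        ≡⟨ pull (m + d) (p₁ + p₀) (q₁ + q₀) ⟩
      (m + d) * (m + d) * (m + d) * ((m + d) * ((p₁ + p₀) * (p₁ + p₀) * ((q₁ + q₀) * (q₁ + q₀))))
        ≤⟨ *-monoʳ-≤ ((m + d) * (m + d) * (m + d)) (two-point m d p₁ p₀ q₁ q₀ agree≤ disagree≤) ⟩
      (m + d) * (m + d) * (m + d) * (8 * (m * x + d * y))
        -- The factor 8 of `two-point` is what turns the cube of m + d into that of N = 2 (m + d),
        -- so the inequality has constant 1 and tensorises.
        ≡⟨ eight (m + d) (m * x + d * y) ⟩
      2 * (m + d) * (2 * (m + d)) * (2 * (m + d)) * (m * x + d * y)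
        ≡⟨ cong₂ (λ z w → z * z * z * w) N≡ (∑-balanced (λ x y → P x * P x * (Q y * Q y))) ⟨
      N * N * N * (∑[ a ∈ S ] (P (α a) * P (α a) * (Q (β a) * Q (β a)))) ∎
      where
      open ≤-Reasoning
      p₁ = P true
      p₀ = P false
      q₁ = Q true
      q₀ = Q false
      x = p₁ * p₁ * (q₁ * q₁) + p₀ * p₀ * (q₀ * q₀)
      y = p₁ * p₁ * (q₀ * q₀) + p₀ * p₀ * (q₁ * q₁)
      left : ∀ m d p₁ p₀ → m * (p₁ + p₀) + d * (p₁ + p₀) ≡ (m + d) * (p₁ + p₀)
      left = solve-∀
      right : ∀ m d p₁ p₀ → m * (p₁ + p₀) + d * (p₀ + p₁) ≡ (m + d) * (p₁ + p₀)
      right = solve-∀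
      pull : ∀ c s t → c * s * (c * s) * (c * t * (c * t)) ≡ c * c * c * (c * (s * s * (t * t)))
      pull = solve-∀
      eight : ∀ c z → c * c * c * (8 * z) ≡ 2 * c * (2 * c) * (2 * c) * z
      eight = solve-∀
      N≡ : N ≡ 2 * (m + d)
      N≡ = trans (length≡∑ S) (trans (∑-balanced (λ _ _ → 1)) (two m d))
        where
        two : ∀ m d → m * 2 + d * 2 ≡ 2 * (m + d)
        two = solve-∀

    -- The exponents are p = q = 1/2.
    reverse-hypercontractivity : ∀ n (U V : Vec Bool n → ℕ) →
      let sumU = ∑[ σ ∈ vecsOf S n ] U (Vec.map α σ)
          sumV = ∑[ σ ∈ vecsOf S n ] V (Vec.map β σ)
          K    = length S ^ n
      in sumU * sumU * (sumV * sumV) ≤ K * K * K *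
         (∑[ σ ∈ vecsOf S n ] (U (Vec.map α σ) * U (Vec.map α σ) * (V (Vec.map β σ) * V (Vec.map β σ))))
    reverse-hypercontractivity zero U V = ≤-reflexive (collapse (U []) (V []))
      where
      collapse : ∀ u v → (u + 0) * (u + 0) * ((v + 0) * (v + 0)) ≡ 1 * 1 * 1 * (u * u * (v * v) + 0)
      collapse = solve-∀
    reverse-hypercontractivity (suc n) U V = begin
      sumU * sumU * (sumV * sumV)
        ≡⟨ cong₂ (λ s t → s * s * (t * t)) (∑-vecsOf S n _) (∑-vecsOf S n _) ⟩
      ∑ S (φ ∘ α) * ∑ S (φ ∘ α) * (∑ S (ψ ∘ β) * ∑ S (ψ ∘ β))
        ≤⟨ one-voter-reverse φ ψ ⟩
      N * N * N * (∑[ a ∈ S ] (φ (α a) * φ (α a) * (ψ (β a) * ψ (β a))))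
        -- `φ` and `ψ` see the head only through its two bits; with these fixed, induction on the
        -- other coordinates bounds the product of their squares.
        ≤⟨ *-monoʳ-≤ (N * N * N) (∑-mono S λ a → reverse-hypercontractivity n (U ∘ (α a ∷_)) (V ∘ (β a ∷_))) ⟩
      N * N * N * (∑[ a ∈ S ] (K * K * K * inner a))
        ≡⟨ cong (N * N * N *_) (∑-*ˡ (K * K * K) S inner) ⟩
      N * N * N * (K * K * K * ∑ S inner)
        ≡⟨ cubes N K (∑ S inner) ⟩
      N * K * (N * K) * (N * K) * ∑ S inner
        ≡⟨ cong (N * K * (N * K) * (N * K) *_) (∑-vecsOf S n _) ⟨
      N * K * (N * K) * (N * K) *
         (∑[ σ ∈ vecsOf S (suc n) ] (U (Vec.map α σ) * U (Vec.map α σ) * (V (Vec.map β σ) * V (Vec.map β σ)))) ∎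
      where
      open ≤-Reasoning
      K = length S ^ n
      sumU = ∑[ σ ∈ vecsOf S (suc n) ] U (Vec.map α σ)
      sumV = ∑[ σ ∈ vecsOf S (suc n) ] V (Vec.map β σ)
      φ ψ : Bool → ℕ
      φ x = ∑[ s ∈ vecsOf S n ] U (x ∷ Vec.map α s)
      ψ y = ∑[ s ∈ vecsOf S n ] V (y ∷ Vec.map β s)
      inner : A → ℕ
      inner a = ∑[ s ∈ vecsOf S n ] (U (α a ∷ Vec.map α s) * U (α a ∷ Vec.map α s)
                                     * (V (β a ∷ Vec.map β s) * V (β a ∷ Vec.map β s)))
      cubes : ∀ n k z → n * n * n * (k * k * k * z) ≡ n * k * (n * k) * (n * k) * z
      cubes = solve-∀

-- Rankings and adjacent swaps

-- Exchanges the positions s and s + 1; the identity when s + 1 is out of range.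
swapAt : ∀ {n} → ℕ → Vec A n → Vec A n
swapAt zero    []          = []
swapAt zero    (x ∷ [])    = x ∷ []
swapAt zero    (x ∷ y ∷ v) = y ∷ x ∷ v
swapAt (suc s) []          = []
swapAt (suc s) (x ∷ v)     = x ∷ swapAt s v

swapHead : ∀ {n} → Fin n → Fin n
swapHead {suc zero}    p             = p
swapHead {suc (suc n)} zero          = suc zero
swapHead {suc (suc n)} (suc zero)    = zero
swapHead {suc (suc n)} (suc (suc p)) = suc (suc p)

swapFin : ∀ {n} → ℕ → Fin n → Fin n
swapFin zero    p       = swapHead p
swapFin (suc s) zero    = zero
swapFin (suc s) (suc p) = suc (swapFin s p)

lookup-swapAt : ∀ {n} s (v : Vec A n) p → lookup (swapAt s v) p ≡ lookup v (swapFin s p)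
lookup-swapAt zero    (x ∷ [])    zero          = refl
lookup-swapAt zero    (x ∷ y ∷ v) zero          = refl
lookup-swapAt zero    (x ∷ y ∷ v) (suc zero)    = refl
lookup-swapAt zero    (x ∷ y ∷ v) (suc (suc p)) = refl
lookup-swapAt (suc s) (x ∷ v)     zero          = refl
lookup-swapAt (suc s) (x ∷ v)     (suc p)       = lookup-swapAt s v p

swapFin-involutive : ∀ {n} s (p : Fin n) → swapFin s (swapFin s p) ≡ p
swapFin-involutive {suc zero}    zero    zero          = refl
swapFin-involutive {suc (suc n)} zero    zero          = refl
swapFin-involutive {suc (suc n)} zero    (suc zero)    = refl
swapFin-involutive {suc (suc n)} zero    (suc (suc p)) = refl
swapFin-involutive (suc s) zero          = refl
swapFin-involutive (suc s) (suc p)       = cong suc (swapFin-involutive s p)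

swapFin-lower : ∀ {n} s (p : Fin n) → toℕ p ≡ s → suc s < n → toℕ (swapFin s p) ≡ suc s
swapFin-lower {suc zero}    zero    p       e (s≤s ())
swapFin-lower {suc (suc n)} zero    zero    e _         = refl
swapFin-lower (suc s) (suc p) e (s≤s s<n) = cong suc (swapFin-lower s p (suc-injective e) s<n)

swapFin-raise : ∀ {n} s (p : Fin n) → toℕ p ≡ suc s → toℕ (swapFin s p) ≡ s
swapFin-raise {suc (suc n)} zero    (suc zero) e = refl
swapFin-raise (suc s) (suc p)    e = cong suc (swapFin-raise s p (suc-injective e))

swapFin-other : ∀ {n} s (p : Fin n) → toℕ p ≢ s → toℕ p ≢ suc s → swapFin s p ≡ p
swapFin-other {suc zero}    zero    zero          ne₁ ne₂ = refl
swapFin-other {suc (suc n)} zero    zero          ne₁ ne₂ = contradiction refl ne₁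
swapFin-other {suc (suc n)} zero    (suc zero)    ne₁ ne₂ = contradiction refl ne₂
swapFin-other {suc (suc n)} zero    (suc (suc p)) ne₁ ne₂ = refl
swapFin-other (suc s) zero          ne₁ ne₂ = refl
swapFin-other (suc s) (suc p)       ne₁ ne₂ =
  cong suc (swapFin-other s p (ne₁ ∘ cong suc) (ne₂ ∘ cong suc))

swapFin-order : ∀ {n} s {p q : Fin n} → toℕ p < toℕ q →
  (toℕ p ≡ s × toℕ q ≡ suc s) ⊎ toℕ (swapFin s p) < toℕ (swapFin s q)
swapFin-order {suc zero}    zero    {zero}        {zero}        ()
swapFin-order {suc (suc n)} zero    {zero}        {suc zero}    _   = inj₁ (refl , refl)
swapFin-order {suc (suc n)} zero    {zero}        {suc (suc q)} _   = inj₂ (s≤s (s≤s z≤n))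
swapFin-order {suc (suc n)} zero    {suc zero}    {suc zero}    (s≤s ())
swapFin-order {suc (suc n)} zero    {suc zero}    {suc (suc q)} _   = inj₂ (s≤s z≤n)
swapFin-order {suc (suc n)} zero    {suc (suc p)} {suc zero}    (s≤s ())
swapFin-order {suc (suc n)} zero    {suc (suc p)} {suc (suc q)} p<q = inj₂ p<q
swapFin-order (suc s) {zero}        {suc q}       _   = inj₂ (s≤s z≤n)
swapFin-order (suc s) {suc p}       {suc q}       (s≤s p<q) with swapFin-order s p<q
... | inj₁ (e₁ , e₂) = inj₁ (cong suc e₁ , cong suc e₂)
... | inj₂ lt        = inj₂ (s≤s lt)

swapAt-out : ∀ {n} s (v : Vec A n) → n ≤ s → swapAt s v ≡ v
swapAt-out zero    []          _         = refl
swapAt-out (suc s) []          _         = refl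
swapAt-out (suc s) (x ∷ v)     (s≤s n≤s) = cong (x ∷_) (swapAt-out s v n≤s)

swapAt-map : ∀ {n} s (g : A → B) (v : Vec A n) → swapAt s (Vec.map g v) ≡ Vec.map g (swapAt s v)
swapAt-map zero    g []          = refl
swapAt-map zero    g (x ∷ [])    = refl
swapAt-map zero    g (x ∷ y ∷ v) = refl
swapAt-map (suc s) g []          = refl
swapAt-map (suc s) g (x ∷ v)     = cong (g x ∷_) (swapAt-map s g v)

lookup-ext : ∀ {n} {v w : Vec A n} → (∀ p → lookup v p ≡ lookup w p) → v ≡ w
lookup-ext {v = []}    {[]}    eq = refl
lookup-ext {v = x ∷ v} {y ∷ w} eq = cong₂ _∷_ (eq zero) (lookup-ext (eq ∘ suc))

swap-distinct : ∀ s (v : Vec (Fin k) k) → AllDistinct v → AllDistinct (swapAt s v)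
swap-distinct s v dist p q eq = trans (sym (swapFin-involutive s p)) (trans (cong (swapFin s) swapped) (swapFin-involutive s q))
  where
  swapped : swapFin s p ≡ swapFin s q
  swapped = dist _ _ (trans (sym (lookup-swapAt s v p)) (trans eq (lookup-swapAt s v q)))

order-distinct : (ρ : Ranking k) → AllDistinct (order ρ)
order-distinct (mkRanking v dist) = recompute (allDistinct? v) dist

swap : ℕ → Ranking k → Ranking k
swap s ρ = mkRanking (swapAt s (order ρ)) (swap-distinct s (order ρ) (order-distinct ρ))

map-distinct : ∀ {g : Fin k → Fin k} → (∀ {x y} → g x ≡ g y → x ≡ y) →
  (v : Vec (Fin k) k) → AllDistinct v → AllDistinct (Vec.map g v)
map-distinct {g = g} inj v dist p q eq =
  dist p q (inj (trans (sym (VecP.lookup-map p g v)) (trans eq (VecP.lookup-map q g v))))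

relabel : (g : Fin k → Fin k) → (∀ {x y} → g x ≡ g y → x ≡ y) → Ranking k → Ranking k
relabel g inj ρ = mkRanking (Vec.map g (order ρ)) (map-distinct inj (order ρ) (order-distinct ρ))

order-injective : {ρ τ : Ranking k} → order ρ ≡ order τ → ρ ≡ τ
order-injective {ρ = mkRanking v _} {mkRanking .v _} refl = refl

-- If `y` were missed, punching it out would inject `Fin (suc n)` into `Fin n`.
injective⇒surjective : ∀ {n} (f : Fin n → Fin n) → (∀ {p q} → f p ≡ f q → p ≡ q) → ∀ y → ∃ λ p → f p ≡ y
injective⇒surjective {zero}  f inj ()
injective⇒surjective {suc n} f inj y with FinP.any? (λ p → f p Fin.≟ y)
... | yes hit = hit
... | no miss = contradiction
  (FinP.injective⇒≤ {f = λ p → Fin.punchOut (avoid p)} λ eq → inj (FinP.punchOut-injective (avoid _) (avoid _) eq))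
  1+n≰n
  where
  avoid : ∀ p → y ≢ f p
  avoid p eq = miss (p , sym eq)

abstract
  position : (ρ : Ranking k) → ∀ a → ∃ λ p → lookup (order ρ) p ≡ a
  position ρ = injective⇒surjective (lookup (order ρ)) (order-distinct ρ _ _)

pos : Ranking k → Fin k → Fin k
pos ρ a = proj₁ (position ρ a)

lookup-pos : ∀ (ρ : Ranking k) a → lookup (order ρ) (pos ρ a) ≡ a
lookup-pos ρ a = proj₂ (position ρ a)

pos-unique : ∀ (ρ : Ranking k) {a p} → lookup (order ρ) p ≡ a → pos ρ a ≡ p
pos-unique ρ {a} eq = order-distinct ρ _ _ (trans (lookup-pos ρ a) (sym eq))

rank : Ranking k → Fin k → ℕ
rank ρ a = toℕ (pos ρ a)

rank< : ∀ (ρ : Ranking k) a → rank ρ a < k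
rank< ρ a = toℕ<n (pos ρ a)

rank-injective : ∀ (ρ : Ranking k) {a b} → rank ρ a ≡ rank ρ b → a ≡ b
rank-injective ρ {a} {b} eq =
  trans (sym (lookup-pos ρ a)) (trans (cong (lookup (order ρ)) (toℕ-injective eq)) (lookup-pos ρ b))

rank⇒prefers : ∀ (ρ : Ranking k) {a b} → rank ρ a < rank ρ b → Prefers ρ a b
rank⇒prefers ρ {a} {b} lt = pos ρ a , pos ρ b , lt , lookup-pos ρ a , lookup-pos ρ b

rank-ext : ∀ {ρ τ : Ranking k} → (∀ a → rank ρ a ≡ rank τ a) → ρ ≡ τ
rank-ext {ρ = ρ} {τ} same = order-injective (lookup-ext λ p →
  sym (trans (cong (lookup (order τ)) (sym (trans (toℕ-injective (sym (same _))) (pos-unique ρ refl)))) (lookup-pos τ _)))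

pos-swap : ∀ s (ρ : Ranking k) a → pos (swap s ρ) a ≡ swapFin s (pos ρ a)
pos-swap s ρ a = pos-unique (swap s ρ) (trans (lookup-swapAt s (order ρ) (swapFin s (pos ρ a)))
  (trans (cong (lookup (order ρ)) (swapFin-involutive s (pos ρ a))) (lookup-pos ρ a)))

rank-relabel : ∀ (g : Fin k → Fin k) (inj : ∀ {x y} → g x ≡ g y → x ≡ y) ρ a → rank (relabel g inj ρ) (g a) ≡ rank ρ a
rank-relabel g inj ρ a = cong toℕ (pos-unique (relabel g inj ρ)
  (trans (VecP.lookup-map (pos ρ a) g (order ρ)) (cong g (lookup-pos ρ a))))

module _ (s : ℕ) (ρ : Ranking k) where

  rank-swap-lower : ∀ {a} → rank ρ a ≡ s → suc s < k → rank (swap s ρ) a ≡ suc s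
  rank-swap-lower {a} e lt = trans (cong toℕ (pos-swap s ρ a)) (swapFin-lower s (pos ρ a) e lt)

  rank-swap-raise : ∀ {a} → rank ρ a ≡ suc s → rank (swap s ρ) a ≡ s
  rank-swap-raise {a} e = trans (cong toℕ (pos-swap s ρ a)) (swapFin-raise s (pos ρ a) e)

  rank-swap-other : ∀ {a} → rank ρ a ≢ s → rank ρ a ≢ suc s → rank (swap s ρ) a ≡ rank ρ a
  rank-swap-other {a} n₁ n₂ = cong toℕ (trans (pos-swap s ρ a) (swapFin-other s (pos ρ a) n₁ n₂))

  rank-swap-order : ∀ {a b} → rank ρ a < rank ρ b →
    (rank ρ a ≡ s × rank ρ b ≡ suc s) ⊎ rank (swap s ρ) a < rank (swap s ρ) b
  rank-swap-order {a} {b} lt with swapFin-order s {pos ρ a} {pos ρ b} lt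
  ... | inj₁ adjacent = inj₁ adjacent
  ... | inj₂ lt′ = inj₂ (subst₂ (λ x y → toℕ x < toℕ y) (sym (pos-swap s ρ a)) (sym (pos-swap s ρ b)) lt′)

  swap-involutive : swap s (swap s ρ) ≡ ρ
  swap-involutive = rank-ext λ a → cong toℕ
    (trans (pos-swap s (swap s ρ) a) (trans (cong (swapFin s) (pos-swap s ρ a)) (swapFin-involutive s (pos ρ a))))

  swap-relabel : ∀ (g : Fin k → Fin k) (inj : ∀ {x y} → g x ≡ g y → x ≡ y) → swap s (relabel g inj ρ) ≡ relabel g inj (swap s ρ)
  swap-relabel g inj = order-injective (swapAt-map s g (order ρ))

  -- The window starting at `s` contains both positions that move. All manipulations produced below
  -- are adjacent swaps, and this is how they count towards M_4.
  swap-window : s < k → WindowPerm 4 ρ (swap s ρ)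
  swap-window s<k = fromℕ< (m<n⇒m<1+n s<k) , λ p outside →
    sym (trans (lookup-swapAt s (order ρ) p) (cong (lookup (order ρ)) (fixed p outside)))
    where
    at-s : toℕ (fromℕ< (m<n⇒m<1+n s<k)) ≡ s
    at-s = toℕ-fromℕ< (m<n⇒m<1+n s<k)
    fixed : ∀ p → toℕ p < toℕ (fromℕ< (m<n⇒m<1+n s<k)) ⊎ toℕ (fromℕ< (m<n⇒m<1+n s<k)) + 4 ≤ toℕ p → swapFin s p ≡ p
    fixed p outside rewrite at-s with outside
    ... | inj₁ p<s   = swapFin-other s p (<⇒≢ p<s) (<⇒≢ (m<n⇒m<1+n p<s))
    ... | inj₂ s+4≤p = swapFin-other s p (>⇒≢ (≤-trans (m<m+n s (s≤s z≤n)) s+4≤p))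
        (>⇒≢ (≤-trans (≤-reflexive (+-comm 2 s)) (≤-trans (+-monoʳ-≤ s (s≤s (s≤s z≤n))) s+4≤p)))

swap-injective : ∀ s {ρ τ : Ranking k} → swap s ρ ≡ swap s τ → ρ ≡ τ
swap-injective s {ρ} {τ} eq = trans (sym (swap-involutive s ρ)) (trans (cong (swap s) eq) (swap-involutive s τ))

relabel-injective : ∀ (g : Fin k → Fin k) (inj : ∀ {x y} → g x ≡ g y → x ≡ y) {ρ τ} →
  relabel g inj ρ ≡ relabel g inj τ → ρ ≡ τ
relabel-injective g inj {ρ} {τ} eq = rank-ext λ a →
  trans (sym (rank-relabel g inj ρ a)) (trans (cong (λ r → rank r (g a)) eq) (rank-relabel g inj τ a))

∈-Sk : ∀ (ρ : Ranking k) → ρ ∈ Sk k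
∈-Sk {k} ρ = AnyP.mapMaybe⁺ toRanking (vecsOf (allFin k) k)
  (AnyP.map⁺ (Any.map (λ where refl → found) (∈-vecsOf MembershipP.∈-allFin (order ρ))))
  where
  found : MaybeAny (ρ ≡_) (toRanking (order ρ))
  found with allDistinct? (order ρ)
  ... | yes _ = just refl
  ... | no ¬d = contradiction (order-distinct ρ) ¬d

-- The order vector recovers the argument of `toRanking`, so different vectors never give equal
-- rankings.
Sk-unique : ∀ k → Unique (Sk k)
Sk-unique k = mapMaybe-unique (vecsOf-unique (UniqueP.allFin⁺ k) k)
  where
  order-toRanking : ∀ (v : Vec (Fin k) k) {ρ} → toRanking v ≡ just ρ → order ρ ≡ v
  order-toRanking v eq with allDistinct? v
  order-toRanking v refl | yes _ = refl
  fresh : ∀ {v ρ} (vs : List (Vec (Fin k) k)) → order ρ ≡ v → All (v ≢_) vs → All (ρ ≢_) (mapMaybe toRanking vs)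
  fresh [] eq [] = []
  fresh (w ∷ vs) eq (v≢w ∷ v∉) with toRanking w in e
  ... | nothing = fresh vs eq v∉
  ... | just τ  = (λ ρ≡τ → v≢w (trans (sym eq) (trans (cong order ρ≡τ) (order-toRanking w e)))) ∷ fresh vs eq v∉
  mapMaybe-unique : ∀ {vs : List (Vec (Fin k) k)} → Unique vs → Unique (mapMaybe toRanking vs)
  mapMaybe-unique [] = []
  mapMaybe-unique {v ∷ vs} (v∉ ∷ u) with toRanking v in e
  ... | nothing = mapMaybe-unique u
  ... | just ρ  = fresh vs (order-toRanking v e) v∉ ∷ mapMaybe-unique u

∑-swap-invariant : ∀ s (G : Ranking k → ℕ) → ∑ (Sk k) (G ∘ swap s) ≡ ∑ (Sk k) G
∑-swap-invariant {k} s = ∑-injective (Sk k) (Sk-unique k) ∈-Sk (swap s) (swap-injective s)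

∑-relabel-invariant : ∀ (g : Fin k → Fin k) (inj : ∀ {x y} → g x ≡ g y → x ≡ y) (G : Ranking k → ℕ) →
  ∑ (Sk k) (G ∘ relabel g inj) ≡ ∑ (Sk k) G
∑-relabel-invariant {k} g inj = ∑-injective (Sk k) (Sk-unique k) ∈-Sk (relabel g inj) (relabel-injective g inj)

-- Poincaré inequalities on the swap graph

swaps : ∀ {n} → List ℕ → Vec A n → Vec A n
swaps []      v = v
swaps (s ∷ w) v = swaps w (swapAt s v)

swaps-++ : ∀ {n} w₁ w₂ (v : Vec A n) → swaps (w₁ ++ w₂) v ≡ swaps w₂ (swaps w₁ v)
swaps-++ []       w₂ v = refl
swaps-++ (s ∷ w₁) w₂ v = swaps-++ w₁ w₂ (swapAt s v)

swaps-suc : ∀ {n} w (x : A) (v : Vec A n) → swaps (map suc w) (x ∷ v) ≡ x ∷ swaps w v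
swaps-suc []      x v = refl
swaps-suc (s ∷ w) x v = swaps-suc w x (swapAt s v)

swaps-map : ∀ {n} w (g : A → B) (v : Vec A n) → swaps w (Vec.map g v) ≡ Vec.map g (swaps w v)
swaps-map []      g v = refl
swaps-map (s ∷ w) g v = trans (cong (swaps w) (swapAt-map s g v)) (swaps-map w g (swapAt s v))

bubble : ∀ {n} {x : A} (v : Vec A (suc n)) → x ∈ᵥ v →
  ∃ λ w → ∃ λ rest → length w ≤ n × swaps w v ≡ x ∷ rest × (∀ {y} → y ∈ᵥ v → y ≢ x → y ∈ᵥ rest)
bubble (x ∷ v) (hereᵥ refl) = [] , v , z≤n , refl , λ where
  (hereᵥ y≡x) y≢x → contradiction y≡x y≢x
  (thereᵥ y∈) _   → y∈
bubble {n = suc n} {x} (z ∷ v) (thereᵥ x∈) with bubble v x∈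
... | w , rest , len , eq , keep =
    map suc w ++ 0 ∷ [] , z ∷ rest
  , ≤-trans (≤-reflexive (trans (ListP.length-++ (map suc w)) (trans (+-comm _ 1) (cong suc (length-map suc w))))) (s≤s len)
  , trans (swaps-++ (map suc w) (0 ∷ []) (z ∷ v)) (cong (swapAt 0) (trans (swaps-suc w z v) (cong (z ∷_) eq)))
  , λ where
      (hereᵥ y≡z) _   → hereᵥ y≡z
      (thereᵥ y∈) y≢x → thereᵥ (keep y∈ y≢x)

-- Selection sort: `bubble` brings the required head to the front in at most n swaps, and the word
-- that sorts the rest acts one position further down.
sort-to : ∀ {n} (v u : Vec A n) → (∀ p q → lookup u p ≡ lookup u q → p ≡ q) → (∀ p → lookup u p ∈ᵥ v) →
  ∃ λ w → length w ≤ n * n × swaps w v ≡ u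
sort-to [] [] dist sub = [] , z≤n , refl
sort-to {n = suc n} v (x ∷ u) dist sub with bubble v (sub zero)
... | w₁ , rest , len₁ , eq₁ , keep with sort-to rest u
      (λ p q eq → FinP.suc-injective (dist (suc p) (suc q) eq))
      (λ p → keep (sub (suc p)) (λ eq → FinP.0≢1+n (sym (dist (suc p) zero eq))))
... | w₂ , len₂ , eq₂ = w₁ ++ map suc w₂
  , ≤-trans (≤-reflexive (trans (ListP.length-++ w₁) (cong (length w₁ +_) (length-map suc w₂))))
            (+-mono-≤ (m≤n⇒m≤1+n len₁) (≤-trans len₂ (*-monoʳ-≤ n (n≤1+n n))))
  , trans (swaps-++ w₁ (map suc w₂) v) (trans (cong (swaps (map suc w₂)) eq₁) (trans (swaps-suc w₂ x rest) (cong (x ∷_) eq₂)))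

swapWord : List ℕ → Ranking k → Ranking k
swapWord []      ρ = ρ
swapWord (s ∷ w) ρ = swapWord w (swap s ρ)

order-swapWord : ∀ w (ρ : Ranking k) → order (swapWord w ρ) ≡ swaps w (order ρ)
order-swapWord []      ρ = refl
order-swapWord (s ∷ w) ρ = order-swapWord w (swap s ρ)

compose : Ranking k → Ranking k → Ranking k
compose ρ π = relabel (lookup (order ρ)) (order-distinct ρ _ _) π

-- The word sorts the identity ranking into `π`. Swaps act on positions and commute with renaming by
-- `ρ`, so one word serves every `ρ`.
compose-as-swaps : ∀ (π : Ranking k) → ∃ λ w → length w ≤ k * k × ∀ ρ → compose ρ π ≡ swapWord w ρ
compose-as-swaps {k} π with sort-to (Vec.allFin k) (order π) (order-distinct π) (λ p → VecMembershipP.∈-allFin⁺ _)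
... | w , len , eq = w , len , λ ρ → order-injective (begin
  Vec.map (lookup (order ρ)) (order π)                 ≡⟨ cong (Vec.map (lookup (order ρ))) eq ⟨
  Vec.map (lookup (order ρ)) (swaps w (Vec.allFin k))  ≡⟨ swaps-map w (lookup (order ρ)) (Vec.allFin k) ⟨
  swaps w (Vec.map (lookup (order ρ)) (Vec.allFin k))  ≡⟨ cong (swaps w) (VecP.map-lookup-allFin (order ρ)) ⟩
  swaps w (order ρ)                                    ≡⟨ order-swapWord w ρ ⟨
  order (swapWord w ρ)                                 ∎)
  where open ≡-Reasoning

module _ {B : Set} (_≟_ : DecidableEquality B) where
  private
    ne = ≢-indicator _≟_

  ne-refl : ∀ x → ne x x ≡ 0
  ne-refl x = 𝟙-no (¬? (x ≟ x)) (λ x≢x → x≢x refl)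

  ne-bound : ∀ {x y m} → (x ≢ y → m ≡ 0 → ⊥) → ne x y ≤ m
  ne-bound {x} {y} = 𝟙-bound (¬? (x ≟ y))

  swapEnergy : (Ranking k → B) → ℕ
  swapEnergy {k} H = ∑[ s ∈ upTo k ] (∑[ ρ ∈ Sk k ] ne (H ρ) (H (swap s ρ)))

  -- For s ≥ k the swap is the identity and contributes nothing, so the letters of a swap word need
  -- no bound.
  single-swap : ∀ (H : Ranking k → B) s → ∑[ ρ ∈ Sk k ] ne (H ρ) (H (swap s ρ)) ≤ swapEnergy H
  single-swap {k} H s with s ℕ.<? k
  ... | yes s<k = ∑-≥-term (λ s → ∑[ ρ ∈ Sk k ] ne (H ρ) (H (swap s ρ))) (MembershipP.∈-upTo⁺ s<k)
  ... | no s≮k = ≤-trans (≤-reflexive (trans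
      (∑-cong (Sk k) λ ρ → trans (cong (λ τ → ne (H ρ) (H τ)) (order-injective (swapAt-out s (order ρ) (≮⇒≥ s≮k)))) (ne-refl (H ρ)))
      (trans (∑-const (Sk k) 0) (*-zeroʳ (length (Sk k)))))) z≤n

  swapWord-energy : ∀ (H : Ranking k → B) w → ∑[ ρ ∈ Sk k ] ne (H ρ) (H (swapWord w ρ)) ≤ length w * swapEnergy H
  swapWord-energy {k} H [] = ≤-reflexive (trans (∑-cong (Sk k) (λ ρ → ne-refl (H ρ))) (trans (∑-const (Sk k) 0) (*-zeroʳ (length (Sk k)))))
  swapWord-energy {k} H (s ∷ w) = begin
    ∑[ ρ ∈ Sk k ] ne (H ρ) (H (swapWord w (swap s ρ)))
      ≤⟨ ∑-mono (Sk k) (λ ρ → ≢-indicator-triangle _≟_ _ (H (swap s ρ)) _) ⟩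
    ∑[ ρ ∈ Sk k ] (ne (H ρ) (H (swap s ρ)) + ne (H (swap s ρ)) (H (swapWord w (swap s ρ))))
      ≡⟨ ∑-+ (Sk k) _ _ ⟩
    (∑[ ρ ∈ Sk k ] ne (H ρ) (H (swap s ρ))) + (∑[ ρ ∈ Sk k ] ne (H (swap s ρ)) (H (swapWord w (swap s ρ))))
      -- The second vertex of the path is uniform again because `swap s` is a bijection; the
      -- induction restarts from it.
      ≡⟨ cong ((∑[ ρ ∈ Sk k ] ne (H ρ) (H (swap s ρ))) +_) (∑-swap-invariant s (λ ρ → ne (H ρ) (H (swapWord w ρ)))) ⟩
    (∑[ ρ ∈ Sk k ] ne (H ρ) (H (swap s ρ))) + (∑[ ρ ∈ Sk k ] ne (H ρ) (H (swapWord w ρ)))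
      ≤⟨ +-mono-≤ (single-swap H s) (swapWord-energy H w) ⟩
    length (s ∷ w) * swapEnergy H ∎
    where open ≤-Reasoning

  -- Writing the second ranking as compose ρ π, the swap path from ρ depends on π only,
  -- so that every vertex on it is uniformly distributed.
  poincaré : ∀ (H : Ranking k → B) →
    ∑[ ρ ∈ Sk k ] (∑[ ρ' ∈ Sk k ] ne (H ρ) (H ρ')) ≤ length (Sk k) * (k * k * swapEnergy H)
  poincaré {k} H = begin
    ∑[ ρ ∈ Sk k ] (∑[ ρ' ∈ Sk k ] ne (H ρ) (H ρ'))
      ≡⟨ ∑-cong (Sk k) (λ ρ → ∑-relabel-invariant (lookup (order ρ)) (order-distinct ρ _ _) (λ τ → ne (H ρ) (H τ))) ⟨
    ∑[ ρ ∈ Sk k ] (∑[ π ∈ Sk k ] ne (H ρ) (H (compose ρ π)))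
      ≡⟨ ∑-swap (Sk k) (Sk k) _ ⟩
    ∑[ π ∈ Sk k ] (∑[ ρ ∈ Sk k ] ne (H ρ) (H (compose ρ π)))
      ≤⟨ ∑-mono (Sk k) fixed ⟩
    ∑[ π ∈ Sk k ] (k * k * swapEnergy H)
      ≡⟨ ∑-const (Sk k) _ ⟩
    length (Sk k) * (k * k * swapEnergy H) ∎
    where
    open ≤-Reasoning
    fixed : ∀ π → ∑[ ρ ∈ Sk k ] ne (H ρ) (H (compose ρ π)) ≤ k * k * swapEnergy H
    fixed π with compose-as-swaps π
    ... | w , len , eq = ≤-trans (≤-reflexive (∑-cong (Sk k) λ ρ → cong (λ τ → ne (H ρ) (H τ)) (eq ρ)))
      (≤-trans (swapWord-energy H w) (*-monoˡ-≤ (swapEnergy H) len))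

-- Renaming two alternatives, and the fibres of one preference bit

transpose-left : ∀ (a b : Fin k) → transpose a b a ≡ b
transpose-left a b rewrite dec-true (a Fin.≟ a) refl = refl

transpose-right : ∀ (a b : Fin k) → transpose a b b ≡ a
transpose-right a b with b Fin.≟ a
... | yes b≡a = b≡a
... | no _ rewrite dec-true (b Fin.≟ b) refl = refl

transpose-other : ∀ (a b : Fin k) {c} → c ≢ a → c ≢ b → transpose a b c ≡ c
transpose-other a b {c} c≢a c≢b rewrite dec-false (c Fin.≟ a) c≢a | dec-false (c Fin.≟ b) c≢b = refl

transpose-injective : ∀ (a b : Fin k) {x y} → transpose a b x ≡ transpose a b y → x ≡ y
transpose-injective a b eq = trans (sym (transpose-inverse b a)) (trans (cong (transpose b a) eq) (transpose-inverse b a))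

toggle : Fin k → Fin k → Ranking k → Ranking k
toggle a b = relabel (transpose a b) (transpose-injective a b)

module _ (a b : Fin k) (ρ : Ranking k) where

  rank-toggle : ∀ c → rank (toggle a b ρ) (transpose a b c) ≡ rank ρ c
  rank-toggle = rank-relabel (transpose a b) (transpose-injective a b) ρ

  rank-toggle-left : rank (toggle a b ρ) a ≡ rank ρ b
  rank-toggle-left = trans (cong (rank (toggle a b ρ)) (sym (transpose-right a b))) (rank-toggle b)

  rank-toggle-right : rank (toggle a b ρ) b ≡ rank ρ a
  rank-toggle-right = trans (cong (rank (toggle a b ρ)) (sym (transpose-left a b))) (rank-toggle a)

  rank-toggle-other : ∀ {c} → c ≢ a → c ≢ b → rank (toggle a b ρ) c ≡ rank ρ c
  rank-toggle-other c≢a c≢b = trans (cong (rank (toggle a b ρ)) (sym (transpose-other a b c≢a c≢b))) (rank-toggle _)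

Swapped : Fin k → Fin k → ℕ → Ranking k → Set
Swapped a b s ρ = (rank ρ a ≡ s × rank ρ b ≡ suc s) ⊎ (rank ρ b ≡ s × rank ρ a ≡ suc s)

abstract
  swapped? : ∀ (a b : Fin k) s ρ → Dec (Swapped a b s ρ)
  swapped? a b s ρ = (rank ρ a ℕ.≟ s ×-dec rank ρ b ℕ.≟ suc s) ⊎-dec (rank ρ b ℕ.≟ s ×-dec rank ρ a ℕ.≟ suc s)

-- Swaps act on positions, toggles on names, and the two actions commute. They coincide exactly
-- where the swap graph crosses between the two values of the a-b bit.
swap≡toggle : ∀ {a b : Fin k} {s} {ρ : Ranking k} → Swapped a b s ρ → swap s ρ ≡ toggle a b ρ
swap≡toggle {k} {a} {b} {s} {ρ} swapped = rank-ext same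
  where
  left : Swapped a b s ρ → rank (swap s ρ) a ≡ rank ρ b
  left (inj₁ (ra , rb)) = trans (rank-swap-lower s ρ ra (subst (_< k) rb (rank< ρ b))) (sym rb)
  left (inj₂ (rb , ra)) = trans (rank-swap-raise s ρ ra) (sym rb)
  right : Swapped a b s ρ → rank (swap s ρ) b ≡ rank ρ a
  right (inj₁ (ra , rb)) = trans (rank-swap-raise s ρ rb) (sym ra)
  right (inj₂ (rb , ra)) = trans (rank-swap-lower s ρ rb (subst (_< k) ra (rank< ρ a))) (sym ra)
  away : ∀ {c} → c ≢ a → c ≢ b → Swapped a b s ρ → rank (swap s ρ) c ≡ rank ρ c
  away c≢a c≢b (inj₁ (ra , rb)) = rank-swap-other s ρ
    (λ e → c≢a (rank-injective ρ (trans e (sym ra)))) (λ e → c≢b (rank-injective ρ (trans e (sym rb))))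
  away c≢a c≢b (inj₂ (rb , ra)) = rank-swap-other s ρ
    (λ e → c≢b (rank-injective ρ (trans e (sym rb)))) (λ e → c≢a (rank-injective ρ (trans e (sym ra))))
  same : ∀ c → rank (swap s ρ) c ≡ rank (toggle a b ρ) c
  same c with c Fin.≟ a | c Fin.≟ b
  ... | yes refl | _        = trans (left swapped) (sym (rank-toggle-left a b ρ))
  ... | no _     | yes refl = trans (right swapped) (sym (rank-toggle-right a b ρ))
  ... | no c≢a   | no c≢b   = trans (away c≢a c≢b swapped) (sym (rank-toggle-other a b ρ c≢a c≢b))

bit : Fin k → Fin k → Ranking k → Bool
bit a b ρ = does (rank ρ a ℕ.<? rank ρ b)

bit-true : ∀ {a b : Fin k} {ρ} → rank ρ a < rank ρ b → bit a b ρ ≡ true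
bit-true {a = a} {b} {ρ} = dec-true (rank ρ a ℕ.<? rank ρ b)

bit-false : ∀ {a b : Fin k} {ρ} → rank ρ b < rank ρ a → bit a b ρ ≡ false
bit-false {a = a} {b} {ρ} lt = dec-false (rank ρ a ℕ.<? rank ρ b) (<⇒≯ lt)

rank-compare : ∀ {a b : Fin k} → a ≢ b → (ρ : Ranking k) → rank ρ a < rank ρ b ⊎ rank ρ b < rank ρ a
rank-compare {a = a} {b} a≢b ρ with <-cmp (rank ρ a) (rank ρ b)
... | tri< lt _ _ = inj₁ lt
... | tri≈ _ eq _ = contradiction (rank-injective ρ eq) a≢b
... | tri> _ _ gt = inj₂ gt

bit-cong : ∀ {a b : Fin k} {ρ τ} → a ≢ b → (rank ρ a < rank ρ b → rank τ a < rank τ b) →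
  (rank ρ b < rank ρ a → rank τ b < rank τ a) → bit a b ρ ≡ bit a b τ
bit-cong {ρ = ρ} {τ} a≢b f g with rank-compare a≢b ρ
... | inj₁ lt = trans (bit-true {ρ = ρ} lt) (sym (bit-true {ρ = τ} (f lt)))
... | inj₂ gt = trans (bit-false {ρ = ρ} gt) (sym (bit-false {ρ = τ} (g gt)))

bit-toggle : ∀ {a b : Fin k} → a ≢ b → ∀ ρ → bit a b (toggle a b ρ) ≡ not (bit a b ρ)
bit-toggle {a = a} {b} a≢b ρ with rank-compare a≢b ρ
... | inj₁ lt = trans (bit-false {ρ = toggle a b ρ} (subst₂ _<_ (sym (rank-toggle-right a b ρ)) (sym (rank-toggle-left a b ρ)) lt))
                      (cong not (sym (bit-true {ρ = ρ} lt)))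
... | inj₂ gt = trans (bit-true {ρ = toggle a b ρ} (subst₂ _<_ (sym (rank-toggle-left a b ρ)) (sym (rank-toggle-right a b ρ)) gt))
                      (cong not (sym (bit-false {ρ = ρ} gt)))

bit-swap : ∀ {a b : Fin k} → a ≢ b → ∀ s ρ → ¬ Swapped a b s ρ → bit a b (swap s ρ) ≡ bit a b ρ
bit-swap a≢b s ρ ¬sw = sym (bit-cong {ρ = ρ} {swap s ρ} a≢b
  (λ lt → [ (λ e → contradiction (inj₁ e) ¬sw) , id ]′ (rank-swap-order s ρ lt))
  (λ gt → [ (λ e → contradiction (inj₂ e) ¬sw) , id ]′ (rank-swap-order s ρ gt)))

module _ {a b : Fin k} (a≢b : a ≢ b) where
  private
    S = Sk k
    N = length S

  force : Bool → Ranking k → Ranking k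
  force x ρ = if does (bit a b ρ Bool.≟ x) then ρ else toggle a b ρ

  force-id : ∀ {x ρ} → bit a b ρ ≡ x → force x ρ ≡ ρ
  force-id {x} {ρ} eq rewrite dec-true (bit a b ρ Bool.≟ x) eq = refl

  force-toggle : ∀ {x ρ} → bit a b ρ ≢ x → force x ρ ≡ toggle a b ρ
  force-toggle {x} {ρ} ne rewrite dec-false (bit a b ρ Bool.≟ x) ne = refl

  toggle-involutive : ∀ ρ → toggle a b (toggle a b ρ) ≡ ρ
  toggle-involutive ρ = rank-ext same
    where
    same : ∀ c → rank (toggle a b (toggle a b ρ)) c ≡ rank ρ c
    same c with c Fin.≟ a | c Fin.≟ b
    ... | yes refl | _ = trans (rank-toggle-left a b _) (rank-toggle-right a b ρ)
    ... | no _ | yes refl = trans (rank-toggle-right a b _) (rank-toggle-left a b ρ)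
    ... | no c≢a | no c≢b = trans (rank-toggle-other a b _ c≢a c≢b) (rank-toggle-other a b ρ c≢a c≢b)

  force-of-toggle : ∀ x ρ → force x (toggle a b ρ) ≡ force x ρ
  force-of-toggle x ρ with bit a b ρ Bool.≟ x
  ... | yes eq = trans (force-toggle λ eq′ → BoolP.not-¬ (sym eq) (trans (sym eq′) (bit-toggle a≢b ρ))) (toggle-involutive ρ)
  ... | no ne  = force-id (trans (bit-toggle a≢b ρ) (sym (BoolP.¬-not (ne ∘ sym))))

  -- `toggle a b` preserves the uniform measure and negates the bit, so the bit is fair. Doubling
  -- avoids the division by two.
  ∑-bit : ∀ (G : Bool → ℕ) → 2 * (∑[ ρ ∈ S ] G (bit a b ρ)) ≡ N * (G true + G false)
  ∑-bit G = begin
    2 * (∑[ ρ ∈ S ] G (bit a b ρ))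
      ≡⟨ cong ((∑[ ρ ∈ S ] G (bit a b ρ)) +_) (trans (+-identityʳ _)
           (sym (∑-relabel-invariant (transpose a b) (transpose-injective a b) (G ∘ bit a b)))) ⟩
    (∑[ ρ ∈ S ] G (bit a b ρ)) + (∑[ ρ ∈ S ] G (bit a b (toggle a b ρ)))
      ≡⟨ ∑-+ S _ _ ⟨
    ∑[ ρ ∈ S ] (G (bit a b ρ) + G (bit a b (toggle a b ρ)))
      ≡⟨ ∑-cong S (λ ρ → trans (cong (λ x → G (bit a b ρ) + G x) (bit-toggle a≢b ρ)) (both (bit a b ρ))) ⟩
    ∑[ ρ ∈ S ] (G true + G false)
      ≡⟨ ∑-const S _ ⟩
    N * (G true + G false) ∎
    where
    open ≡-Reasoning
    both : ∀ x → G x + G (not x) ≡ G true + G false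
    both true  = refl
    both false = +-comm (G false) (G true)

  ∑-force-both : ∀ (G : Ranking k → ℕ) ρ → G (force true ρ) + G (force false ρ) ≡ G ρ + G (toggle a b ρ)
  ∑-force-both G ρ with bit a b ρ
  ... | true  = refl
  ... | false = +-comm (G (toggle a b ρ)) (G ρ)

  -- For uniform `ρ'` this is a uniform sample among the rankings with the same a-b preference as
  -- `ρ`: the conditional resampling given the bit.
  align : Ranking k → Ranking k → Ranking k
  align ρ ρ' = force (bit a b ρ) ρ'

  ∑-align : ∀ (H : Ranking k → ℕ) → ∑[ ρ ∈ S ] (∑[ ρ' ∈ S ] H (align ρ ρ')) ≡ N * ∑ S H
  ∑-align H = *-cancelˡ-≡ _ _ 2 (begin
    2 * (∑[ ρ ∈ S ] (∑[ ρ' ∈ S ] H (align ρ ρ')))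
      ≡⟨ ∑-bit (λ x → ∑[ ρ' ∈ S ] H (force x ρ')) ⟩
    N * ((∑[ ρ' ∈ S ] H (force true ρ')) + (∑[ ρ' ∈ S ] H (force false ρ')))
      ≡⟨ cong (N *_) (trans (sym (∑-+ S _ _)) (trans (∑-cong S (∑-force-both H)) (∑-+ S _ _))) ⟩
    N * (∑ S H + (∑[ ρ' ∈ S ] H (toggle a b ρ')))
      ≡⟨ cong (λ z → N * (∑ S H + z)) (∑-relabel-invariant (transpose a b) (transpose-injective a b) H) ⟩
    N * (∑ S H + ∑ S H)
      ≡⟨ double N (∑ S H) ⟩
    2 * (N * ∑ S H) ∎)
    where
    open ≡-Reasoning
    double : ∀ n h → n * (h + h) ≡ 2 * (n * h)
    double = solve-∀

  keeps-bit : ℕ → Ranking k → ℕ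
  keeps-bit s ρ = 𝟙 (¬? (swapped? a b s ρ))

  module _ {B : Set} (_≟_ : DecidableEquality B) where
    private
      ne = ≢-indicator _≟_

    fibreEnergy : (Ranking k → B) → ℕ
    fibreEnergy H = ∑[ s ∈ upTo k ] (∑[ ρ ∈ S ] (keeps-bit s ρ * ne (H ρ) (H (swap s ρ))))

    -- Forcing the bit folds the swap graph onto one half of it: a swap of a and b becomes a loop,
    -- every other swap remains a swap.
    folded-energy : ∀ x (H : Ranking k → B) → swapEnergy _≟_ (H ∘ force x) ≤ 2 * fibreEnergy H
    folded-energy x H = begin
      ∑[ s ∈ upTo k ] (∑[ ρ ∈ S ] ne (H (force x ρ)) (H (force x (swap s ρ))))
        ≤⟨ ∑-mono (upTo k) (λ s → ∑-mono S (pointwise s)) ⟩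
      ∑[ s ∈ upTo k ] (∑[ ρ ∈ S ] (e s ρ + e s (toggle a b ρ)))
        ≡⟨ ∑-cong (upTo k) (λ s → trans (∑-+ S _ _) (trans (cong (∑ S (e s) +_)
             (∑-relabel-invariant (transpose a b) (transpose-injective a b) (e s))) (cong (∑ S (e s) +_) (sym (+-identityʳ _))))) ⟩
      ∑[ s ∈ upTo k ] (2 * ∑ S (e s))
        ≡⟨ ∑-*ˡ 2 (upTo k) _ ⟩
      2 * fibreEnergy H ∎
      where
      open ≤-Reasoning
      e : ℕ → Ranking k → ℕ
      e s ρ = keeps-bit s ρ * ne (H ρ) (H (swap s ρ))
      toggle-swapped : ∀ {s ρ} → Swapped a b s (toggle a b ρ) → Swapped a b s ρ
      toggle-swapped {s} {ρ} (inj₁ (ra , rb)) = inj₂ (trans (sym (rank-toggle-left a b ρ)) ra , trans (sym (rank-toggle-right a b ρ)) rb)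
      toggle-swapped {s} {ρ} (inj₂ (rb , ra)) = inj₁ (trans (sym (rank-toggle-right a b ρ)) rb , trans (sym (rank-toggle-left a b ρ)) ra)
      e-active : ∀ {s ρ} → ¬ Swapped a b s ρ → e s ρ ≡ ne (H ρ) (H (swap s ρ))
      e-active {s} {ρ} ¬sw = trans (cong (_* ne (H ρ) (H (swap s ρ))) (𝟙-yes (¬? (swapped? a b s ρ)) ¬sw)) (+-identityʳ _)
      pointwise : ∀ s ρ → ne (H (force x ρ)) (H (force x (swap s ρ))) ≤ e s ρ + e s (toggle a b ρ)
      pointwise s ρ with swapped? a b s ρ
      ... | yes sw = ≤-trans (≤-reflexive (trans (cong (λ τ → ne (H (force x ρ)) (H τ))
                        (trans (cong (force x) (swap≡toggle sw)) (force-of-toggle x ρ))) (ne-refl _≟_ _))) z≤n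
      ... | no ¬sw with bit a b ρ Bool.≟ x
      ...   | yes eq = ≤-trans (≤-reflexive (trans
                (cong (λ τ → ne (H ρ) (H τ)) (force-id (trans (bit-swap a≢b s ρ ¬sw) eq)))
                (sym (+-identityʳ _)))) (m≤m+n _ _)
      -- Both ends are replaced by their toggles. Renaming commutes with the swap, so their images
      -- form the edge at `toggle a b ρ`, paid for by the second summand.
      ...   | no ne′ = ≤-trans (≤-reflexive (trans
                (cong (λ τ → ne (H (toggle a b ρ)) (H τ)) (trans (force-toggle (λ eq → ne′ (trans (sym (bit-swap a≢b s ρ ¬sw)) eq)))
                   (sym (swap-relabel s ρ (transpose a b) (transpose-injective a b)))))
                (sym (e-active (¬sw ∘ toggle-swapped))))) (m≤n+m _ _)

    -- `poincaré` is applied to `H ∘ force x` for each bit `x`. In the constant 4, one factor 2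
    -- comes from folding and one from adding the two halves.
    fibre-poincaré : ∀ (H : Ranking k → B) →
      ∑[ ρ ∈ S ] (∑[ ρ' ∈ S ] ne (H ρ) (H (align ρ ρ'))) ≤ N * (4 * (k * k) * fibreEnergy H)
    fibre-poincaré H = begin
      ∑[ ρ ∈ S ] (∑[ ρ' ∈ S ] ne (H ρ) (H (align ρ ρ')))
        ≤⟨ ∑-mono S (λ ρ → ∑-mono S (pointwise ρ)) ⟩
      ∑[ ρ ∈ S ] (∑[ ρ' ∈ S ] (half true ρ ρ' + half false ρ ρ'))
        ≡⟨ trans (∑-cong S (λ ρ → ∑-+ S _ _)) (∑-+ S _ _) ⟩
      (∑[ ρ ∈ S ] (∑[ ρ' ∈ S ] half true ρ ρ')) + (∑[ ρ ∈ S ] (∑[ ρ' ∈ S ] half false ρ ρ'))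
        ≤⟨ +-mono-≤ (folded true) (folded false) ⟩
      N * (k * k * (2 * fibreEnergy H)) + N * (k * k * (2 * fibreEnergy H))
        ≡⟨ regroup N k (fibreEnergy H) ⟩
      N * (4 * (k * k) * fibreEnergy H) ∎
      where
      open ≤-Reasoning
      half : Bool → Ranking k → Ranking k → ℕ
      half x ρ ρ' = ne (H (force x ρ)) (H (force x ρ'))
      pointwise : ∀ ρ ρ' → ne (H ρ) (H (align ρ ρ')) ≤ half true ρ ρ' + half false ρ ρ'
      pointwise ρ ρ' = bound (bit a b ρ) refl
        where
        bound : ∀ x → bit a b ρ ≡ x → ne (H ρ) (H (force x ρ')) ≤ half true ρ ρ' + half false ρ ρ'
        bound true  eq = ≤-trans (≤-reflexive (cong (λ τ → ne (H τ) (H (force true ρ'))) (sym (force-id eq)))) (m≤m+n _ _)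
        bound false eq = ≤-trans (≤-reflexive (cong (λ τ → ne (H τ) (H (force false ρ'))) (sym (force-id eq)))) (m≤n+m _ _)
      folded : ∀ x → ∑[ ρ ∈ S ] (∑[ ρ' ∈ S ] half x ρ ρ') ≤ N * (k * k * (2 * fibreEnergy H))
      folded x = ≤-trans (poincaré _≟_ (H ∘ force x)) (*-monoʳ-≤ N (*-monoʳ-≤ (k * k) (folded-energy x H)))
      regroup : ∀ n k e → n * (k * k * (2 * e)) + n * (k * k * (2 * e)) ≡ n * (4 * (k * k) * e)
      regroup = solve-∀

-- Correlation of two preference bits

∑-toggle : ∀ (a b : Fin k) (G : Ranking k → ℕ) → ∑ (Sk k) (G ∘ toggle a b) ≡ ∑ (Sk k) G
∑-toggle a b = ∑-relabel-invariant (transpose a b) (transpose-injective a b)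

module _ {a b c d : Fin k} (a≢b : a ≢ b) (c≢d : c ≢ d) (a≢c : a ≢ c) (a≢d : a ≢ d) (c≢b : c ≢ b) where
  private
    S = Sk k
    α = bit a b
    β = bit c d
    cnt = count S α β

    𝟙-complement : ∀ x → 𝟙 (x Bool.≟ true) + 𝟙 (x Bool.≟ false) ≡ 1
    𝟙-complement true  = refl
    𝟙-complement false = refl

    row : ∀ x → 2 * (cnt x true + cnt x false) ≡ length S
    row x = begin
      2 * (cnt x true + cnt x false)
        ≡⟨ cong (2 *_) (trans (sym (∑-+ S _ _)) (∑-cong S λ ρ → trans
             (sym (*-distribˡ-+ (𝟙 (α ρ Bool.≟ x)) (𝟙 (β ρ Bool.≟ true)) (𝟙 (β ρ Bool.≟ false))))
             (trans (cong (𝟙 (α ρ Bool.≟ x) *_) (𝟙-complement (β ρ))) (*-identityʳ _)))) ⟩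
      2 * (∑[ ρ ∈ S ] 𝟙 (α ρ Bool.≟ x))
        ≡⟨ ∑-bit a≢b (λ y → 𝟙 (y Bool.≟ x)) ⟩
      length S * (𝟙 (true Bool.≟ x) + 𝟙 (false Bool.≟ x))
        ≡⟨ cong (length S *_) (one x) ⟩
      length S * 1
        ≡⟨ *-identityʳ _ ⟩
      length S ∎
      where
      open ≡-Reasoning
      one : ∀ x → 𝟙 (true Bool.≟ x) + 𝟙 (false Bool.≟ x) ≡ 1
      one true  = refl
      one false = refl

    column : ∀ y → 2 * (cnt true y + cnt false y) ≡ length S
    column y = begin
      2 * (cnt true y + cnt false y)
        ≡⟨ cong (2 *_) (trans (sym (∑-+ S _ _)) (∑-cong S λ ρ → trans
             (sym (*-distribʳ-+ (𝟙 (β ρ Bool.≟ y)) (𝟙 (α ρ Bool.≟ true)) (𝟙 (α ρ Bool.≟ false))))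
             (trans (cong (_* 𝟙 (β ρ Bool.≟ y)) (𝟙-complement (α ρ))) (*-identityˡ _)))) ⟩
      2 * (∑[ ρ ∈ S ] 𝟙 (β ρ Bool.≟ y))
        ≡⟨ ∑-bit c≢d (λ x → 𝟙 (x Bool.≟ y)) ⟩
      length S * (𝟙 (true Bool.≟ y) + 𝟙 (false Bool.≟ y))
        ≡⟨ cong (length S *_) (one y) ⟩
      length S * 1
        ≡⟨ *-identityʳ _ ⟩
      length S ∎
      where
      open ≡-Reasoning
      one : ∀ x → 𝟙 (true Bool.≟ x) + 𝟙 (false Bool.≟ x) ≡ 1
      one true  = refl
      one false = refl

    tf≡ft : cnt true false ≡ cnt false true
    tf≡ft = +-cancelˡ-≡ (cnt true true) _ _ (*-cancelˡ-≡ _ _ 2 (trans (row true) (sym (column true))))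

    tt≡ff : cnt true true ≡ cnt false false
    tt≡ff = +-cancelʳ-≡ (cnt true false) _ _
      (trans (*-cancelˡ-≡ _ _ 2 (trans (row true) (sym (column false)))) (+-comm (cnt true false) (cnt false false)))

    m≤3m : ∀ m → m ≤ 3 * m
    m≤3m m = m≤m+n m _

    Chain : Fin k → Fin k → Fin k → Ranking k → Set
    Chain x y z ρ = rank ρ x < rank ρ y × rank ρ y < rank ρ z

    chain? : ∀ x y z ρ → Dec (Chain x y z ρ)
    chain? x y z ρ = rank ρ x ℕ.<? rank ρ y ×-dec rank ρ y ℕ.<? rank ρ z

    chains : Fin k → Fin k → Fin k → ℕ
    chains x y z = ∑[ ρ ∈ S ] 𝟙 (chain? x y z ρ)

    chains-relabel : ∀ u v x y z →
      chains x y z ≡ chains (transpose u v x) (transpose u v y) (transpose u v z)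
    chains-relabel u v x y z = trans (∑-cong S λ ρ → 𝟙-cong (chain? x y z ρ) (chain? _ _ _ (toggle u v ρ))
        (λ (p , q) → subst₂ _<_ (sym (rank-toggle u v ρ x)) (sym (rank-toggle u v ρ y)) p
                   , subst₂ _<_ (sym (rank-toggle u v ρ y)) (sym (rank-toggle u v ρ z)) q)
        (λ (p , q) → subst₂ _<_ (rank-toggle u v ρ x) (rank-toggle u v ρ y) p
                   , subst₂ _<_ (rank-toggle u v ρ y) (rank-toggle u v ρ z) q))
      (∑-toggle u v _)

    chains-swap-last : ∀ {x y z} → x ≢ y → x ≢ z → chains x y z ≡ chains x z y
    chains-swap-last {x} {y} {z} x≢y x≢z = trans (chains-relabel y z x y z)
      (trans (cong (λ x → chains x _ _) (transpose-other y z x≢y x≢z))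
             (cong₂ (chains x) (transpose-left y z) (transpose-right y z)))

    chains-swap-first : ∀ {x y z} → z ≢ x → z ≢ y → chains x y z ≡ chains y x z
    chains-swap-first {x} {y} {z} z≢x z≢y = trans (chains-relabel x y x y z)
      (trans (cong (chains _ _) (transpose-other x y z≢x z≢y))
             (cong₂ (λ u v → chains u v z) (transpose-left x y) (transpose-right x y)))

    bit⇒rank : ∀ {x y : Fin k} {ρ} → bit x y ρ ≡ true → rank ρ x < rank ρ y
    bit⇒rank {x} {y} {ρ} eq = decidable-stable (rank ρ x ℕ.<? rank ρ y)
      λ ≮ → contradiction (trans (sym eq) (dec-false (rank ρ x ℕ.<? rank ρ y) ≮)) λ ()

    bit⇒rank′ : ∀ {x y : Fin k} {ρ} → x ≢ y → bit x y ρ ≡ false → rank ρ y < rank ρ x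
    bit⇒rank′ {x} {y} {ρ} x≢y eq with rank-compare x≢y ρ
    ... | inj₁ lt = contradiction (trans (sym (bit-true {ρ = ρ} lt)) eq) λ ()
    ... | inj₂ gt = gt

    cell : ∀ x y ρ → Dec (α ρ ≡ x × β ρ ≡ y)
    cell x y ρ = α ρ Bool.≟ x ×-dec β ρ Bool.≟ y

    cnt≡ : ∀ x y → cnt x y ≡ ∑[ ρ ∈ S ] 𝟙 (cell x y ρ)
    cnt≡ x y = ∑-cong S λ ρ → sym (𝟙-× (α ρ Bool.≟ x) (β ρ Bool.≟ y))

    tf-chains : b ≡ d → cnt true false ≡ chains a b c
    tf-chains refl = trans (cnt≡ true false) (∑-cong S λ ρ → 𝟙-cong (cell true false ρ) (chain? a b c ρ)
      (λ (p , q) → bit⇒rank {ρ = ρ} p , bit⇒rank′ {ρ = ρ} c≢d q)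
      (λ (p , q) → bit-true {ρ = ρ} p , bit-false {ρ = ρ} q))

    tt≤chains : b ≡ d → cnt true true ≤ chains a c b + chains c a b
    tt≤chains refl = ≤-trans (≤-reflexive (cnt≡ true true)) (≤-trans (∑-mono S λ ρ → split ρ) (≤-reflexive (∑-+ S _ _)))
      where
      split : ∀ ρ → 𝟙 (cell true true ρ) ≤ 𝟙 (chain? a c b ρ) + 𝟙 (chain? c a b ρ)
      split ρ with rank-compare a≢c ρ
      ... | inj₁ lt = ≤-trans (𝟙-mono (cell true true ρ) (chain? a c b ρ) (λ (p , q) → lt , bit⇒rank {ρ = ρ} q)) (m≤m+n _ _)
      ... | inj₂ gt = ≤-trans (𝟙-mono (cell true true ρ) (chain? c a b ρ) (λ (p , q) → gt , bit⇒rank {ρ = ρ} p)) (m≤n+m _ _)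

    chains≤tt : b ≡ d → chains a c b ≤ cnt true true
    chains≤tt refl = ≤-trans (∑-mono S λ ρ → 𝟙-mono (chain? a c b ρ) (cell true true ρ)
      (λ (p , q) → bit-true {ρ = ρ} (<-trans p q) , bit-true {ρ = ρ} q)) (≤-reflexive (sym (cnt≡ true true)))

    tt≡tf : b ≢ d → cnt true true ≡ cnt true false
    tt≡tf b≢d = trans (cnt≡ true true) (trans (sym (∑-toggle c d _)) (trans (∑-cong S λ ρ →
        𝟙-cong (cell true true (toggle c d ρ)) (cell true false ρ)
          (λ (p , q) → trans (sym (α-toggle ρ)) p , BoolP.not-injective (trans (sym (bit-toggle c≢d ρ)) q))
          (λ (p , q) → trans (α-toggle ρ) p , trans (bit-toggle c≢d ρ) (cong not q)))
      (sym (cnt≡ true false))))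
      where
      α-toggle : ∀ ρ → α (toggle c d ρ) ≡ α ρ
      α-toggle ρ = cong₂ (λ x y → does (x ℕ.<? y)) (rank-toggle-other c d ρ a≢c a≢d) (rank-toggle-other c d ρ (c≢b ∘ sym) b≢d)

  -- Both bits are fair, which gives the two equalities. The hypotheses leave b = d as the only
  -- possible coincidence. If b ≠ d, toggling c and d flips the second bit and keeps the first, so
  -- the bits are independent. If b = d, the six orders of three alternatives are equally likely: a
  -- > b with b > c is one of them, a > b with c > b is two, so the correlation is 1/3.
  bits-balanced : Balanced S α β
  bits-balanced with b Fin.≟ d
  ... | no b≢d = record
    { agree = tt≡ff ; disagree = tf≡ft
    ; agree≤ = ≤-trans (≤-reflexive (tt≡tf b≢d)) (m≤3m _)
    ; disagree≤ = ≤-trans (≤-reflexive (sym (tt≡tf b≢d))) (m≤3m _) }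
  ... | yes b≡d = record
    { agree = tt≡ff ; disagree = tf≡ft
    ; agree≤ = begin
        cnt true true                  ≤⟨ tt≤chains b≡d ⟩
        chains a c b + chains c a b    ≡⟨ cong₂ _+_ refl (chains-swap-first (c≢b ∘ sym) (a≢b ∘ sym)) ⟩
        chains a c b + chains a c b    ≡⟨ cong₂ _+_ acb acb ⟩
        cnt true false + cnt true false ≤⟨ +-monoʳ-≤ (cnt true false) (m≤m+n _ _) ⟩
        3 * cnt true false             ∎
    ; disagree≤ = begin
        cnt true false                 ≡⟨ acb ⟨
        chains a c b                   ≤⟨ chains≤tt b≡d ⟩
        cnt true true                  ≤⟨ m≤3m _ ⟩
        3 * cnt true true              ∎ }
    where
    open ≤-Reasoning
    acb : chains a c b ≡ cnt true false
    acb = trans (chains-swap-last a≢c a≢b) (sym (tf-chains b≡d))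

-- The two-voter contradiction

-- What an adjacent swap may do to the winner when neither end is a manipulation point.
Step : (Ranking k → Fin k) → ℕ → Ranking k → Set
Step h s ρ = h (swap s ρ) ≡ h ρ ⊎ (rank ρ (h ρ) ≡ s × rank ρ (h (swap s ρ)) ≡ suc s)

-- Pushes whatever stands at position `p` down by `t` places. The indices do not refer to an
-- alternative, so each `lower p t` is a bijection of rankings.
lower : ℕ → ℕ → Ranking k → Ranking k
lower p zero    ρ = ρ
lower p (suc t) ρ = swap (p + t) (lower p t ρ)

rank-lower : ∀ (ρ : Ranking k) {e} t → rank ρ e + t < k → rank (lower (rank ρ e) t ρ) e ≡ rank ρ e + t
rank-lower ρ zero    _  = sym (+-identityʳ _)
rank-lower {k} ρ {e} (suc t) lt = trans
  (rank-swap-lower _ (lower (rank ρ e) t ρ) (rank-lower ρ t (<-trans (n<1+n _) lt′)) lt′) (sym (+-suc (rank ρ e) t))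
  where
  lt′ : suc (rank ρ e + t) < k
  lt′ = subst (_< k) (+-suc (rank ρ e) t) lt

-- Along the path the upper alternative of every swap is `e`, and a step can only take the victory
-- away from the upper one.
lower-preserves : ∀ (ρ : Ranking k) {e} (h : Ranking k → Fin k) t → rank ρ e + t < k →
  (∀ r → r < t → Step h (rank ρ e + r) (lower (rank ρ e) r ρ)) → h ρ ≢ e → h (lower (rank ρ e) t ρ) ≡ h ρ
lower-preserves ρ h zero    _  steps ≢e = refl
lower-preserves {k} ρ {e} h (suc t) lt steps ≢e with steps t ≤-refl
  | lower-preserves ρ {e} h t (<-trans (n<1+n _) (subst (_< k) (+-suc (rank ρ e) t) lt)) (λ r r<t → steps r (m<n⇒m<1+n r<t)) ≢e
... | inj₁ same | ih = trans same ih
... | inj₂ (at-e , _) | ih = contradiction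
  (trans (sym ih) (rank-injective (lower (rank ρ e) t ρ) (trans at-e (sym (rank-lower ρ t
    (<-trans (n<1+n _) (subst (_< k) (+-suc (rank ρ e) t) lt)))))))
  ≢e

rank-lower-target : ∀ (ρ : Ranking k) {e e'} d → rank ρ e' ≡ suc (rank ρ e + d) →
  ∀ t → t ≤ d → rank (lower (rank ρ e) t ρ) e' ≡ suc (rank ρ e + d)
rank-lower-target ρ d eq zero    _   = eq
rank-lower-target ρ {e} {e'} d eq (suc t) t<d = trans
  (rank-swap-other _ (lower (rank ρ e) t ρ) (λ x → >⇒≢ far (trans (sym ih) x)) (λ x → >⇒≢ farther (trans (sym ih) x))) ih
  where
  ih = rank-lower-target ρ {e} {e'} d eq t (<⇒≤ t<d)
  farther : suc (rank ρ e + t) < suc (rank ρ e + d)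
  farther = s≤s (+-monoʳ-< (rank ρ e) t<d)
  far : rank ρ e + t < suc (rank ρ e + d)
  far = <-trans (n<1+n _) farther

lower-below : ∀ (ρ : Ranking k) {e e'} → rank ρ e < rank ρ e' →
  ∃ λ t → rank ρ e + t < k × rank (lower (rank ρ e) t ρ) e' < rank (lower (rank ρ e) t ρ) e
lower-below {k} ρ {e} {e'} lt = suc d , bound , subst₂ _<_ (sym below) (sym at) (n<1+n _)
  where
  -- The number of alternatives strictly between `e` and `e'`; one further swap carries `e` past
  -- `e'`.
  d = rank ρ e' ∸ suc (rank ρ e)
  target : rank ρ e' ≡ suc (rank ρ e + d)
  target = sym (m+[n∸m]≡n lt)
  bound : rank ρ e + suc d < k
  bound = subst (_< k) (trans target (sym (+-suc (rank ρ e) d))) (rank< ρ e')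
  at : rank (lower (rank ρ e) (suc d) ρ) e ≡ suc (rank ρ e + d)
  at = trans (rank-lower ρ (suc d) bound) (+-suc (rank ρ e) d)
  below : rank (lower (rank ρ e) (suc d) ρ) e' ≡ rank ρ e + d
  below = rank-swap-raise _ (lower (rank ρ e) d ρ) (rank-lower-target ρ {e} {e'} d target d ≤-refl)

-- Whichever of `c` and `d` is on top is lowered past the other when the preference has to be
-- reversed. The bounds on `p` and `t` place the path among the k^2 index pairs of the union bound.
record Adjusted (c d : Fin k) (γ : Bool) (ρ : Ranking k) : Set where
  field
    p t       : ℕ
    p<k       : p < k
    t<k       : t < k
    fits      : bit c d (lower p t ρ) ≡ γ
    lowered   : Fin k
    is-c-or-d : lowered ≡ c ⊎ lowered ≡ d
    preserves : ∀ (h : Ranking k → Fin k) → (∀ r → suc r < k → Step h (p + r) (lower p r ρ)) → h ρ ≢ lowered → h (lower p t ρ) ≡ h ρ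

adjust : ∀ {c d : Fin k} → c ≢ d → ∀ γ ρ → Adjusted c d γ ρ
adjust {k} {c} {d} c≢d γ ρ with bit c d ρ Bool.≟ γ
-- The preference is already right: a path of length zero, for which `c` is an arbitrary choice.
... | yes eq = record
  { p = rank ρ c ; t = 0 ; p<k = rank< ρ c ; t<k = ≤-trans (s≤s z≤n) (rank< ρ c)
  ; fits = eq ; lowered = c ; is-c-or-d = inj₁ refl ; preserves = λ h steps ≢c → refl }
... | no ne with rank-compare c≢d ρ
...   | inj₁ c<d = record
  { p = rank ρ c ; t = proj₁ lowering ; p<k = rank< ρ c
  ; t<k = ≤-<-trans (m≤n+m _ (rank ρ c)) (proj₁ (proj₂ lowering))
  ; fits = trans (bit-false {ρ = lower (rank ρ c) (proj₁ lowering) ρ} (proj₂ (proj₂ lowering)))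
                 (sym (BoolP.¬-not (λ γ≡true → ne (trans (bit-true {ρ = ρ} c<d) (sym γ≡true)))))
  ; lowered = c ; is-c-or-d = inj₁ refl
  ; preserves = λ h steps → lower-preserves ρ h (proj₁ lowering) (proj₁ (proj₂ lowering))
      λ r r<t → steps r (≤-<-trans r<t (≤-<-trans (m≤n+m _ (rank ρ c)) (proj₁ (proj₂ lowering)))) }
  where lowering = lower-below ρ c<d
...   | inj₂ d<c = record
  { p = rank ρ d ; t = proj₁ lowering ; p<k = rank< ρ d
  ; t<k = ≤-<-trans (m≤n+m _ (rank ρ d)) (proj₁ (proj₂ lowering))
  ; fits = trans (bit-true {ρ = lower (rank ρ d) (proj₁ lowering) ρ} (proj₂ (proj₂ lowering)))
                 (sym (BoolP.¬-not (λ γ≡false → ne (trans (bit-false {ρ = ρ} d<c) (sym γ≡false)))))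
  ; lowered = d ; is-c-or-d = inj₂ refl
  ; preserves = λ h steps → lower-preserves ρ h (proj₁ lowering) (proj₁ (proj₂ lowering))
      λ r r<t → steps r (≤-<-trans r<t (≤-<-trans (m≤n+m _ (rank ρ d)) (proj₁ (proj₂ lowering)))) }
  where lowering = lower-below ρ d<c

-- Lowering an alternative other than the winner never changes the winner.
two-voter-contradiction : ∀ {a b c d : Fin k} → a ≢ b → c ≢ d → a ≢ c → a ≢ d → c ≢ b →
  (h : Ranking k → Ranking k → Fin k) (ρ w : Ranking k) (β γ : Bool) →
  (∀ p t p' t' → p < k → suc t < k → p' < k → t' < k → Step (λ u → h u (lower p' t' w)) (p + t) (lower p t ρ)) →
  (∀ p t p' t' → p < k → t < k → p' < k → suc t' < k → Step (h (lower p t ρ)) (p' + t') (lower p' t' w)) →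
  (∀ p' t' → p' < k → t' < k → bit a b (lower p' t' w) ≡ β → h ρ (lower p' t' w) ≡ a) →
  (∀ p t → p < k → t < k → bit c d (lower p t ρ) ≡ γ → h (lower p t ρ) w ≡ c) → ⊥
two-voter-contradiction {k} {a} {b} {c} {d} a≢b c≢d a≢c a≢d c≢b h ρ w β γ step₁ step₂ wins-a wins-c =
  case-lowered A.is-c-or-d B.is-c-or-d
  where
  module A = Adjusted (adjust a≢b β w)
  module B = Adjusted (adjust c≢d γ ρ)
  w* = lower A.p A.t w
  ρ* = lower B.p B.t ρ
  0<k : 0 < k
  0<k = ≤-trans (s≤s z≤n) A.p<k

  at-w* : h ρ w* ≡ a
  at-w* = wins-a A.p A.t A.p<k A.t<k A.fits
  at-ρ* : h ρ* w ≡ c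
  at-ρ* = wins-c B.p B.t B.p<k B.t<k B.fits

  lower-w : h ρ w ≢ A.lowered → h ρ w* ≡ h ρ w
  lower-w = A.preserves (h ρ) (λ r r<k → step₂ 0 0 A.p r 0<k 0<k A.p<k r<k)
  lower-ρ : h ρ w ≢ B.lowered → h ρ* w ≡ h ρ w
  lower-ρ = B.preserves (λ u → h u w) (λ r r<k → step₁ B.p r 0 0 B.p<k r<k 0<k 0<k)

  either : ∀ {v e x y : Fin k} → v ≢ x → v ≢ y → e ≡ x ⊎ e ≡ y → v ≢ e
  either v≢x v≢y (inj₁ refl) = v≢x
  either v≢x v≢y (inj₂ refl) = v≢y

  -- Lowering `c` or `d` for the first voter would keep the winner `a`, although `c` wins at (`ρ*`,
  -- `w`). Exchanging the voters excludes `c` as well.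
  not-a : h ρ w ≢ a
  not-a eq = a≢c (trans (sym eq) (trans (sym (lower-ρ (λ e → either a≢c a≢d B.is-c-or-d (trans (sym eq) e)))) at-ρ*))
  not-c : h ρ w ≢ c
  not-c eq = a≢c (trans (sym at-w*) (trans (lower-w (λ e → either (a≢c ∘ sym) c≢b A.is-c-or-d (trans (sym eq) e))) eq))

  case-lowered : A.lowered ≡ a ⊎ A.lowered ≡ b → B.lowered ≡ c ⊎ B.lowered ≡ d → ⊥
  -- The winner at (`ρ`, `w`) is not `a`, so lowering `a` would preserve it, against `at-w*`.
  case-lowered (inj₁ ≡a) _ = not-a (trans (sym (lower-w (λ e → not-a (trans e ≡a)))) at-w*)
  case-lowered (inj₂ _) (inj₁ ≡c) = not-c (trans (sym (lower-ρ (λ e → not-c (trans e ≡c)))) at-ρ*)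
  -- What remains is that `b` and `d` are lowered. The two routes around the square to (`ρ*`, `w*`)
  -- keep the winners `a` and `c` of their middle corners.
  case-lowered (inj₂ ≡b) (inj₂ ≡d) = a≢c (trans (sym still-a) still-c)
    where
    still-a : h ρ* w* ≡ a
    still-a = trans (B.preserves (λ u → h u w*) (λ r r<k → step₁ B.p r A.p A.t B.p<k r<k A.p<k A.t<k)
      (λ e → a≢d (trans (sym at-w*) (trans e ≡d)))) at-w*
    still-c : h ρ* w* ≡ c
    still-c = trans (A.preserves (h ρ*) (λ r r<k → step₂ B.p B.t A.p r B.p<k B.t<k A.p<k r<k)
      (λ e → c≢b (trans (sym at-ρ*) (trans e ≡b)))) at-ρ*

-- Pivotal edges

-- `a`, `b`, `v`, `w` are the winners at a profile and after the swap of one voter, of another, and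
-- of both; the three disjunctions are what honest edges allow. If the edge from `v` to `w` changes
-- the winner, its ends are read off from the positions s and s + 1. Otherwise v = w, and joining
-- `a` to `b` through it needs equal alternatives, equal ranks, or an a-b swap by the second voter.
pivot-persists : ∀ {k} {ρ τ : Ranking k} {a b v w : Fin k} {s t} → a ≢ b → ¬ Swapped a b t τ →
  rank ρ a ≡ s → rank ρ b ≡ suc s →
  w ≡ v ⊎ (rank ρ v ≡ s × rank ρ w ≡ suc s) →
  v ≡ a ⊎ (rank τ a ≡ t × rank τ v ≡ suc t) →
  w ≡ b ⊎ (rank τ b ≡ t × rank τ w ≡ suc t) → v ≡ a × w ≡ b
pivot-persists {ρ = ρ} _ _ ra rb (inj₂ (rv , rw)) _ _ =
  rank-injective ρ (trans rv (sym ra)) , rank-injective ρ (trans rw (sym rb))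
pivot-persists a≢b _ _ _ (inj₁ refl) (inj₁ refl) (inj₁ a≡b) = contradiction a≡b a≢b
pivot-persists _ ¬sw _ _ (inj₁ refl) (inj₁ refl) (inj₂ swapped) = contradiction (inj₂ swapped) ¬sw
pivot-persists _ ¬sw _ _ (inj₁ refl) (inj₂ swapped) (inj₁ refl) = contradiction (inj₁ swapped) ¬sw
pivot-persists {τ = τ} a≢b _ _ _ (inj₁ refl) (inj₂ (ra , _)) (inj₂ (rb , _)) =
  contradiction (rank-injective τ (trans ra (sym rb))) a≢b

module _ {n k : ℕ} where

  swapVoter : Fin n → ℕ → Profile n k → Profile n k
  swapVoter i s σ = σ [ i ]≔ swap s (lookup σ i)

  swapVoter-involutive : ∀ i s σ → swapVoter i s (swapVoter i s σ) ≡ σ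
  swapVoter-involutive i s σ = begin
    (σ [ i ]≔ ρ) [ i ]≔ swap s (lookup (σ [ i ]≔ ρ) i)   ≡⟨ []≔-idempotent σ i ⟩
    σ [ i ]≔ swap s (lookup (σ [ i ]≔ ρ) i)              ≡⟨ cong (λ τ → σ [ i ]≔ swap s τ) (lookup∘update i σ ρ) ⟩
    σ [ i ]≔ swap s (swap s (lookup σ i))                ≡⟨ cong (σ [ i ]≔_) (swap-involutive s (lookup σ i)) ⟩
    σ [ i ]≔ lookup σ i                                  ≡⟨ []≔-lookup σ i ⟩
    σ                                                    ∎
    where
    open ≡-Reasoning
    ρ = swap s (lookup σ i)

  lookup-swapVoter : ∀ {i l} s σ → i ≢ l → lookup (swapVoter l s σ) i ≡ lookup σ i
  lookup-swapVoter s σ i≢l = lookup∘update′ i≢l σ _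

  swapVoter-commute : ∀ {i l} s t σ → i ≢ l → swapVoter i s (swapVoter l t σ) ≡ swapVoter l t (swapVoter i s σ)
  swapVoter-commute {i} {l} s t σ i≢l = begin
    (σ [ l ]≔ τ) [ i ]≔ swap s (lookup (σ [ l ]≔ τ) i)     ≡⟨ cong (λ r → (σ [ l ]≔ τ) [ i ]≔ swap s r) (lookup-swapVoter t σ i≢l) ⟩
    (σ [ l ]≔ τ) [ i ]≔ ρ                                  ≡⟨ []≔-commutes σ l i (i≢l ∘ sym) ⟩
    (σ [ i ]≔ ρ) [ l ]≔ τ                                  ≡⟨ cong (λ r → (σ [ i ]≔ ρ) [ l ]≔ swap t r) (lookup-swapVoter s σ (i≢l ∘ sym)) ⟨
    (σ [ i ]≔ ρ) [ l ]≔ swap t (lookup (σ [ i ]≔ ρ) l)     ∎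
    where
    open ≡-Reasoning
    ρ = swap s (lookup σ i)
    τ = swap t (lookup σ l)

  ∑-swapVoter : ∀ i s (G : Profile n k → ℕ) → ∑ (profiles n k) (G ∘ swapVoter i s) ≡ ∑ (profiles n k) G
  ∑-swapVoter i s = ∑-update (Sk k) (swap s) (∑-swap-invariant s) i

  swapVoter-out : ∀ i {s} σ → k ≤ s → swapVoter i s σ ≡ σ
  swapVoter-out i {s} σ k≤s = trans (cong (σ [ i ]≔_) (order-injective (swapAt-out s (order (lookup σ i)) k≤s))) ([]≔-lookup σ i)

  module Local (f : SCF n k) where

    Manip : Profile n k → Set
    Manip = RManipPoint 4 f

    abstract
      manip? : Decidable Manip
      manip? = rManipPoint? 4 f

    #manip : ℕ
    #manip = ∑ (profiles n k) (𝟙 ∘ manip?)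

    gain⇒manip : ∀ i s σ → s < k → rank (lookup σ i) (f (swapVoter i s σ)) < rank (lookup σ i) (f σ) → Manip σ
    gain⇒manip i s σ s<k lt = i , Any.map
      (λ where refl → swap-window s (lookup σ i) s<k , rank⇒prefers (lookup σ i) lt) (∈-Sk (swap s (lookup σ i)))

    -- A better new winner is a gain at `σ`. A worse one, unless the swap reverses just these two
    -- alternatives, is still worse in the swapped ranking, and then swapping back is a gain.
    swap-changes : ∀ i s σ → ¬ Manip σ → ¬ Manip (swapVoter i s σ) → f (swapVoter i s σ) ≡ f σ ⊎
      (rank (lookup σ i) (f σ) ≡ s × rank (lookup σ i) (f (swapVoter i s σ)) ≡ suc s)
    swap-changes i s σ ¬m ¬m′ with s ℕ.<? k
    ... | no s≮k = inj₁ (cong f (swapVoter-out i σ (≮⇒≥ s≮k)))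
    ... | yes s<k with f (swapVoter i s σ) Fin.≟ f σ
    ...   | yes eq = inj₁ eq
    ...   | no ne with rank-compare ne (lookup σ i)
    ...     | inj₁ better = contradiction (gain⇒manip i s σ s<k better) ¬m
    ...     | inj₂ worse with rank-swap-order s (lookup σ i) worse
    ...       | inj₁ swapped = inj₂ swapped
    ...       | inj₂ still = contradiction (gain⇒manip i s (swapVoter i s σ) s<k
      (subst₂ (λ ρ v → rank ρ v < rank ρ (f (swapVoter i s σ)))
        (sym (lookup∘update i σ _)) (cong f (sym (swapVoter-involutive i s σ))) still)) ¬m′

    Pivot : Fin n → ℕ → Fin k → Fin k → Profile n k → Set
    Pivot i s a b σ = (rank (lookup σ i) a ≡ s × rank (lookup σ i) b ≡ suc s) × f σ ≡ a × f (swapVoter i s σ) ≡ b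

    abstract
      pivot? : ∀ i s a b → Decidable (Pivot i s a b)
      pivot? i s a b σ = (rank (lookup σ i) a ℕ.≟ s ×-dec rank (lookup σ i) b ℕ.≟ suc s)
        ×-dec f σ Fin.≟ a ×-dec f (swapVoter i s σ) Fin.≟ b

    #pivot : Fin n → ℕ → Fin k → Fin k → ℕ
    #pivot i s a b = ∑ (profiles n k) (𝟙 ∘ pivot? i s a b)

    pivot-stable : ∀ {i l} → i ≢ l → ∀ {s a b} → a ≢ b → ∀ t σ → ¬ Swapped a b t (lookup σ l) →
      ¬ Manip σ → ¬ Manip (swapVoter i s σ) → ¬ Manip (swapVoter l t σ) → ¬ Manip (swapVoter l t (swapVoter i s σ)) →
      Pivot i s a b σ → Pivot i s a b (swapVoter l t σ)
    pivot-stable {i} {l} i≢l {s} {a} {b} a≢b t σ ¬sw m₀ m₁ m₂ m₃ ((ra , rb) , fa , fb) =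
      (trans (cong (λ ρ → rank ρ a) same) ra , trans (cong (λ ρ → rank ρ b) same) rb) , values
      where
      same = lookup-swapVoter t σ i≢l
      commute = swapVoter-commute s t σ i≢l
      v = f (swapVoter l t σ)
      w = f (swapVoter i s (swapVoter l t σ))
      values : f (swapVoter l t σ) ≡ a × f (swapVoter i s (swapVoter l t σ)) ≡ b
      values = pivot-persists a≢b ¬sw ra rb
        (subst (λ ρ → w ≡ v ⊎ (rank ρ v ≡ s × rank ρ w ≡ suc s)) same
          (swap-changes i s (swapVoter l t σ) m₂ (subst (¬_ ∘ Manip) (sym commute) m₃)))
        (subst (λ u → v ≡ u ⊎ (rank (lookup σ l) u ≡ t × rank (lookup σ l) v ≡ suc t)) fa (swap-changes l t σ m₀ m₂))
        (subst₂ (λ ρ u → w ≡ u ⊎ (rank ρ u ≡ t × rank ρ w ≡ suc t)) (lookup-swapVoter s σ (i≢l ∘ sym)) fb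
          (subst (λ w → w ≡ f (swapVoter i s σ) ⊎ (rank (lookup (swapVoter i s σ) l) (f (swapVoter i s σ)) ≡ t
                     × rank (lookup (swapVoter i s σ) l) w ≡ suc t))
                 (cong f (sym commute)) (swap-changes l t (swapVoter i s σ) m₁ m₃)))

    swapped-swap : ∀ {a b : Fin k} {s ρ} → Swapped a b s (swap s ρ) → Swapped a b s ρ
    swapped-swap {a} {b} {s} {ρ} (inj₁ (ra , rb)) = inj₂
      ( trans (cong (λ r → rank r b) (sym (swap-involutive s ρ))) (rank-swap-raise s (swap s ρ) rb)
      , trans (cong (λ r → rank r a) (sym (swap-involutive s ρ))) (rank-swap-lower s (swap s ρ) ra (subst (_< k) rb (rank< (swap s ρ) b))))
    swapped-swap {a} {b} {s} {ρ} (inj₂ (rb , ra)) = inj₁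
      ( trans (cong (λ r → rank r a) (sym (swap-involutive s ρ))) (rank-swap-raise s (swap s ρ) ra)
      , trans (cong (λ r → rank r b) (sym (swap-involutive s ρ))) (rank-swap-lower s (swap s ρ) rb (subst (_< k) ra (rank< (swap s ρ) a))))

    pivotᵇ : Fin n → ℕ → Fin k → Fin k → Profile n k → Bool
    pivotᵇ i s a b σ = does (pivot? i s a b σ)

    ne : Bool → Bool → ℕ
    ne = ≢-indicator Bool._≟_

    square-manip : Fin n → ℕ → Fin n → ℕ → Profile n k → ℕ
    square-manip i s l t σ = 𝟙 (manip? σ) + 𝟙 (manip? (swapVoter i s σ))
      + (𝟙 (manip? (swapVoter l t σ)) + 𝟙 (manip? (swapVoter l t (swapVoter i s σ))))

    -- `pivot-stable` applies in both directions: the swap of voter l is an involution that permutes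
    -- the four corners of the square.
    pivot-boundary : ∀ {i l} → i ≢ l → ∀ {s a b} (a≢b : a ≢ b) t σ →
      keeps-bit a≢b t (lookup σ l) * ne (pivotᵇ i s a b σ) (pivotᵇ i s a b (swapVoter l t σ)) ≤ square-manip i s l t σ
    pivot-boundary {i} {l} i≢l {s} {a} {b} a≢b t σ with swapped? a b t (lookup σ l)
    ... | yes sw = z≤n
    ... | no ¬sw = ≤-trans (≤-reflexive (+-identityʳ _)) (ne-bound Bool._≟_ λ differ free → differ (agree free))
      where
      back = swapVoter-involutive l t σ
      agree : square-manip i s l t σ ≡ 0 → pivotᵇ i s a b σ ≡ pivotᵇ i s a b (swapVoter l t σ)
      agree free = does-⇔ (mk⇔ forward backward) (pivot? i s a b σ) (pivot? i s a b (swapVoter l t σ))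
        where
        m₀₁ = m+n≡0⇒m≡0 (𝟙 (manip? σ) + 𝟙 (manip? (swapVoter i s σ))) free
        m₂₃ = m+n≡0⇒n≡0 (𝟙 (manip? σ) + 𝟙 (manip? (swapVoter i s σ))) free
        m₀ = 𝟙≡0 (manip? σ) (m+n≡0⇒m≡0 _ m₀₁)
        m₁ = 𝟙≡0 (manip? (swapVoter i s σ)) (m+n≡0⇒n≡0 (𝟙 (manip? σ)) m₀₁)
        m₂ = 𝟙≡0 (manip? (swapVoter l t σ)) (m+n≡0⇒m≡0 _ m₂₃)
        m₃ = 𝟙≡0 (manip? (swapVoter l t (swapVoter i s σ))) (m+n≡0⇒n≡0 (𝟙 (manip? (swapVoter l t σ))) m₂₃)
        commute = swapVoter-commute s t σ i≢l
        forward : Pivot i s a b σ → Pivot i s a b (swapVoter l t σ)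
        forward = pivot-stable i≢l a≢b t σ ¬sw m₀ m₁ m₂ m₃
        backward : Pivot i s a b (swapVoter l t σ) → Pivot i s a b σ
        backward p = subst (Pivot i s a b) back (pivot-stable i≢l a≢b t (swapVoter l t σ)
          (λ sw → ¬sw (swapped-swap (subst (Swapped a b t) (lookup∘update l σ _) sw)))
          m₂ (subst (¬_ ∘ Manip) (sym commute) m₃)
          (subst (¬_ ∘ Manip) (sym back) m₀)
          (subst (¬_ ∘ Manip) (sym (trans (cong (swapVoter l t) commute) (swapVoter-involutive l t (swapVoter i s σ)))) m₁)
          p)

    ∑-square-manip : ∀ i s l t → ∑ (profiles n k) (square-manip i s l t) ≡ 4 * #manip
    ∑-square-manip i s l t = begin
      ∑ V (square-manip i s l t)
        ≡⟨ trans (∑-+ V _ _) (cong₂ _+_ (∑-+ V _ _) (∑-+ V _ _)) ⟩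
      #manip + ∑ V (𝟙 ∘ manip? ∘ swapVoter i s)
        + (∑ V (𝟙 ∘ manip? ∘ swapVoter l t) + ∑ V (𝟙 ∘ manip? ∘ swapVoter l t ∘ swapVoter i s))
        ≡⟨ cong₂ _+_ (cong (#manip +_) (∑-swapVoter i s _)) (cong₂ _+_ (∑-swapVoter l t _)
             (trans (∑-swapVoter i s (𝟙 ∘ manip? ∘ swapVoter l t)) (∑-swapVoter l t _))) ⟩
      #manip + #manip + (#manip + #manip)
        ≡⟨ four #manip ⟩
      4 * #manip ∎
      where
      open ≡-Reasoning
      V = profiles n k
      four : ∀ m → m + m + (m + m) ≡ 4 * m
      four = solve-∀

    private
      S = Sk k
      N = length (Sk k)
      V = profiles n k
      T = length (Sk k) ^ n

    module Fibre (i : Fin n) (s : ℕ) (a b : Fin k) (a≢b : a ≢ b) where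

      mix : Profile n k → Profile n k → Profile n k
      mix = zipWith (align a≢b)

      -- Voter `i` is overwritten, so the entry of `σ` at `i` is irrelevant and swaps there never
      -- lie on the boundary.
      pivotAt : Ranking k → Profile n k → Bool
      pivotAt ρ σ = pivotᵇ i s a b (σ [ i ]≔ ρ)

      boundary-at : ∀ ρ l t σ →
        keeps-bit a≢b t (lookup σ l) * ne (pivotAt ρ σ) (pivotAt ρ (σ [ l ]≔ swap t (lookup σ l)))
        ≤ square-manip i s l t (σ [ i ]≔ ρ)
      boundary-at ρ l t σ with i Fin.≟ l
      ... | yes refl = ≤-trans (≤-reflexive (trans
          (cong (λ τ → keeps-bit a≢b t (lookup σ i) * ne (pivotAt ρ σ) (pivotᵇ i s a b τ)) ([]≔-idempotent σ i))
          (trans (cong (keeps-bit a≢b t (lookup σ i) *_) (ne-refl Bool._≟_ (pivotAt ρ σ))) (*-zeroʳ (keeps-bit a≢b t (lookup σ i)))))) z≤n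
      ... | no i≢l = ≤-trans (≤-reflexive (cong₂ (λ r τ → keeps-bit a≢b t r * ne (pivotAt ρ σ) (pivotᵇ i s a b τ))
            same (trans ([]≔-commutes σ l i (i≢l ∘ sym)) (cong (λ r → (σ [ i ]≔ ρ) [ l ]≔ swap t r) same))))
          (pivot-boundary i≢l a≢b t (σ [ i ]≔ ρ))
        where
        same : lookup σ l ≡ lookup (σ [ i ]≔ ρ) l
        same = sym (lookup∘update′ (i≢l ∘ sym) σ ρ)

      -- The `hybrid` argument with fibre Poincaré inequalities, each boundary edge being charged to
      -- the corners of its square. The constant is 4k^2 (Poincaré) times n voters, k positions and
      -- 4 corners.
      instability : ∑[ ρ ∈ S ] (∑[ σ ∈ V ] (∑[ σ' ∈ V ] ne (pivotAt ρ σ) (pivotAt ρ (mix σ σ'))))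
        ≤ 16 * n * (k * k * k) * (T * N * #manip)
      instability = begin
        ∑[ ρ ∈ S ] (∑[ σ ∈ V ] (∑[ σ' ∈ V ] ne (pivotAt ρ σ) (pivotAt ρ (mix σ σ'))))
          ≤⟨ ∑-mono S (λ ρ → hybrid Bool._≟_ S (align a≢b) (upTo k) swap (keeps-bit a≢b) (4 * (k * k))
               (∑-align a≢b) (fibre-poincaré a≢b Bool._≟_) n (pivotAt ρ)) ⟩
        ∑[ ρ ∈ S ] (T * (4 * (k * k) * (∑[ l ∈ allFin n ] (∑[ t ∈ upTo k ] (∑[ σ ∈ V ] boundary ρ l t σ)))))
          ≤⟨ ∑-mono S (λ ρ → *-monoʳ-≤ T (*-monoʳ-≤ (4 * (k * k)) (∑-mono (allFin n) λ l → ∑-mono (upTo k) λ t →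
               ∑-mono V λ σ → boundary-at ρ l t σ))) ⟩
        ∑[ ρ ∈ S ] (T * (4 * (k * k) * (∑[ l ∈ allFin n ] (∑[ t ∈ upTo k ] (∑[ σ ∈ V ] square-manip i s l t (σ [ i ]≔ ρ))))))
          ≡⟨ trans (∑-*ˡ T S _) (cong (T *_) (∑-*ˡ (4 * (k * k)) S _)) ⟩
        T * (4 * (k * k) * (∑[ ρ ∈ S ] (∑[ l ∈ allFin n ] (∑[ t ∈ upTo k ] (∑[ σ ∈ V ] square-manip i s l t (σ [ i ]≔ ρ))))))
          ≡⟨ cong (λ z → T * (4 * (k * k) * z)) total ⟩
        T * (4 * (k * k) * (n * (k * (N * (4 * #manip)))))
          ≡⟨ regroup T n k N #manip ⟩
        16 * n * (k * k * k) * (T * N * #manip) ∎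
        where
        open ≤-Reasoning
        boundary : Ranking k → Fin n → ℕ → Profile n k → ℕ
        boundary ρ l t σ = keeps-bit a≢b t (lookup σ l) * ne (pivotAt ρ σ) (pivotAt ρ (σ [ l ]≔ swap t (lookup σ l)))
        regroup : ∀ t n k m x → t * (4 * (k * k) * (n * (k * (m * (4 * x))))) ≡ 16 * n * (k * k * k) * (t * m * x)
        regroup = solve-∀
        total : ∑[ ρ ∈ S ] (∑[ l ∈ allFin n ] (∑[ t ∈ upTo k ] (∑[ σ ∈ V ] square-manip i s l t (σ [ i ]≔ ρ))))
          ≡ n * (k * (N * (4 * #manip)))
        total = begin-equality
          ∑[ ρ ∈ S ] (∑[ l ∈ allFin n ] (∑[ t ∈ upTo k ] (∑[ σ ∈ V ] square-manip i s l t (σ [ i ]≔ ρ))))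
            ≡⟨ trans (∑-swap S (allFin n) _) (∑-cong (allFin n) λ l → trans (∑-swap S (upTo k) _) (∑-cong (upTo k) λ t →
                 trans (∑-swap S V _) (trans (∑-resample S i _) (cong (N *_) (∑-square-manip i s l t))))) ⟩
          ∑[ l ∈ allFin n ] (∑[ t ∈ upTo k ] (N * (4 * #manip)))
            ≡⟨ trans (∑-const (allFin n) _) (cong₂ _*_ (ListP.length-tabulate {n = n} id)
                 (trans (∑-const (upTo k) _) (cong (_* (N * (4 * #manip))) (ListP.length-upTo k)))) ⟩
          n * (k * (N * (4 * #manip))) ∎

-- Intersecting two pivotal events

χ : Bool → ℕ
χ x = if x then 1 else 0

χ≤1 : ∀ x → χ x ≤ 1
χ≤1 true  = ≤-refl
χ≤1 false = z≤n

χ*χ-bound : ∀ x y {m} → (x ≡ true → y ≡ true → m ≡ 0 → ⊥) → χ x * χ y ≤ m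
χ*χ-bound false y     h = z≤n
χ*χ-bound true  false h = z≤n
χ*χ-bound true  true {zero}  h = ⊥-elim (h refl refl refl)
χ*χ-bound true  true {suc m} h = s≤s z≤n

χ-ne : ∀ x y → ≢-indicator Bool._≟_ x y ≡ 0 → x ≡ y
χ-ne true  true  _ = refl
χ-ne false false _ = refl

∑-lower : ∀ p t (G : Ranking k → ℕ) → ∑ (Sk k) (G ∘ lower p t) ≡ ∑ (Sk k) G
∑-lower p zero    G = refl
∑-lower p (suc t) G = trans (∑-lower p t (G ∘ swap (p + t))) (∑-swap-invariant (p + t) G)

∑-bounded : ∀ (xs : List A) {F : A → ℕ} {c} → (∀ x → F x ≤ c) → ∑ xs F ≤ length xs * c
∑-bounded xs F≤c = ≤-trans (∑-mono xs F≤c) (≤-reflexive (∑-const xs _))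

identity-ranking : Ranking k
identity-ranking {k} = mkRanking (Vec.allFin k)
  λ p q eq → trans (sym (VecP.lookup-allFin p)) (trans eq (VecP.lookup-allFin q))

Sk-nonempty : ∀ k → 1 ≤ length (Sk k)
Sk-nonempty k = nonempty (∈-Sk (identity-ranking {k}))
  where
  nonempty : ∀ {x : A} {xs} → x ∈ xs → 1 ≤ length xs
  nonempty (here _)  = s≤s z≤n
  nonempty (there _) = s≤s z≤n

module _ {n k : ℕ} (f : SCF n k) where
  open Local f

  private
    S = Sk k
    N = length (Sk k)
    V = profiles n k
    T = length (Sk k) ^ n
    -- The number of values of the auxiliary variables `ρ`, `y`, `σ'` in `weight`, so that `weight`
    -- divided by `K` is a probability.
    K = N * (N * T)

    length-V : length V ≡ T
    length-V = length-vecsOf S n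

  module Resampled (i j : Fin n) (s : ℕ) (a b : Fin k) (a≢b : a ≢ b) where
    open Fibre i s a b a≢b

    mix-cong : ∀ {σ τ} σ' → Vec.map (bit a b) σ ≡ Vec.map (bit a b) τ → mix σ σ' ≡ mix τ σ'
    mix-cong {σ} {τ} σ' eq = trans (sym (VecP.zipWith-map₁ (force a≢b) (bit a b) σ σ'))
      (trans (cong (λ z → zipWith (force a≢b) z σ') eq) (VecP.zipWith-map₁ (force a≢b) (bit a b) τ σ'))

    -- Mixing reads its first argument through bits alone. This lets the ranking of `j` be exchanged
    -- for any other with the same a-b preference, in particular a lowered one.
    mix-replace : ∀ σ σ' {y v} → bit a b v ≡ bit a b y → mix (σ [ j ]≔ v) σ' ≡ mix (σ [ j ]≔ y) σ'
    mix-replace σ σ' {y} {v} eq = mix-cong σ' (trans (VecP.map-[]≔ (bit a b) σ j)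
      (trans (cong (Vec.map (bit a b) σ [ j ]≔_) eq) (sym (VecP.map-[]≔ (bit a b) σ j))))

    -- Up to normalisation, the probability of a pivot given the a-b preferences z of the voters other than i and j;
    -- voter j is resampled because the other pivot event depends on the whole of that voter's ranking.
    weight : Vec Bool n → ℕ
    weight z = ∑[ ρ ∈ S ] (∑[ y ∈ S ] (∑[ σ' ∈ V ] χ (pivotAt ρ (zipWith (force a≢b) (z [ j ]≔ bit a b y) σ'))))

    weight-bits : ∀ σ → weight (Vec.map (bit a b) σ) ≡
      ∑[ ρ ∈ S ] (∑[ y ∈ S ] (∑[ σ' ∈ V ] χ (pivotAt ρ (mix (σ [ j ]≔ y) σ'))))
    weight-bits σ = ∑-cong S λ ρ → ∑-cong S λ y → ∑-cong V λ σ' → cong (χ ∘ pivotAt ρ)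
      (trans (cong (λ z → zipWith (force a≢b) z σ') (sym (VecP.map-[]≔ (bit a b) σ j)))
             (VecP.zipWith-map₁ (force a≢b) (bit a b) (σ [ j ]≔ y) σ'))

    weight≤K : ∀ z → weight z ≤ K
    weight≤K z = ∑-bounded S λ ρ → ∑-bounded S λ y → ≤-trans
      (∑-bounded V (λ σ' → χ≤1 (pivotAt ρ (zipWith (force a≢b) (z [ j ]≔ bit a b y) σ'))))
      (≤-reflexive (trans (*-identityʳ _) length-V))

    -- Mixing keeps profiles uniform, so averaging the weights returns the pivot probability
    -- exactly, with no error from manipulation points.
    ∑-weight : ∑[ σ ∈ V ] weight (Vec.map (bit a b) σ) ≡ K * #pivot i s a b
    ∑-weight = begin
      ∑[ σ ∈ V ] weight (Vec.map (bit a b) σ)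
        ≡⟨ ∑-cong V weight-bits ⟩
      ∑[ σ ∈ V ] (∑[ ρ ∈ S ] (∑[ y ∈ S ] (∑[ σ' ∈ V ] χ (pivotAt ρ (mix (σ [ j ]≔ y) σ')))))
        ≡⟨ ∑-swap V S _ ⟩
      ∑[ ρ ∈ S ] (∑[ σ ∈ V ] (∑[ y ∈ S ] (∑[ σ' ∈ V ] χ (pivotAt ρ (mix (σ [ j ]≔ y) σ')))))
        ≡⟨ ∑-cong S (λ ρ → ∑-resample S j _) ⟩
      ∑[ ρ ∈ S ] (N * (∑[ σ ∈ V ] (∑[ σ' ∈ V ] χ (pivotAt ρ (mix σ σ')))))
        ≡⟨ ∑-cong S (λ ρ → cong (N *_) (∑-zipWith S (align a≢b) (∑-align a≢b) n (χ ∘ pivotAt ρ))) ⟩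
      ∑[ ρ ∈ S ] (N * (T * (∑[ σ ∈ V ] χ (pivotAt ρ σ))))
        ≡⟨ trans (∑-*ˡ N S _) (cong (N *_) (∑-*ˡ T S _)) ⟩
      N * (T * (∑[ ρ ∈ S ] (∑[ σ ∈ V ] χ (pivotAt ρ σ))))
        ≡⟨ cong (λ z → N * (T * z)) (trans (∑-swap S V _) (∑-resample S i (χ ∘ pivotᵇ i s a b))) ⟩
      N * (T * (N * #pivot i s a b))
        ≡⟨ regroup N T (#pivot i s a b) ⟩
      K * #pivot i s a b ∎
      where
      open ≡-Reasoning
      regroup : ∀ n t p → n * (t * (n * p)) ≡ n * (n * t) * p
      regroup = solve-∀

    unstable : Ranking k → Ranking k → Profile n k → Profile n k → ℕ
    unstable ρ v σ σ' = ne (pivotAt ρ (σ [ j ]≔ v)) (pivotAt ρ (mix (σ [ j ]≔ v) σ'))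

    -- Lowering by fixed indices is a bijection, so `instability` holds unchanged at every vertex of
    -- the lowering paths.
    ∑-unstable : ∀ p t p' t' → ∑[ σ ∈ V ] (∑[ ρ ∈ S ] (∑[ w ∈ S ] (∑[ σ' ∈ V ] unstable (lower p t ρ) (lower p' t' w) σ σ')))
      ≤ 16 * n * (k * k * k) * (K * #manip)
    ∑-unstable p t p' t' = begin
      ∑[ σ ∈ V ] (∑[ ρ ∈ S ] (∑[ w ∈ S ] (∑[ σ' ∈ V ] unstable (lower p t ρ) (lower p' t' w) σ σ')))
        ≡⟨ ∑-cong V (λ σ → trans (∑-lower {k = k} p t (λ ρ → ∑[ w ∈ S ] (∑[ σ' ∈ V ] unstable ρ (lower p' t' w) σ σ')))
             (∑-cong S λ ρ → ∑-lower {k = k} p' t' (λ w → ∑[ σ' ∈ V ] unstable ρ w σ σ'))) ⟩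
      ∑[ σ ∈ V ] (∑[ ρ ∈ S ] (∑[ w ∈ S ] (∑[ σ' ∈ V ] unstable ρ w σ σ')))
        ≡⟨ trans (∑-swap V S _) (∑-cong S λ ρ → ∑-resample S j _) ⟩
      ∑[ ρ ∈ S ] (N * (∑[ σ ∈ V ] (∑[ σ' ∈ V ] ne (pivotAt ρ σ) (pivotAt ρ (mix σ σ')))))
        ≡⟨ ∑-*ˡ N S _ ⟩
      N * (∑[ ρ ∈ S ] (∑[ σ ∈ V ] (∑[ σ' ∈ V ] ne (pivotAt ρ σ) (pivotAt ρ (mix σ σ')))))
        ≤⟨ *-monoʳ-≤ N instability ⟩
      N * (16 * n * (k * k * k) * (T * N * #manip))
        ≡⟨ regroup N T n k #manip ⟩
      16 * n * (k * k * k) * (K * #manip) ∎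
      where
      open ≤-Reasoning
      regroup : ∀ m t n k x → m * (16 * n * (k * k * k) * (t * m * x)) ≡ 16 * n * (k * k * k) * (m * (m * t) * x)
      regroup = solve-∀

  module Cross (i j : Fin n) (i≢j : i ≢ j) (s t : ℕ) (a b c d : Fin k)
    (a≢b : a ≢ b) (c≢d : c ≢ d) (a≢c : a ≢ c) (a≢d : a ≢ d) (c≢b : c ≢ b) where

    private
      module I = Fibre i s a b a≢b
      module J = Fibre j t c d c≢d
      module RI = Resampled i j s a b a≢b
      module RJ = Resampled j i t c d c≢d

    pairs : ℕ
    pairs = ∑[ σ ∈ V ] (RI.weight (Vec.map (bit a b) σ) * RJ.weight (Vec.map (bit c d) σ))

    pairs-lower-bound : K * K * (#pivot i s a b * #pivot i s a b * (#pivot j t c d * #pivot j t c d)) * (K * K)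
      ≤ T * T * T * pairs * (K * K)
    pairs-lower-bound = begin
      K * K * (p * p * (q * q)) * (K * K)
        ≡⟨ regroup₁ K p q ⟩
      K * p * (K * p) * (K * q * (K * q))
        ≡⟨ cong₂ (λ x y → x * x * (y * y)) RI.∑-weight RJ.∑-weight ⟨
      sumI * sumI * (sumJ * sumJ)
        ≤⟨ reverse-hypercontractivity S (bit a b) (bit c d) (bits-balanced a≢b c≢d a≢c a≢d c≢b) n RI.weight RJ.weight ⟩
      T * T * T * (∑[ σ ∈ V ] (u σ * u σ * (v σ * v σ)))
        -- The exponents 1/2 leave squares of the weights; since a weight is at most `K`, each
        -- square is at most `K` times the weight.
        ≤⟨ *-monoʳ-≤ (T * T * T) (∑-mono V λ σ → ≤-trans
             (*-mono-≤ (*-monoˡ-≤ (u σ) (RI.weight≤K _)) (*-monoˡ-≤ (v σ) (RJ.weight≤K _)))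
             (≤-reflexive (regroup₂ K (u σ) (v σ)))) ⟩
      T * T * T * (∑[ σ ∈ V ] (K * K * (u σ * v σ)))
        ≡⟨ cong (T * T * T *_) (trans (∑-*ˡ (K * K) V _) (*-comm (K * K) pairs)) ⟩
      T * T * T * (pairs * (K * K))
        ≡⟨ *-assoc (T * T * T) pairs (K * K) ⟨
      T * T * T * pairs * (K * K) ∎
      where
      open ≤-Reasoning
      p = #pivot i s a b
      q = #pivot j t c d
      u v : Profile n k → ℕ
      u σ = RI.weight (Vec.map (bit a b) σ)
      v σ = RJ.weight (Vec.map (bit c d) σ)
      sumI = ∑ V u
      sumJ = ∑ V v
      regroup₁ : ∀ k p q → k * k * (p * p * (q * q)) * (k * k) ≡ k * p * (k * p) * (k * q * (k * q))
      regroup₁ = solve-∀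
      regroup₂ : ∀ k u v → k * u * (k * v) ≡ k * k * (u * v)
      regroup₂ = solve-∀

    module Point (σ : Profile n k) (ρ w : Ranking k) where

      at : Ranking k → Ranking k → Profile n k
      at u v = (σ [ i ]≔ u) [ j ]≔ v

      at-swapped : ∀ u v → at u v ≡ (σ [ j ]≔ v) [ i ]≔ u
      at-swapped u v = []≔-commutes σ i j i≢j

      swap-at-i : ∀ r u v → swapVoter i r (at u v) ≡ at (swap r u) v
      swap-at-i r u v = begin
        at u v [ i ]≔ swap r (lookup (at u v) i)               ≡⟨ cong (λ x → x [ i ]≔ swap r (lookup x i)) (at-swapped u v) ⟩
        ((σ [ j ]≔ v) [ i ]≔ u) [ i ]≔ swap r (lookup ((σ [ j ]≔ v) [ i ]≔ u) i) ≡⟨ []≔-idempotent (σ [ j ]≔ v) i ⟩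
        (σ [ j ]≔ v) [ i ]≔ swap r (lookup ((σ [ j ]≔ v) [ i ]≔ u) i) ≡⟨ cong (λ x → (σ [ j ]≔ v) [ i ]≔ swap r x) (lookup∘update i (σ [ j ]≔ v) u) ⟩
        (σ [ j ]≔ v) [ i ]≔ swap r u                           ≡⟨ at-swapped (swap r u) v ⟨
        at (swap r u) v                                        ∎
        where open ≡-Reasoning

      swap-at-j : ∀ r u v → swapVoter j r (at u v) ≡ at u (swap r v)
      swap-at-j r u v = trans ([]≔-idempotent (σ [ i ]≔ u) j) (cong (λ x → (σ [ i ]≔ u) [ j ]≔ swap r x) (lookup∘update j (σ [ i ]≔ u) v))

      step-i : ∀ r u v → ¬ Manip (at u v) → ¬ Manip (at (swap r u) v) → Step (λ u → f (at u v)) r u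
      step-i r u v m m′ = subst₂ (λ x z → f x ≡ f (at u v) ⊎ (rank z (f (at u v)) ≡ r × rank z (f x) ≡ suc r))
        (swap-at-i r u v) (trans (cong (λ x → lookup x i) (at-swapped u v)) (lookup∘update i (σ [ j ]≔ v) u))
        (swap-changes i r (at u v) m (subst (¬_ ∘ Manip) (sym (swap-at-i r u v)) m′))

      step-j : ∀ r u v → ¬ Manip (at u v) → ¬ Manip (at u (swap r v)) → Step (λ v → f (at u v)) r v
      step-j r u v m m′ = subst₂ (λ x z → f x ≡ f (at u v) ⊎ (rank z (f (at u v)) ≡ r × rank z (f x) ≡ suc r))
        (swap-at-j r u v) (lookup∘update j (σ [ i ]≔ u) v)
        (swap-changes j r (at u v) m (subst (¬_ ∘ Manip) (sym (swap-at-j r u v)) m′))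

      module _ (y x : Ranking k) (σ' σ'' : Profile n k) where

        -- The first two indices lower the ranking of voter `i`, the last two that of voter `j`. The
        -- three summands are the ways in which the two-voter argument can fail at this vertex.
        bad : ℕ → ℕ → ℕ → ℕ → ℕ
        bad p r p' r' = 𝟙 (manip? (at (lower p r ρ) (lower p' r' w)))
          + (RI.unstable (lower p r ρ) (lower p' r' w) σ σ' + RJ.unstable (lower p' r' w) (lower p r ρ) σ σ'')

        all-bad : ℕ
        all-bad = ∑[ p ∈ upTo k ] (∑[ r ∈ upTo k ] (∑[ p' ∈ upTo k ] (∑[ r' ∈ upTo k ] bad p r p' r')))

        no-pair : χ (I.pivotAt ρ (I.mix (σ [ j ]≔ y) σ')) * χ (J.pivotAt w (J.mix (σ [ i ]≔ x) σ'')) ≤ all-bad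
        no-pair = χ*χ-bound _ _ impossible
          where
          impossible : I.pivotAt ρ (I.mix (σ [ j ]≔ y) σ') ≡ true → J.pivotAt w (J.mix (σ [ i ]≔ x) σ'') ≡ true → all-bad ≡ 0 → ⊥
          impossible pivot-i pivot-j all-good = two-voter-contradiction a≢b c≢d a≢c a≢d c≢b
            -- The preferences to be attained by lowering are those of the redrawn rankings, `y` of
            -- voter `j` and `x` of voter `i`, under which the two mixed pivots are known.
            (λ u v → f (at u v)) ρ w (bit a b y) (bit c d x)
            (λ p r p' r' p<k sr<k p'<k r'<k → step-i (p + r) (lower p r ρ) (lower p' r' w)
              (honest p r p' r' p<k (<-trans (n<1+n r) sr<k) p'<k r'<k) (honest p (suc r) p' r' p<k sr<k p'<k r'<k))
            (λ p r p' r' p<k r<k p'<k sr'<k → step-j (p' + r') (lower p r ρ) (lower p' r' w)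
              (honest p r p' r' p<k r<k p'<k (<-trans (n<1+n r') sr'<k)) (honest p r p' (suc r') p<k r<k p'<k sr'<k))
            wins-a wins-c
            where
            good : ∀ p r p' r' → p < k → r < k → p' < k → r' < k → bad p r p' r' ≡ 0
            good p r p' r' p<k r<k p'<k r'<k =
              ∑≡0 (upTo k) _ (∑≡0 (upTo k) _ (∑≡0 (upTo k) _ (∑≡0 (upTo k) _ all-good
                (MembershipP.∈-upTo⁺ p<k)) (MembershipP.∈-upTo⁺ r<k)) (MembershipP.∈-upTo⁺ p'<k)) (MembershipP.∈-upTo⁺ r'<k)
            honest : ∀ p r p' r' → p < k → r < k → p' < k → r' < k → ¬ Manip (at (lower p r ρ) (lower p' r' w))
            honest p r p' r' p<k r<k p'<k r'<k = 𝟙≡0 (manip? _) (m+n≡0⇒m≡0 _ (good p r p' r' p<k r<k p'<k r'<k))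
            0<k : 0 < k
            0<k = ≤-trans (s≤s z≤n) (rank< ρ a)
            wins-a : ∀ p' r' → p' < k → r' < k → bit a b (lower p' r' w) ≡ bit a b y → f (at ρ (lower p' r' w)) ≡ a
            wins-a p' r' p'<k r'<k same = trans (cong f (at-swapped ρ v)) (proj₁ (proj₂ pivot))
              where
              v = lower p' r' w
              stable : RI.unstable ρ v σ σ' ≡ 0
              -- `lower 0 0` is the identity, so the unlowered `ρ` is among the vertices covered.
              stable = m+n≡0⇒m≡0 _ (m+n≡0⇒n≡0 (𝟙 (manip? (at ρ v))) (good 0 0 p' r' 0<k 0<k p'<k r'<k))
              pivot : Pivot i s a b ((σ [ j ]≔ v) [ i ]≔ ρ)
              -- Equal bits make the mixtures from `v` and from `y` the same profile; stability then
              -- removes the mixing.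
              pivot = does-true (pivot? i s a b _) (trans (χ-ne _ _ stable)
                (trans (cong (I.pivotAt ρ) (RI.mix-replace σ σ' same)) pivot-i))
            wins-c : ∀ p r → p < k → r < k → bit c d (lower p r ρ) ≡ bit c d x → f (at (lower p r ρ) w) ≡ c
            wins-c p r p<k r<k same = proj₁ (proj₂ pivot)
              where
              u = lower p r ρ
              stable : RJ.unstable w u σ σ'' ≡ 0
              stable = m+n≡0⇒n≡0 (RI.unstable u w σ σ') (m+n≡0⇒n≡0 (𝟙 (manip? (at u w))) (good p r 0 0 p<k r<k 0<k 0<k))
              pivot : Pivot j t c d ((σ [ i ]≔ u) [ j ]≔ w)
              pivot = does-true (pivot? j t c d _) (trans (χ-ne _ _ stable)
                (trans (cong (J.pivotAt w) (RJ.mix-replace σ σ'' same)) pivot-j))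

    -- The seven independent variables: the common profile `σ`, the rankings `ρ` of `i` and `w` of
    -- `j`, the redrawn rankings `y` of `j` and `x` of `i`, and the profiles `σ'` and `σ''` that
    -- feed the two mixtures.
    Observable : Set
    Observable = Profile n k → Ranking k → Ranking k → Ranking k → Ranking k → Profile n k → Profile n k → ℕ

    𝔼 : Observable → ℕ
    𝔼 G = ∑[ σ ∈ V ] (∑[ ρ ∈ S ] (∑[ w ∈ S ] (∑[ y ∈ S ] (∑[ x ∈ S ] (∑[ σ' ∈ V ] (∑[ σ'' ∈ V ] G σ ρ w y x σ' σ''))))))

    𝔼-∑ : ∀ {X : Set} (xs : List X) (G : X → Observable) →
      𝔼 (λ σ ρ w y x σ' σ'' → ∑[ z ∈ xs ] G z σ ρ w y x σ' σ'') ≡ ∑[ z ∈ xs ] 𝔼 (G z)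
    𝔼-∑ xs G = trans (∑-cong V λ σ → trans (∑-cong S λ ρ → trans (∑-cong S λ w → trans (∑-cong S λ y →
      trans (∑-cong S λ x → trans (∑-cong V λ σ' → ∑-swap V xs _) (∑-swap V xs _)) (∑-swap S xs _)) (∑-swap S xs _))
      (∑-swap S xs _)) (∑-swap S xs _)) (∑-swap V xs _)

    𝔼-+ : ∀ (G H : Observable) → 𝔼 (λ σ ρ w y x σ' σ'' → G σ ρ w y x σ' σ'' + H σ ρ w y x σ' σ'') ≡ 𝔼 G + 𝔼 H
    𝔼-+ G H = trans (∑-cong V λ σ → trans (∑-cong S λ ρ → trans (∑-cong S λ w → trans (∑-cong S λ y →
      trans (∑-cong S λ x → trans (∑-cong V λ σ' → ∑-+ V _ _) (∑-+ V _ _)) (∑-+ S _ _)) (∑-+ S _ _))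
      (∑-+ S _ _)) (∑-+ S _ _)) (∑-+ V _ _)

    𝔼-mono : ∀ {G H : Observable} → (∀ σ ρ w y x σ' σ'' → G σ ρ w y x σ' σ'' ≤ H σ ρ w y x σ' σ'') → 𝔼 G ≤ 𝔼 H
    𝔼-mono G≤H = ∑-mono V λ σ → ∑-mono S λ ρ → ∑-mono S λ w → ∑-mono S λ y → ∑-mono S λ x → ∑-mono V λ σ' → ∑-mono V λ σ'' →
      G≤H σ ρ w y x σ' σ''

    private
      -- Accounts for the three variables on which a summand of `bad` does not depend: `y`, `x` and
      -- one of the two mixing profiles.
      free : ℕ → ℕ
      free z = N * (N * (T * z))

      free-inner : ∀ (G : ℕ) → ∑[ y ∈ S ] (∑[ x ∈ S ] (T * G)) ≡ free G
      free-inner G = trans (∑-const S _) (cong (N *_) (∑-const S _))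

      ∑-free : ∀ (G : Profile n k → Ranking k → Ranking k → ℕ) →
        ∑[ σ ∈ V ] (∑[ ρ ∈ S ] (∑[ w ∈ S ] free (G σ ρ w))) ≡ free (∑[ σ ∈ V ] (∑[ ρ ∈ S ] (∑[ w ∈ S ] G σ ρ w)))
      ∑-free G = trans (∑-cong V λ σ → trans (∑-cong S λ ρ → pull S (G σ ρ)) (pull S _)) (pull V _)
        where
        pull : ∀ {X : Set} (xs : List X) (H : X → ℕ) → ∑[ x ∈ xs ] free (H x) ≡ free (∑ xs H)
        pull xs H = trans (∑-*ˡ N xs _) (cong (N *_) (trans (∑-*ˡ N xs _) (cong (N *_) (∑-*ˡ T xs H))))

    𝔼-first : ∀ (G : Profile n k → Ranking k → Ranking k → Profile n k → ℕ) →
      𝔼 (λ σ ρ w y x σ' σ'' → G σ ρ w σ') ≡ free (∑[ σ ∈ V ] (∑[ ρ ∈ S ] (∑[ w ∈ S ] (∑[ σ' ∈ V ] G σ ρ w σ'))))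
    𝔼-first G = trans (∑-cong V λ σ → ∑-cong S λ ρ → ∑-cong S λ w → trans
      (∑-cong S λ y → ∑-cong S λ x → trans (∑-cong V λ σ' → trans (∑-const V _) (cong (_* G σ ρ w σ') length-V)) (∑-*ˡ T V _))
      (free-inner _)) (∑-free _)

    𝔼-second : ∀ (G : Profile n k → Ranking k → Ranking k → Profile n k → ℕ) →
      𝔼 (λ σ ρ w y x σ' σ'' → G σ ρ w σ'') ≡ free (∑[ σ ∈ V ] (∑[ ρ ∈ S ] (∑[ w ∈ S ] (∑[ σ'' ∈ V ] G σ ρ w σ''))))
    𝔼-second G = trans (∑-cong V λ σ → ∑-cong S λ ρ → ∑-cong S λ w → trans
      (∑-cong S λ y → ∑-cong S λ x → trans (∑-const V _) (cong (_* (∑[ σ'' ∈ V ] G σ ρ w σ'')) length-V))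
      (free-inner _)) (∑-free _)

    private
      -- One unit for the manipulation point itself, and `16 * n * (k * k * k)` for the instability
      -- of each of the two pivots.
      C = 1 + 32 * n * (k * k * k)

    bad-average : ∀ p r p' r' → 𝔼 (λ σ ρ w y x σ' σ'' → Point.bad σ ρ w y x σ' σ'' p r p' r') ≤ C * (K * K * #manip)
    bad-average p r p' r' = begin
      𝔼 (λ σ ρ w y x σ' σ'' → Point.bad σ ρ w y x σ' σ'' p r p' r')
        ≡⟨ trans (𝔼-+ (λ σ ρ w _ _ _ _ → m σ ρ w) (λ σ ρ w y x σ' σ'' → unI σ ρ w σ' + unJ σ ρ w σ''))
                 (cong (𝔼 (λ σ ρ w _ _ _ _ → m σ ρ w) +_) (𝔼-+ (λ σ ρ w _ _ σ' _ → unI σ ρ w σ') (λ σ ρ w _ _ _ σ'' → unJ σ ρ w σ''))) ⟩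
      𝔼 (λ σ ρ w _ _ _ _ → m σ ρ w) + (𝔼 (λ σ ρ w _ _ σ' _ → unI σ ρ w σ') + 𝔼 (λ σ ρ w _ _ _ σ'' → unJ σ ρ w σ''))
        ≡⟨ cong₂ _+_ (𝔼-first (λ σ ρ w _ → m σ ρ w)) (cong₂ _+_ (𝔼-first unI) (𝔼-second unJ)) ⟩
      free (∑[ σ ∈ V ] (∑[ ρ ∈ S ] (∑[ w ∈ S ] (∑[ _ ∈ V ] m σ ρ w))))
        + (free (∑[ σ ∈ V ] (∑[ ρ ∈ S ] (∑[ w ∈ S ] (∑[ σ' ∈ V ] unI σ ρ w σ'))))
         + free (∑[ σ ∈ V ] (∑[ ρ ∈ S ] (∑[ w ∈ S ] (∑[ σ'' ∈ V ] unJ σ ρ w σ'')))))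
        ≤⟨ +-mono-≤ (free-mono m-total) (+-mono-≤ (free-mono (RI.∑-unstable p r p' r'))
             (free-mono (≤-trans (≤-reflexive (∑-cong V λ σ → ∑-swap S S _)) (RJ.∑-unstable p' r' p r)))) ⟩
      free (T * (N * (N * #manip))) + (free (16 * n * (k * k * k) * (K * #manip)) + free (16 * n * (k * k * k) * (K * #manip)))
        ≡⟨ regroup N T n k #manip ⟩
      C * (K * K * #manip) ∎
      where
      open ≤-Reasoning
      m : Profile n k → Ranking k → Ranking k → ℕ
      m σ ρ w = 𝟙 (manip? (Point.at σ ρ w (lower p r ρ) (lower p' r' w)))
      unI unJ : Profile n k → Ranking k → Ranking k → Profile n k → ℕ
      unI σ ρ w σ' = RI.unstable (lower p r ρ) (lower p' r' w) σ σ'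
      unJ σ ρ w σ'' = RJ.unstable (lower p' r' w) (lower p r ρ) σ σ''
      free-mono : ∀ {x y} → x ≤ y → free x ≤ free y
      free-mono x≤y = *-monoʳ-≤ N (*-monoʳ-≤ N (*-monoʳ-≤ T x≤y))
      m-total : ∑[ σ ∈ V ] (∑[ ρ ∈ S ] (∑[ w ∈ S ] (∑[ _ ∈ V ] m σ ρ w))) ≤ T * (N * (N * #manip))
      m-total = begin
        ∑[ σ ∈ V ] (∑[ ρ ∈ S ] (∑[ w ∈ S ] (∑[ _ ∈ V ] m σ ρ w)))
          ≡⟨ ∑-cong V (λ σ → ∑-cong S λ ρ → ∑-cong S λ w → trans (∑-const V _) (cong (_* m σ ρ w) length-V)) ⟩
        ∑[ σ ∈ V ] (∑[ ρ ∈ S ] (∑[ w ∈ S ] (T * m σ ρ w)))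
          ≡⟨ trans (∑-cong V λ σ → trans (∑-cong S λ ρ → ∑-*ˡ T S _) (∑-*ˡ T S _)) (∑-*ˡ T V _) ⟩
        T * (∑[ σ ∈ V ] (∑[ ρ ∈ S ] (∑[ w ∈ S ] m σ ρ w)))
          ≡⟨ cong (T *_) (∑-cong V λ σ → trans (∑-lower {k = k} p r (λ u → ∑[ w ∈ S ] 𝟙 (manip? ((σ [ i ]≔ u) [ j ]≔ lower p' r' w))))
               (∑-cong S λ u → ∑-lower {k = k} p' r' (λ v → 𝟙 (manip? ((σ [ i ]≔ u) [ j ]≔ v))))) ⟩
        T * (∑[ σ ∈ V ] (∑[ u ∈ S ] (∑[ v ∈ S ] 𝟙 (manip? ((σ [ i ]≔ u) [ j ]≔ v)))))
          ≡⟨ cong (T *_) (trans (∑-resample S i (λ τ → ∑[ v ∈ S ] 𝟙 (manip? (τ [ j ]≔ v)))) (cong (N *_) (∑-resample S j (𝟙 ∘ manip?)))) ⟩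
        T * (N * (N * #manip)) ∎
      regroup : ∀ m t n k x →
        m * (m * (t * (t * (m * (m * x))))) + (m * (m * (t * (16 * n * (k * k * k) * (m * (m * t) * x))))
          + m * (m * (t * (16 * n * (k * k * k) * (m * (m * t) * x)))))
        ≡ (1 + 32 * n * (k * k * k)) * (m * (m * t) * (m * (m * t)) * x)
      regroup = solve-∀

    -- Simultaneous pivots always produce a bad vertex, by `no-pair`, and there are k^4 vertices,
    -- all with the same average bound.
    pairs-bound : pairs ≤ k * (k * (k * (k * (C * (K * K * #manip)))))
    pairs-bound = begin
      pairs
        ≡⟨ ∑-cong V (λ σ → trans (cong₂ _*_ (RI.weight-bits σ) (RJ.weight-bits σ)) (expand σ)) ⟩
      𝔼 (λ σ ρ w y x σ' σ'' → χ (I.pivotAt ρ (I.mix (σ [ j ]≔ y) σ')) * χ (J.pivotAt w (J.mix (σ [ i ]≔ x) σ'')))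
        ≤⟨ 𝔼-mono (λ σ ρ w y x σ' σ'' → Point.no-pair σ ρ w y x σ' σ'') ⟩
      𝔼 (λ σ ρ w y x σ' σ'' → Point.all-bad σ ρ w y x σ' σ'')
        ≡⟨ trans (𝔼-∑ U (λ p → sum-over λ r → sum-over λ p' → sum-over (bad p r p')))
             (∑-cong U λ p → trans (𝔼-∑ U (λ r → sum-over λ p' → sum-over (bad p r p')))
             (∑-cong U λ r → trans (𝔼-∑ U (λ p' → sum-over (bad p r p'))) (∑-cong U λ p' → 𝔼-∑ U (bad p r p')))) ⟩
      ∑[ p ∈ U ] (∑[ r ∈ U ] (∑[ p' ∈ U ] (∑[ r' ∈ U ] 𝔼 (λ σ ρ w y x σ' σ'' → Point.bad σ ρ w y x σ' σ'' p r p' r'))))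
        ≤⟨ bounded (λ p → bounded λ r → bounded λ p' → bounded λ r' → bad-average p r p' r') ⟩
      k * (k * (k * (k * (C * (K * K * #manip))))) ∎
      where
      open ≤-Reasoning
      U = upTo k
      sum-over : (ℕ → Observable) → Observable
      sum-over G σ ρ w y x σ' σ'' = ∑[ z ∈ U ] G z σ ρ w y x σ' σ''
      bad : ℕ → ℕ → ℕ → ℕ → Observable
      bad p r p' r' σ ρ w y x σ' σ'' = Point.bad σ ρ w y x σ' σ'' p r p' r'
      bounded : ∀ {F : ℕ → ℕ} {c} → (∀ x → F x ≤ c) → ∑ U F ≤ k * c
      bounded {c = c} F≤c = ≤-trans (∑-bounded U F≤c) (≤-reflexive (cong (_* c) (ListP.length-upTo k)))
      expand : ∀ σ →
        (∑[ ρ ∈ S ] (∑[ y ∈ S ] (∑[ σ' ∈ V ] χ (I.pivotAt ρ (I.mix (σ [ j ]≔ y) σ')))))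
        * (∑[ w ∈ S ] (∑[ x ∈ S ] (∑[ σ'' ∈ V ] χ (J.pivotAt w (J.mix (σ [ i ]≔ x) σ'')))))
        ≡ ∑[ ρ ∈ S ] (∑[ w ∈ S ] (∑[ y ∈ S ] (∑[ x ∈ S ] (∑[ σ' ∈ V ] (∑[ σ'' ∈ V ]
            (χ (I.pivotAt ρ (I.mix (σ [ j ]≔ y) σ')) * χ (J.pivotAt w (J.mix (σ [ i ]≔ x) σ''))))))))
      expand σ = trans (∑-*-∑ S S _ _) (∑-cong S λ ρ → ∑-cong S λ w →
        trans (∑-*-∑ S S _ _) (∑-cong S λ y → ∑-cong S λ x → ∑-*-∑ V V _ _))

    -- After division by the fourth power of `T` it bounds the product of the squared pivot
    -- probabilities by `k * k * k * k * C` times the probability of M_4. The auxiliary counts `K`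
    -- cancel.
    cross-bound : #pivot i s a b * #pivot i s a b * (#pivot j t c d * #pivot j t c d)
      ≤ T * T * T * (k * k * k * k * (C * #manip))
    cross-bound = *-cancelˡ-≤ (K * K) (*-cancelʳ-≤ _ _ (K * K) (begin
      K * K * (p * p * (q * q)) * (K * K)
        ≤⟨ pairs-lower-bound ⟩
      T * T * T * pairs * (K * K)
        ≤⟨ *-monoˡ-≤ (K * K) (*-monoʳ-≤ (T * T * T) pairs-bound) ⟩
      T * T * T * (k * (k * (k * (k * (C * (K * K * #manip)))))) * (K * K)
        ≡⟨ regroup T k C K #manip ⟩
      K * K * (T * T * T * (k * k * k * k * (C * #manip))) * (K * K) ∎))
      where
      open ≤-Reasoning
      p = #pivot i s a b
      q = #pivot j t c d
      regroup : ∀ t k c m x → t * t * t * (k * (k * (k * (k * (c * (m * m * x)))))) * (m * m)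
        ≡ m * m * (t * t * t * (k * k * k * k * (c * x))) * (m * m)
      regroup = solve-∀
      instance
        N≢0 : ℕ.NonZero N
        N≢0 = ℕ.>-nonZero (Sk-nonempty k)
        T≢0 : ℕ.NonZero T
        T≢0 = m^n≢0 N n
        NT≢0 : ℕ.NonZero (N * T)
        NT≢0 = m*n≢0 N T
        K≢0 : ℕ.NonZero K
        K≢0 = m*n≢0 N (N * T)
        KK≢0 : ℕ.NonZero (K * K)
        KK≢0 = m*n≢0 K K

positive-* : ∀ x y → 1 ≤ x → 1 ≤ y → 1 ≤ x * y
positive-* x y x≥1 y≥1 = *-mono-≤ {1} {x} {1} {y} x≥1 y≥1

-- Functions far from NONMANIP

zipWith-proj₂ : ∀ {n} (v w : Vec A n) → zipWith (λ _ y → y) v w ≡ w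
zipWith-proj₂ []      []      = refl
zipWith-proj₂ (x ∷ v) (y ∷ w) = cong (y ∷_) (zipWith-proj₂ v w)

module _ {n k : ℕ} (f : SCF n k) where
  open Local f

  private
    S = Sk k
    N = length (Sk k)
    V = profiles n k
    T = length (Sk k) ^ n

    neF : Fin k → Fin k → ℕ
    neF = ≢-indicator Fin._≟_

    instance
      N≢0 : ℕ.NonZero N
      N≢0 = ℕ.>-nonZero (Sk-nonempty k)
      T≢0 : ℕ.NonZero T
      T≢0 = m^n≢0 N n

  disagreement : SCF n k → ℕ
  disagreement g = ∑[ σ ∈ V ] neF (f σ) (g σ)

  -- The swap that witnesses a pivot from `a` to `b` leads to a pivot from `b` to `a`.
  #pivot-flip : ∀ i s a b → #pivot i s a b ≤ #pivot i s b a
  #pivot-flip i s a b = ≤-trans (∑-mono V λ σ → 𝟙-mono (pivot? i s a b σ) (pivot? i s b a (swapVoter i s σ)) (flip σ))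
    (≤-reflexive (∑-swapVoter i s (𝟙 ∘ pivot? i s b a)))
    where
    flip : ∀ σ → Pivot i s a b σ → Pivot i s b a (swapVoter i s σ)
    flip σ ((ra , rb) , fa , fb) =
      ( trans (cong (λ ρ → rank ρ b) (lookup∘update i σ _)) (rank-swap-raise s (lookup σ i) rb)
      , trans (cong (λ ρ → rank ρ a) (lookup∘update i σ _)) (rank-swap-lower s (lookup σ i) ra (subst (_< k) rb (rank< (lookup σ i) b))))
      , fb , trans (cong f (swapVoter-involutive i s σ)) fa

  #pivot-out : ∀ i {s} a b → k ≤ s → #pivot i s a b ≡ 0
  #pivot-out i {s} a b k≤s = trans (∑-cong V λ σ → 𝟙-no (pivot? i s a b σ)
    λ ((ra , _) , _) → <⇒≱ (rank< (lookup σ i) a) (subst (k ≤_) (sym ra) k≤s))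
    (trans (∑-const V 0) (*-zeroʳ (length V)))

  module _ (coll : Fin k → Fin k) where

    separated? : ∀ a b → Dec (coll a ≢ coll b)
    separated? a b = ¬? (coll a Fin.≟ coll b)

    -- Pivots that are visible after the outcome is passed through `coll`, which is the identity for
    -- comparison with one-voter functions and merges two alternatives for comparison with
    -- two-valued ones.
    crossings : Fin n → ℕ → Profile n k → ℕ
    crossings l s σ = ∑[ a ∈ allFin k ] (∑[ b ∈ allFin k ] (𝟙 (separated? a b) * 𝟙 (pivot? l s a b σ)))

    change-bound : ∀ l s σ → neF (coll (f σ)) (coll (f (swapVoter l s σ)))
      ≤ 𝟙 (manip? σ) + 𝟙 (manip? (swapVoter l s σ)) + crossings l s σ
    change-bound l s σ = ne-bound Fin._≟_ contra
      where
      contra : coll (f σ) ≢ coll (f (swapVoter l s σ)) →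
        𝟙 (manip? σ) + 𝟙 (manip? (swapVoter l s σ)) + crossings l s σ ≡ 0 → ⊥
      contra differ zero-sum with swap-changes l s σ
          (𝟙≡0 (manip? σ) (m+n≡0⇒m≡0 _ honest)) (𝟙≡0 (manip? (swapVoter l s σ)) (m+n≡0⇒n≡0 (𝟙 (manip? σ)) honest))
        where honest = m+n≡0⇒m≡0 (𝟙 (manip? σ) + 𝟙 (manip? (swapVoter l s σ))) zero-sum
      ... | inj₁ same = differ (cong coll (sym same))
      ... | inj₂ ranks = 1+n≢0 (trans (sym (cong₂ _*_ (𝟙-yes (separated? a b) differ) (𝟙-yes (pivot? l s a b σ) (ranks , refl , refl))))
        (∑≡0 (allFin k) _ (∑≡0 (allFin k) _ (m+n≡0⇒n≡0 (𝟙 (manip? σ) + 𝟙 (manip? (swapVoter l s σ))) zero-sum)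
          (MembershipP.∈-allFin a)) (MembershipP.∈-allFin b)))
        where
        a = f σ
        b = f (swapVoter l s σ)

    changes-bound : ∀ M e l s → (∀ a b → coll a ≢ coll b → M * #pivot l s a b ≤ e) →
      M * (∑[ σ ∈ V ] neF (coll (f σ)) (coll (f (swapVoter l s σ)))) ≤ 2 * M * #manip + k * k * e
    changes-bound M e l s small = begin
      M * (∑[ σ ∈ V ] neF (coll (f σ)) (coll (f (swapVoter l s σ))))
        ≤⟨ *-monoʳ-≤ M (∑-mono V (change-bound l s)) ⟩
      M * (∑[ σ ∈ V ] (𝟙 (manip? σ) + 𝟙 (manip? (swapVoter l s σ)) + crossings l s σ))
        ≡⟨ cong (M *_) (trans (∑-+ V _ _) (cong₂ _+_ (trans (∑-+ V _ _) (cong (#manip +_) (∑-swapVoter l s (𝟙 ∘ manip?)))) total)) ⟩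
      M * (#manip + #manip + (∑[ a ∈ allFin k ] (∑[ b ∈ allFin k ] (𝟙 (separated? a b) * #pivot l s a b))))
        ≡⟨ trans (*-distribˡ-+ M (#manip + #manip) _) (cong₂ _+_ (double M #manip)
             (trans (sym (∑-*ˡ M (allFin k) _)) (∑-cong (allFin k) λ a → sym (∑-*ˡ M (allFin k) _)))) ⟩
      2 * M * #manip + (∑[ a ∈ allFin k ] (∑[ b ∈ allFin k ] (M * (𝟙 (separated? a b) * #pivot l s a b))))
        ≤⟨ +-monoʳ-≤ (2 * M * #manip) (≤-trans (∑-bounded (allFin k) λ a → ∑-bounded (allFin k) λ b → term a b)
             (≤-reflexive (trans (cong₂ (λ x y → x * (y * e)) card card) (sym (*-assoc k k e))))) ⟩
      2 * M * #manip + k * k * e ∎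
      where
      open ≤-Reasoning
      card : length (allFin k) ≡ k
      card = ListP.length-tabulate {n = k} id
      double : ∀ m x → m * (x + x) ≡ 2 * m * x
      double = solve-∀
      total : ∑ V (crossings l s) ≡ ∑[ a ∈ allFin k ] (∑[ b ∈ allFin k ] (𝟙 (separated? a b) * #pivot l s a b))
      total = trans (∑-swap V (allFin k) _) (∑-cong (allFin k) λ a → trans (∑-swap V (allFin k) _)
        (∑-cong (allFin k) λ b → ∑-*ˡ (𝟙 (separated? a b)) V _))
      term : ∀ a b → M * (𝟙 (separated? a b) * #pivot l s a b) ≤ e
      term a b = by-cases (separated? a b)
        where
        by-cases : (d : Dec (coll a ≢ coll b)) → M * (𝟙 d * #pivot l s a b) ≤ e
        by-cases (yes sep) = ≤-trans (≤-reflexive (cong (M *_) (*-identityˡ _))) (small a b sep)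
        by-cases (no _)    = ≤-trans (≤-reflexive (*-zeroʳ M)) z≤n

  -- The case of `hybrid` in which every ranking is redrawn without any condition: two independent
  -- profiles disagree with probability at most k^2 times the total swap influence.
  full-hybrid : ∀ (F : Profile n k → Fin k) → ∑[ σ ∈ V ] (∑[ σ' ∈ V ] neF (F σ) (F σ'))
    ≤ T * (k * k * (∑[ l ∈ allFin n ] (∑[ s ∈ upTo k ] (∑[ σ ∈ V ] neF (F σ) (F (swapVoter l s σ))))))
  full-hybrid F = begin
    ∑[ σ ∈ V ] (∑[ σ' ∈ V ] neF (F σ) (F σ'))
      ≡⟨ ∑-cong V (λ σ → ∑-cong V λ σ' → cong (neF (F σ) ∘ F) (zipWith-proj₂ σ σ')) ⟨
    ∑[ σ ∈ V ] (∑[ σ' ∈ V ] neF (F σ) (F (zipWith (λ _ ρ → ρ) σ σ')))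
      ≤⟨ hybrid Fin._≟_ S (λ _ ρ → ρ) (upTo k) swap (λ _ _ → 1) (k * k)
           (λ H → ∑-const S _)
           (λ H → ≤-trans (poincaré Fin._≟_ H) (≤-reflexive (cong (λ z → N * (k * k * z))
              (∑-cong (upTo k) λ s → ∑-cong S λ ρ → sym (*-identityˡ _))))) n F ⟩
    T * (k * k * (∑[ l ∈ allFin n ] (∑[ s ∈ upTo k ] (∑[ σ ∈ V ] (1 * neF (F σ) (F (swapVoter l s σ)))))))
      ≡⟨ cong (λ z → T * (k * k * z)) (∑-cong (allFin n) λ l → ∑-cong (upTo k) λ s → ∑-cong V λ σ → *-identityˡ _) ⟩
    T * (k * k * (∑[ l ∈ allFin n ] (∑[ s ∈ upTo k ] (∑[ σ ∈ V ] neF (F σ) (F (swapVoter l s σ)))))) ∎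
    where open ≤-Reasoning

  module Far (n≥1 : 1 ≤ n) (k≥1 : 1 ≤ k) (e q : ℕ) (far : ∀ g → NonManipBar g → e ≤ q * disagreement g) where

    private
      -- With ε = e / (q T), a pivot set is big when its probability is at least ε / `L`. The factor
      -- n k^5 collects the Poincaré constant k^2, n voters, k positions and k^2 pairs of
      -- alternatives.
      L M : ℕ
      L = 2 * n * (k * k * k * k * k)
      M = L * q
      u = k * k * k
      v = u * k
      w = v * k

      instance
        n≢0 : ℕ.NonZero n
        n≢0 = ℕ.>-nonZero n≥1
        k≢0 : ℕ.NonZero k
        k≢0 = ℕ.>-nonZero k≥1

    -- L is chosen so that the term not involving #manip is exactly half of L * e.
    absorb : L * e ≤ k * k * (n * (k * (2 * M * #manip + k * k * e))) → e ≤ 4 * n * (k * k * k) * (q * #manip)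
    absorb h = *-cancelˡ-≤ c (+-cancelʳ-≤ (c * e) _ _ (begin
      c * e + c * e
        ≡⟨ s₁ n k e ⟩
      L * e
        ≤⟨ h ⟩
      k * k * (n * (k * (2 * M * #manip + k * k * e)))
        ≡⟨ s₂ n k e q #manip ⟩
      c * (4 * n * (k * k * k) * (q * #manip)) + c * e ∎))
      where
      open ≤-Reasoning
      c = n * (k * k * k * k * k)
      s₁ : ∀ n k e → n * (k * k * k * k * k) * e + n * (k * k * k * k * k) * e ≡ 2 * n * (k * k * k * k * k) * e
      s₁ = solve-∀
      s₂ : ∀ n k e q m → k * k * (n * (k * (2 * (2 * n * (k * k * k * k * k) * q) * m + k * k * e)))
        ≡ n * (k * k * k * k * k) * (4 * n * (k * k * k) * (q * m)) + n * (k * k * k * k * k) * e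
      s₂ = solve-∀
      instance
        kkk≢0 : ℕ.NonZero (k * k * k * k * k)
        kkk≢0 = m*n≢0 (k * k * k * k) k {{m*n≢0 (k * k * k) k {{m*n≢0 (k * k) k {{m*n≢0 k k}}}}}}
        c≢0 : ℕ.NonZero c
        c≢0 = m*n≢0 n (k * k * k * k * k)

    grid : ∀ {G : Fin n → ℕ → ℕ} {c} → (∀ l s → G l s ≤ c) → ∑[ l ∈ allFin n ] (∑[ s ∈ upTo k ] G l s) ≤ n * (k * c)
    grid {c = c} G≤c = ≤-trans (∑-bounded (allFin n) λ l → ∑-bounded (upTo k) λ s → G≤c l s)
      (≤-reflexive (cong₂ (λ x y → x * (y * c)) (ListP.length-tabulate {n = n} id) (ListP.length-upTo k)))

    -- Without big pivots across classes of `coll`, the collapsed outcome is nearly constant. The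
    -- value at an independent profile `σ'` serves as the constant, and averaging over `σ'` turns
    -- the distances into a disagreement of two independent profiles.
    near-collapsed : ∀ (coll : Fin k → Fin k) →
      (∀ σ' → ∃ λ g → NonManipBar g × (∀ σ → g σ ≢ f σ → coll (f σ) ≢ coll (f σ'))) →
      (∀ l s a b → coll a ≢ coll b → M * #pivot l s a b ≤ e) → e ≤ 4 * n * (k * k * k) * (q * #manip)
    near-collapsed coll approx small = absorb (*-cancelˡ-≤ T (begin
      T * (L * e)
        ≡⟨ s₁ T L e ⟩
      L * (T * e)
        ≤⟨ *-monoʳ-≤ L total ⟩
      L * (q * (∑[ σ ∈ V ] (∑[ σ' ∈ V ] neF (coll (f σ)) (coll (f σ')))))
        ≤⟨ *-monoʳ-≤ L (*-monoʳ-≤ q (full-hybrid (coll ∘ f))) ⟩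
      L * (q * (T * (k * k * changes)))
        ≡⟨ s₂ L q T k changes ⟩
      T * (k * k * (M * changes))
        ≡⟨ cong (λ z → T * (k * k * z)) (trans (sym (∑-*ˡ M (allFin n) _)) (∑-cong (allFin n) λ l → sym (∑-*ˡ M (upTo k) _))) ⟩
      T * (k * k * (∑[ l ∈ allFin n ] (∑[ s ∈ upTo k ] (M * (∑[ σ ∈ V ] neF (coll (f σ)) (coll (f (swapVoter l s σ))))))))
        ≤⟨ *-monoʳ-≤ T (*-monoʳ-≤ (k * k) (grid λ l s → changes-bound coll M e l s (small l s))) ⟩
      T * (k * k * (n * (k * (2 * M * #manip + k * k * e)))) ∎))
      where
      open ≤-Reasoning
      changes = ∑[ l ∈ allFin n ] (∑[ s ∈ upTo k ] (∑[ σ ∈ V ] neF (coll (f σ)) (coll (f (swapVoter l s σ)))))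
      s₁ : ∀ t l e → t * (l * e) ≡ l * (t * e)
      s₁ = solve-∀
      s₂ : ∀ l q t k c → l * (q * (t * (k * k * c))) ≡ t * (k * k * (l * q * c))
      s₂ = solve-∀
      one : ∀ σ' → e ≤ q * (∑[ σ ∈ V ] neF (coll (f σ)) (coll (f σ')))
      one σ' with approx σ'
      ... | g , nonmanip , close = ≤-trans (far g nonmanip) (*-monoʳ-≤ q (∑-mono V λ σ →
        𝟙-mono (¬? (f σ Fin.≟ g σ)) (¬? (coll (f σ) Fin.≟ coll (f σ'))) (λ f≢g → close σ (f≢g ∘ sym))))
      total : T * e ≤ q * (∑[ σ ∈ V ] (∑[ σ' ∈ V ] neF (coll (f σ)) (coll (f σ'))))
      total = begin
        T * e                                                           ≡⟨ cong (_* e) (length-vecsOf S n) ⟨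
        length V * e                                                    ≡⟨ ∑-const V e ⟨
        ∑[ σ' ∈ V ] e                                                   ≤⟨ ∑-mono V one ⟩
        ∑[ σ' ∈ V ] (q * (∑[ σ ∈ V ] neF (coll (f σ)) (coll (f σ'))))   ≡⟨ ∑-*ˡ q V _ ⟩
        q * (∑[ σ' ∈ V ] (∑[ σ ∈ V ] neF (coll (f σ)) (coll (f σ'))))   ≡⟨ cong (q *_) (∑-swap V V _) ⟩
        q * (∑[ σ ∈ V ] (∑[ σ' ∈ V ] neF (coll (f σ)) (coll (f σ'))))   ∎

    -- Freezing all voters but `i` at an independent profile `σ'` gives a function of one
    -- coordinate. Its distance to `f`, averaged over `σ'`, is controlled by the influences of the
    -- voters other than `i`.
    near-junta : ∀ i → (∀ l s a b → l ≢ i → a ≢ b → M * #pivot l s a b ≤ e) → e ≤ 4 * n * (k * k * k) * (q * #manip)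
    near-junta i small = absorb (*-cancelˡ-≤ T (*-cancelˡ-≤ N (begin
      N * (T * (L * e))
        ≡⟨ s₁ N T L e ⟩
      L * (N * (T * e))
        ≤⟨ *-monoʳ-≤ L (*-monoʳ-≤ N total) ⟩
      L * (N * (q * (∑[ σ' ∈ V ] (∑[ σ ∈ V ] neF (f σ) (f (σ' [ i ]≔ lookup σ i))))))
        ≡⟨ cong (L *_) (trans (s₃ N q _) (cong (q *_) split)) ⟩
      L * (q * (∑[ ρ ∈ S ] (∑[ σ ∈ V ] (∑[ σ' ∈ V ] neF (F ρ σ) (F ρ σ')))))
        ≤⟨ *-monoʳ-≤ L (*-monoʳ-≤ q (∑-mono S λ ρ → full-hybrid (F ρ))) ⟩
      L * (q * (∑[ ρ ∈ S ] (T * (k * k * changes ρ))))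
        ≡⟨ cong (λ z → L * (q * z)) (trans (∑-*ˡ T S _) (cong (T *_) (trans (∑-*ˡ (k * k) S changes) (cong (k * k *_) reorder)))) ⟩
      L * (q * (T * (k * k * (∑[ l ∈ allFin n ] (∑[ s ∈ upTo k ] total-change l s)))))
        ≡⟨ s₂ L q T k _ ⟩
      T * (k * k * (M * (∑[ l ∈ allFin n ] (∑[ s ∈ upTo k ] total-change l s))))
        ≡⟨ cong (λ z → T * (k * k * z)) (trans (sym (∑-*ˡ M (allFin n) _)) (∑-cong (allFin n) λ l → sym (∑-*ˡ M (upTo k) _))) ⟩
      T * (k * k * (∑[ l ∈ allFin n ] (∑[ s ∈ upTo k ] (M * total-change l s))))
        ≤⟨ *-monoʳ-≤ T (*-monoʳ-≤ (k * k) (grid voter)) ⟩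
      T * (k * k * (n * (k * (N * (2 * M * #manip + k * k * e)))))
        ≡⟨ s₄ T k n N _ ⟩
      N * (T * (k * k * (n * (k * (2 * M * #manip + k * k * e))))) ∎)))
      where
      open ≤-Reasoning
      F : Ranking k → Profile n k → Fin k
      F ρ σ = f (σ [ i ]≔ ρ)
      changes : Ranking k → ℕ
      changes ρ = ∑[ l ∈ allFin n ] (∑[ s ∈ upTo k ] (∑[ σ ∈ V ] neF (F ρ σ) (F ρ (swapVoter l s σ))))
      total-change : Fin n → ℕ → ℕ
      total-change l s = ∑[ ρ ∈ S ] (∑[ σ ∈ V ] neF (F ρ σ) (F ρ (swapVoter l s σ)))
      reorder : ∑ S changes ≡ ∑[ l ∈ allFin n ] (∑[ s ∈ upTo k ] total-change l s)
      reorder = trans (∑-swap S (allFin n) _) (∑-cong (allFin n) λ l → ∑-swap S (upTo k) _)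
      s₁ : ∀ n t l e → n * (t * (l * e)) ≡ l * (n * (t * e))
      s₁ = solve-∀
      s₂ : ∀ l q t k c → l * (q * (t * (k * k * c))) ≡ t * (k * k * (l * q * c))
      s₂ = solve-∀
      s₃ : ∀ n q x → n * (q * x) ≡ q * (n * x)
      s₃ = solve-∀
      s₄ : ∀ t k n m x → t * (k * k * (n * (k * (m * x)))) ≡ m * (t * (k * k * (n * (k * x))))
      s₄ = solve-∀
      total : T * e ≤ q * (∑[ σ' ∈ V ] (∑[ σ ∈ V ] neF (f σ) (f (σ' [ i ]≔ lookup σ i))))
      total = begin
        T * e            ≡⟨ cong (_* e) (length-vecsOf S n) ⟨
        length V * e     ≡⟨ ∑-const V e ⟨
        ∑[ σ' ∈ V ] e    ≤⟨ ∑-mono V (λ σ' → far (λ σ → f (σ' [ i ]≔ lookup σ i))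
                              (inj₁ (i , λ σ τ eq → cong (λ ρ → f (σ' [ i ]≔ ρ)) eq))) ⟩
        ∑[ σ' ∈ V ] (q * (∑[ σ ∈ V ] neF (f σ) (f (σ' [ i ]≔ lookup σ i))))   ≡⟨ ∑-*ˡ q V _ ⟩
        q * (∑[ σ' ∈ V ] (∑[ σ ∈ V ] neF (f σ) (f (σ' [ i ]≔ lookup σ i)))) ∎
      split : N * (∑[ σ' ∈ V ] (∑[ σ ∈ V ] neF (f σ) (f (σ' [ i ]≔ lookup σ i))))
        ≡ ∑[ ρ ∈ S ] (∑[ σ ∈ V ] (∑[ σ' ∈ V ] neF (F ρ σ) (F ρ σ')))
      split = begin-equality
        N * (∑[ σ' ∈ V ] (∑[ σ ∈ V ] neF (f σ) (f (σ' [ i ]≔ lookup σ i))))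
          ≡⟨ ∑-*ˡ N V _ ⟨
        ∑[ σ' ∈ V ] (N * (∑[ σ ∈ V ] neF (f σ) (f (σ' [ i ]≔ lookup σ i))))
          ≡⟨ ∑-cong V (λ σ' → ∑-resample S i (λ σ → neF (f σ) (f (σ' [ i ]≔ lookup σ i)))) ⟨
        ∑[ σ' ∈ V ] (∑[ σ ∈ V ] (∑[ ρ ∈ S ] neF (F ρ σ) (f (σ' [ i ]≔ lookup (σ [ i ]≔ ρ) i))))
          ≡⟨ ∑-cong V (λ σ' → trans (∑-cong V λ σ → ∑-cong S λ ρ →
               cong (λ r → neF (F ρ σ) (f (σ' [ i ]≔ r))) (lookup∘update i σ ρ)) (∑-swap V S _)) ⟩
        ∑[ σ' ∈ V ] (∑[ ρ ∈ S ] (∑[ σ ∈ V ] neF (F ρ σ) (F ρ σ')))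
          ≡⟨ trans (∑-swap V S _) (∑-cong S λ ρ → ∑-swap V V _) ⟩
        ∑[ ρ ∈ S ] (∑[ σ ∈ V ] (∑[ σ' ∈ V ] neF (F ρ σ) (F ρ σ'))) ∎
      voter : ∀ l s → M * total-change l s ≤ N * (2 * M * #manip + k * k * e)
      voter l s with l Fin.≟ i
      ... | yes refl = ≤-trans (≤-reflexive (trans (cong (M *_) (trans (∑-cong S λ ρ → trans (∑-cong V λ σ →
              trans (cong (λ τ → neF (F ρ σ) (f τ)) ([]≔-idempotent σ i)) (ne-refl Fin._≟_ (F ρ σ)))
              (trans (∑-const V 0) (*-zeroʳ (length V)))) (trans (∑-const S 0) (*-zeroʳ N)))) (*-zeroʳ M))) z≤n
      ... | no l≢i = begin
        M * total-change l s
          ≡⟨ cong (M *_) (trans (∑-cong S λ ρ → ∑-cong V λ σ → cong (λ τ → neF (F ρ σ) (f τ)) (commute ρ σ))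
               (trans (∑-swap S V _) (∑-resample S i (λ σ → neF (f σ) (f (swapVoter l s σ)))))) ⟩
        M * (N * (∑[ σ ∈ V ] neF (f σ) (f (swapVoter l s σ))))
          ≡⟨ s₃ M N _ ⟩
        N * (M * (∑[ σ ∈ V ] neF (f σ) (f (swapVoter l s σ))))
          ≤⟨ *-monoʳ-≤ N (changes-bound id M e l s (λ a b → small l s a b l≢i)) ⟩
        N * (2 * M * #manip + k * k * e) ∎
        where
        commute : ∀ ρ σ → swapVoter l s σ [ i ]≔ ρ ≡ swapVoter l s (σ [ i ]≔ ρ)
        commute ρ σ = trans ([]≔-commutes σ l i l≢i)
          (cong (λ r → (σ [ i ]≔ ρ) [ l ]≔ swap s r) (sym (lookup∘update′ l≢i σ ρ)))

    record Big : Set where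
      constructor big
      field
        voter    : Fin n
        place    : ℕ
        from to  : Fin k
        distinct : from ≢ to
        large    : e ≤ M * #pivot voter place from to

    flip-big : Big → Big
    flip-big (big i s a b a≢b le) = big i s b a (a≢b ∘ sym) (≤-trans le (*-monoʳ-≤ M (#pivot-flip i s a b)))

    -- The hypotheses of `Cross.cross-bound`; the two `to` alternatives may coincide.
    record CrossPair : Set where
      constructor cross
      field
        E E'    : Big
      open Big E using (from; to; voter)
      open Big E' using () renaming (from to from'; to to to'; voter to voter')
      field
        voters  : voter ≢ voter'
        from≢from' : from ≢ from'
        from≢to'   : from ≢ to'
        from'≢to   : from' ≢ to

    Within : Fin k → Fin k → Fin k → Set
    Within a b x = x ≡ a ⊎ x ≡ b

    within? : ∀ a b x → Dec (Within a b x)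
    within? a b x = x Fin.≟ a ⊎-dec x Fin.≟ b

    escape : ∀ (E E' : Big) → Big.voter E ≢ Big.voter E' → ¬ Within (Big.from E) (Big.to E) (Big.from E') → CrossPair
    escape E@(big i s a b a≢b _) E'@(big j t c d c≢d _) i≢j outside with a Fin.≟ d
    ... | no a≢d   = cross E E' i≢j (outside ∘ inj₁ ∘ sym) a≢d (outside ∘ inj₂)
    -- Here a = d. Reversing the first pivot makes the shared alternative the `to` of both, the
    -- coincidence that is allowed.
    ... | yes refl = cross (flip-big E) E' i≢j (outside ∘ inj₂ ∘ sym) (a≢b ∘ sym) (outside ∘ inj₁)

    pairing : ∀ (E E' : Big) → Big.voter E ≢ Big.voter E' →
      CrossPair ⊎ (Within (Big.from E) (Big.to E) (Big.from E') × Within (Big.from E) (Big.to E) (Big.to E'))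
    pairing E E' i≢j with within? (Big.from E) (Big.to E) (Big.from E') | within? (Big.from E) (Big.to E) (Big.to E')
    ... | yes w | yes w′ = inj₂ (w , w′)
    ... | no ¬w | _      = inj₁ (escape E E' i≢j ¬w)
    ... | yes _ | no ¬w  = inj₁ (escape E (flip-big E') i≢j ¬w)

    -- Positions s ≥ k carry no pivots, so a finite search decides; a failed comparison with the
    -- threshold gives the opposite inequality.
    search : ∀ {C : Fin n → Fin k → Fin k → Set} → (∀ l a b → Dec (C l a b)) →
      (∃ λ (E : Big) → C (Big.voter E) (Big.from E) (Big.to E))
      ⊎ (∀ l s a b → C l a b → a ≢ b → M * #pivot l s a b ≤ e)
    search {C} C? with FinP.any? (λ l → FinP.any? λ s → FinP.any? λ a → FinP.any? λ b →
      C? l a b ×-dec ¬? (a Fin.≟ b) ×-dec e ℕ.≤? M * #pivot l (toℕ {k} s) a b)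
    ... | yes (l , s , a , b , ok , a≢b , le) = inj₁ (big l (toℕ s) a b a≢b le , ok)
    ... | no none = inj₂ small
      where
      small : ∀ l s a b → C l a b → a ≢ b → M * #pivot l s a b ≤ e
      small l s a b ok a≢b with s ℕ.<? k
      ... | no s≮k = ≤-trans (≤-reflexive (trans (cong (M *_) (#pivot-out l a b (≮⇒≥ s≮k))) (*-zeroʳ M))) z≤n
      ... | yes s<k = [ id , (λ le → contradiction
          (l , fromℕ< s<k , a , b , ok , a≢b , subst (λ s → e ≤ M * #pivot l s a b) (sym (toℕ-fromℕ< s<k)) le) none) ]′
          (≤-total (M * #pivot l s a b) e)

    collapse : Fin k → Fin k → Fin k → Fin k
    collapse a b x = if does (within? a b x) then a else x

    collapse-within : ∀ {a b x} → Within a b x → collapse a b x ≡ a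
    collapse-within {a} {b} {x} w rewrite dec-true (within? a b x) w = refl

    collapse-outside : ∀ {a b x} → ¬ Within a b x → collapse a b x ≡ x
    collapse-outside {a} {b} {x} ¬w rewrite dec-false (within? a b x) ¬w = refl

    -- If f σ' lies outside {a, b}, the approximation is the constant f σ'; otherwise it is `f` with
    -- every value outside {a, b} reset to `a`. An error then always changes the collapsed value.
    two-valued : ∀ a b σ' → ∃ λ g → NonManipBar g × (∀ σ → g σ ≢ f σ → collapse a b (f σ) ≢ collapse a b (f σ'))
    two-valued a b σ' with within? a b (f σ')
    ... | no ¬w = (λ _ → f σ') , inj₂ (f σ' , f σ' , λ _ → inj₁ refl) , λ σ g≢f eq → differs σ g≢f (trans eq (collapse-outside ¬w))
      where
      differs : ∀ σ → f σ' ≢ f σ → collapse a b (f σ) ≢ f σ'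
      differs σ g≢f eq with within? a b (f σ)
      ... | yes w  = ¬w (inj₁ (trans (sym eq) (collapse-within w)))
      ... | no ¬w′ = g≢f (trans (sym eq) (collapse-outside ¬w′))
    ... | yes w = g , inj₂ (a , b , values) , close
      where
      g : SCF n k
      g σ = if does (within? a b (f σ)) then f σ else a
      values : ∀ σ → g σ ≡ a ⊎ g σ ≡ b
      values σ with within? a b (f σ)
      ... | yes (inj₁ ≡a) rewrite dec-true (within? a b (f σ)) (inj₁ ≡a) = inj₁ ≡a
      ... | yes (inj₂ ≡b) rewrite dec-true (within? a b (f σ)) (inj₂ ≡b) = inj₂ ≡b
      ... | no ¬w rewrite dec-false (within? a b (f σ)) ¬w = inj₁ refl
      close : ∀ σ → g σ ≢ f σ → collapse a b (f σ) ≢ collapse a b (f σ')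
      close σ g≢f eq with within? a b (f σ)
      ... | yes w′ = g≢f (cong (λ x → if x then f σ else a) (dec-true (within? a b (f σ)) w′))
      ... | no ¬w′ = ¬w′ (inj₁ (trans (sym (collapse-outside ¬w′)) (trans eq (collapse-within w))))

    -- Two big pivots of different voters cross, possibly after a flip, unless they share their pair
    -- {a, b}. If all big pivots lie in {a, b}, then `f` is close to a two-valued function up to
    -- manipulation points; if not, one outside {a, b} crosses a pivot of another voter.
    dichotomy : CrossPair ⊎ e ≤ 4 * n * (k * k * k) * (q * #manip)
    dichotomy with search (λ _ _ _ → yes tt)
    -- No pivot is big at all, so the choice of the exceptional voter is arbitrary.
    ... | inj₂ none = inj₂ (near-junta (fromℕ< n≥1) (λ l s a b _ → none l s a b tt))
    ... | inj₁ (E , _) with search {λ l _ _ → l ≢ Big.voter E} (λ l _ _ → ¬? (l Fin.≟ Big.voter E))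
    ...   | inj₂ none = inj₂ (near-junta (Big.voter E) (λ l s a b l≢i → none l s a b l≢i))
    ...   | inj₁ (E' , j≢i) with pairing E E' (j≢i ∘ sym)
    ...     | inj₁ pair = inj₁ pair
    ...     | inj₂ (c∈ , d∈) with search {λ _ x y → ¬ (Within (Big.from E) (Big.to E) x × Within (Big.from E) (Big.to E) y)}
                (λ _ x y → ¬? (within? (Big.from E) (Big.to E) x ×-dec within? (Big.from E) (Big.to E) y))
    ...       | inj₂ none = inj₂ (near-collapsed (collapse (Big.from E) (Big.to E)) (two-valued (Big.from E) (Big.to E))
      λ l s a b sep → none l s a b
        (λ (wa , wb) → sep (trans (collapse-within wa) (sym (collapse-within wb)))) (sep ∘ cong (collapse (Big.from E) (Big.to E))))
    ...       | inj₁ (E'' , outside) with Big.voter E'' Fin.≟ Big.voter E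
    ...         | no l≢i = [ inj₁ , (λ within → contradiction within outside) ]′ (pairing E E'' (l≢i ∘ sym))
    -- The outside pivot belongs to the voter of `E`, so it is paired with `E'`, whose alternatives
    -- are those of `E`.
    ...         | yes l≡i = [ inj₁ , (λ (x∈ , y∈) → contradiction (through x∈ , through y∈) outside) ]′
      (pairing E' E'' (λ j≡l → j≢i (trans j≡l l≡i)))
      where
      through : ∀ {x} → Within (Big.from E') (Big.to E') x → Within (Big.from E) (Big.to E) x
      through (inj₁ refl) = c∈
      through (inj₂ refl) = d∈

    -- In normalised form ε^4 ≤ 528 n^5 k^27 P(M_4). The fourth power of `M` supplies 16 n^4 k^20,
    -- the vertices of the paths k^4, and `C` at most 33 n k^3.
    far-bound : e * e * (e * e) ≤ q * q * (q * q) * (T * T * T) * (528 * (n * n * n * n * n) * (w * w * w * w * v * u) * #manip)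
    far-bound = [ from-cross , from-manip ]′ dichotomy
      where
      open ≤-Reasoning
      C = 1 + 32 * n * (k * k * k)
      v≥1 : 1 ≤ v
      v≥1 = *-mono-≤ (*-mono-≤ (*-mono-≤ k≥1 k≥1) k≥1) k≥1
      w≥1 : 1 ≤ w
      w≥1 = *-mono-≤ v≥1 k≥1
      nk³≥1 : 1 ≤ n * (k * k * k)
      nk³≥1 = *-mono-≤ n≥1 (*-mono-≤ (*-mono-≤ k≥1 k≥1) k≥1)
      C≤ : C ≤ 33 * (n * (k * k * k))
      C≤ = ≤-trans (+-mono-≤ nk³≥1 (≤-reflexive (*-assoc 32 n (k * k * k)))) ≤-refl
      from-cross : CrossPair → e * e * (e * e) ≤ q * q * (q * q) * (T * T * T) * (528 * (n * n * n * n * n) * (w * w * w * w * v * u) * #manip)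
      from-cross (cross (big i s a b a≢b le) (big j t c d c≢d le′) i≢j a≢c a≢d c≢b) = begin
        e * e * (e * e)
          ≤⟨ *-mono-≤ (*-mono-≤ le le) (*-mono-≤ le′ le′) ⟩
        M * x * (M * x) * (M * y * (M * y))
          ≡⟨ s₁ M x y ⟩
        M * M * (M * M) * (x * x * (y * y))
          ≤⟨ *-monoʳ-≤ (M * M * (M * M)) (Cross.cross-bound f i j i≢j s t a b c d a≢b c≢d a≢c a≢d c≢b) ⟩
        M * M * (M * M) * (T * T * T * (k * k * k * k * (C * #manip)))
          ≤⟨ *-monoʳ-≤ (M * M * (M * M)) (*-monoʳ-≤ (T * T * T) (*-monoʳ-≤ (k * k * k * k) (*-monoˡ-≤ #manip C≤))) ⟩
        M * M * (M * M) * (T * T * T * (k * k * k * k * (33 * (n * (k * k * k)) * #manip)))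
          ≡⟨ s₂ n u v w q T #manip ⟩
        q * q * (q * q) * (T * T * T) * (528 * (n * n * n * n * n) * (w * w * w * w * v * u) * #manip) ∎
        where
        x = #pivot i s a b
        y = #pivot j t c d
        s₁ : ∀ m x y → m * x * (m * x) * (m * y * (m * y)) ≡ m * m * (m * m) * (x * x * (y * y))
        s₁ = solve-∀
        s₂ : ∀ n u v w q t z →
          (2 * n * w * q) * (2 * n * w * q) * ((2 * n * w * q) * (2 * n * w * q)) * (t * t * t * (v * (33 * (n * u) * z)))
          ≡ q * q * (q * q) * (t * t * t) * (528 * (n * n * n * n * n) * (w * w * w * w * v * u) * z)
        s₂ = solve-∀
      e≤qT : e ≤ q * T
      e≤qT = ≤-trans (far (λ _ → fromℕ< k≥1) (inj₂ (fromℕ< k≥1 , fromℕ< k≥1 , λ _ → inj₁ refl)))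
        (*-monoʳ-≤ q (≤-trans (∑-mono V λ σ → 𝟙≤1 (¬? (f σ Fin.≟ fromℕ< k≥1))) (≤-reflexive (trans (∑-const V 1)
          (trans (*-identityʳ _) (length-vecsOf S n))))))
      from-manip : e ≤ 4 * n * (k * k * k) * (q * #manip) →
        e * e * (e * e) ≤ q * q * (q * q) * (T * T * T) * (528 * (n * n * n * n * n) * (w * w * w * w * v * u) * #manip)
      from-manip le = begin
        e * e * (e * e)
          -- The direct bound is linear in ε; the other three factors are bounded by ε ≤ 1.
          ≤⟨ *-mono-≤ (*-mono-≤ e≤qT e≤qT) (*-mono-≤ e≤qT le) ⟩
        q * T * (q * T) * (q * T * (4 * n * u * (q * #manip)))
          ≡⟨ s₁ q T n u #manip ⟩
        1 * (q * q * (q * q) * (T * T * T) * (4 * n * u * #manip))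
          ≤⟨ *-monoˡ-≤ (q * q * (q * q) * (T * T * T) * (4 * n * u * #manip)) slack ⟩
        132 * (n * n * n * n) * (w * w * w * w * v) * (q * q * (q * q) * (T * T * T) * (4 * n * u * #manip))
          ≡⟨ s₂ q T n u v w #manip ⟩
        q * q * (q * q) * (T * T * T) * (528 * (n * n * n * n * n) * (w * w * w * w * v * u) * #manip) ∎
        where
        s₁ : ∀ q t n u z → q * t * (q * t) * (q * t * (4 * n * u * (q * z))) ≡ 1 * (q * q * (q * q) * (t * t * t) * (4 * n * u * z))
        s₁ = solve-∀
        s₂ : ∀ q t n u v w z → 132 * (n * n * n * n) * (w * w * w * w * v) * (q * q * (q * q) * (t * t * t) * (4 * n * u * z))
          ≡ q * q * (q * q) * (t * t * t) * (528 * (n * n * n * n * n) * (w * w * w * w * v * u) * z)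
        s₂ = solve-∀
        slack : 1 ≤ 132 * (n * n * n * n) * (w * w * w * w * v)
        slack = positive-* (132 * (n * n * n * n)) (w * w * w * w * v)
          (positive-* 132 (n * n * n * n) (s≤s z≤n) (*-mono-≤ (*-mono-≤ (*-mono-≤ n≥1 n≥1) n≥1) n≥1))
          (*-mono-≤ (*-mono-≤ (*-mono-≤ (*-mono-≤ w≥1 w≥1) w≥1) w≥1) v≥1)

-- Rational bounds

-- x = a / (b + 1), up to unnormalised equality, so that products need not be reduced to lowest
-- terms. The second index is the denominator minus one.
Represents : ℚ → ℕ → ℕ → Set
Represents x a b = ℚ.toℚᵘ x ℚᵘ.≃ ℚᵘ.mkℚᵘ (ℤ.+ a) b

represents-frac : ∀ c d → Represents (frac c (suc d)) c d
represents-frac c d = ℚP.toℚᵘ-fromℚᵘ (ℚᵘ.mkℚᵘ (ℤ.+ c) d)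

-- `d + b * suc d` is the predecessor of `suc b * suc d`.
represents-* : ∀ {x y a b c d} → Represents x a b → Represents y c d → Represents (x ℚ.* y) (a * c) (d + b * suc d)
represents-* {x} {y} {a} {b} {c} {d} x≃ y≃ = ℚᵘP.≃-trans (ℚP.toℚᵘ-homo-* x y) (ℚᵘP.≃-trans (ℚᵘP.*-cong x≃ y≃)
  (ℚᵘ.*≡* (cong (ℤ._* ℤ.+ suc (d + b * suc d)) (sym (ℤP.pos-* a c)))))

represents-≤⁻ : ∀ {x y a b c d} → Represents x a b → Represents y c d → x ℚ.≤ y → a * suc d ≤ c * suc b
represents-≤⁻ {a = a} {b} {c} {d} x≃ y≃ x≤y = ℤP.drop‿+≤+ (subst₂ ℤ._≤_ (sym (ℤP.pos-* a (suc d))) (sym (ℤP.pos-* c (suc b)))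
  (ℚᵘP.drop-*≤* (ℚᵘP.≤-respˡ-≃ x≃ (ℚᵘP.≤-respʳ-≃ y≃ (ℚP.toℚᵘ-mono-≤ x≤y)))))

represents-≤⁺ : ∀ {x y a b c d} → Represents x a b → Represents y c d → a * suc d ≤ c * suc b → x ℚ.≤ y
represents-≤⁺ {a = a} {b} {c} {d} x≃ y≃ le = ℚP.toℚᵘ-cancel-≤ (ℚᵘP.≤-respˡ-≃ (ℚᵘP.≃-sym x≃) (ℚᵘP.≤-respʳ-≃ (ℚᵘP.≃-sym y≃)
  (ℚᵘ.*≤* (subst₂ ℤ._≤_ (ℤP.pos-* a (suc d)) (ℤP.pos-* c (suc b)) (ℤ.+≤+ le)))))

represents-positive : ∀ {ε} → ℚ.0ℚ ℚ.< ε → ∃ λ p → ∃ λ d → Represents ε p d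
represents-positive {ℚ.mkℚ (ℤ.+ p) d _}      _ = p , d , ℚᵘP.≃-refl
represents-positive {ℚ.mkℚ -[1+ _ ] d _} (ℚ.*<* ())

frac-mono : ∀ {a b} d → a ≤ b → frac a d ℚ.≤ frac b d
frac-mono zero    a≤b = ℚP.≤-refl
frac-mono {a} {b} (suc d) a≤b = represents-≤⁺ (represents-frac a d) (represents-frac b d) (*-monoˡ-≤ (suc d) a≤b)

≤frac⁻ : ∀ {x a b c t} → Represents x a b → 1 ≤ t → x ℚ.≤ frac c t → a * t ≤ suc b * c
≤frac⁻ {b = b} {c} {suc t} x≃ _ le = ≤-trans (represents-≤⁻ x≃ (represents-frac c t) le) (≤-reflexive (*-comm c (suc b)))

fifth-power-≤frac : ∀ {x a b c t D} → Represents x a b → 1 ≤ t → 1 ≤ D →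
  a * a * a * a * a * 1 * t ≤ c * (suc b * suc b * suc b * suc b * suc b * D) →
  x ℚ.* x ℚ.* x ℚ.* x ℚ.* x ℚ.* frac 1 D ℚ.≤ frac c t
fifth-power-≤frac {c = c} {suc t} {suc D} x≃ _ _ le = represents-≤⁺
  (represents-* (represents-* (represents-* (represents-* (represents-* x≃ x≃) x≃) x≃) x≃) (represents-frac 1 D))
  (represents-frac c t) le

slack : ∀ c n k → 528 ≤ c → 1 ≤ n → 1 ≤ k → let u = k * k * k ; v = u * k ; w = v * k in
  528 * (n * n * n * n * n) * (w * w * w * w * v * u) ≤ c * n ^ 7 * k ^ 46
slack c n k c≥528 n≥1 k≥1 = *-mono-≤ (*-mono-≤ c≥528 (≤-trans (≤-reflexive (n⁵ n)) (^-monoʳ-≤ n {{ℕ.>-nonZero n≥1}} {5} {7} (m≤m+n 5 2))))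
  (≤-trans (≤-reflexive k²⁷) (^-monoʳ-≤ k {{ℕ.>-nonZero k≥1}} {27} {46} (m≤m+n 27 19)))
  where
  n⁵ : ∀ n → n * n * n * n * n ≡ n * (n * (n * (n * (n * 1))))
  n⁵ = solve-∀
  k⁴ : ∀ k → k * k * k * k ≡ k * (k * (k * (k * 1)))
  k⁴ = solve-∀
  k³ : ∀ k → k * k * k ≡ k * (k * (k * 1))
  k³ = solve-∀
  k²⁷ : (k * k * k * k * k) * (k * k * k * k * k) * (k * k * k * k * k) * (k * k * k * k * k) * (k * k * k * k) * (k * k * k) ≡ k ^ 27
  k²⁷ = begin
    (k * k * k * k * k) * (k * k * k * k * k) * (k * k * k * k * k) * (k * k * k * k * k) * (k * k * k * k) * (k * k * k)
      ≡⟨ cong₂ _*_ (cong₂ _*_ (cong (λ x → x * x * x * x) (n⁵ k)) (k⁴ k)) (k³ k) ⟩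
    k ^ 5 * k ^ 5 * k ^ 5 * k ^ 5 * k ^ 4 * k ^ 3
      ≡⟨ cong (λ x → x * k ^ 5 * k ^ 5 * k ^ 4 * k ^ 3) (^-distribˡ-+-* k 5 5) ⟨
    k ^ 10 * k ^ 5 * k ^ 5 * k ^ 4 * k ^ 3
      ≡⟨ cong (λ x → x * k ^ 5 * k ^ 4 * k ^ 3) (^-distribˡ-+-* k 10 5) ⟨
    k ^ 15 * k ^ 5 * k ^ 4 * k ^ 3
      ≡⟨ cong (λ x → x * k ^ 4 * k ^ 3) (^-distribˡ-+-* k 15 5) ⟨
    k ^ 20 * k ^ 4 * k ^ 3
      ≡⟨ cong (_* k ^ 3) (^-distribˡ-+-* k 20 4) ⟨
    k ^ 24 * k ^ 3
      ≡⟨ ^-distribˡ-+-* k 24 3 ⟨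
    k ^ 27 ∎
    where open ≡-Reasoning

-- `far-bound` controls ε^4; the fifth factor is absorbed by ε ≤ 1. The numeral stays a variable
-- `c`, of which only 528 ≤ c matters.
lower-bound : ∀ {n k} c → 528 ≤ c → 1 ≤ n → 1 ≤ k → ∀ {ε} → ℚ.0ℚ ℚ.< ε →
  (f : SCF n k) → (∀ g → NonManipBar g → ε ℚ.≤ Dist f g) →
  ε ℚ.* ε ℚ.* ε ℚ.* ε ℚ.* ε ℚ.* frac 1 (c * n ^ 7 * k ^ 46) ℚ.≤ Prob (rManipPoint? 4 f)
lower-bound {n} {k} c c≥528 n≥1 k≥1 ε>0 f far with represents-positive ε>0
... | p , d , ε≃ = fifth-power-≤frac ε≃ T≥1 D≥1 (begin
  p * p * p * p * p * 1 * T
    ≡⟨ s₁ p T ⟩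
  p * (p * p * (p * p) * T)
    ≤⟨ *-mono-≤ p≤q bound ⟩
  q * (q * q * (q * q) * (c₂₇ * #manip))
    ≤⟨ *-monoʳ-≤ q (*-monoʳ-≤ (q * q * (q * q)) (*-monoˡ-≤ #manip (slack c n k c≥528 n≥1 k≥1))) ⟩
  q * (q * q * (q * q) * (D * #manip))
    ≡⟨ s₂ q D #manip ⟩
  #manip * (q * q * q * q * q * D)
    ≡⟨ cong (_* (q * q * q * q * q * D)) counted ⟩
  length (filter (rManipPoint? 4 f) V) * (q * q * q * q * q * D) ∎)
  where
  open ≤-Reasoning
  open Local f
  V = profiles n k
  T = length V
  K = length (Sk k) ^ n
  q = suc d
  u = k * k * k
  v = u * k
  w = v * k
  c₂₇ = 528 * (n * n * n * n * n) * (w * w * w * w * v * u)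
  D = c * n ^ 7 * k ^ 46
  T≡K : T ≡ K
  T≡K = length-vecsOf (Sk k) n
  T≥1 : 1 ≤ T
  T≥1 = subst (1 ≤_) (sym T≡K) (m^n>0 (length (Sk k)) {{ℕ.>-nonZero (Sk-nonempty k)}} n)
  D≥1 : 1 ≤ D
  D≥1 = ≤-trans c₂₇≥1 (slack c n k c≥528 n≥1 k≥1)
    where
    u≥1 : 1 ≤ u
    u≥1 = *-mono-≤ (*-mono-≤ k≥1 k≥1) k≥1
    v≥1 : 1 ≤ v
    v≥1 = *-mono-≤ u≥1 k≥1
    w≥1 : 1 ≤ w
    w≥1 = *-mono-≤ v≥1 k≥1
    c₂₇≥1 : 1 ≤ c₂₇
    c₂₇≥1 = positive-* (528 * (n * n * n * n * n)) (w * w * w * w * v * u)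
      (positive-* 528 (n * n * n * n * n) (s≤s z≤n) (*-mono-≤ (*-mono-≤ (*-mono-≤ (*-mono-≤ n≥1 n≥1) n≥1) n≥1) n≥1))
      (*-mono-≤ (*-mono-≤ (*-mono-≤ (*-mono-≤ (*-mono-≤ w≥1 w≥1) w≥1) w≥1) v≥1) u≥1)
  counted : #manip ≡ length (filter (rManipPoint? 4 f) V)
  counted = trans (∑-cong V λ σ → 𝟙-cong (manip? σ) (rManipPoint? 4 f σ) id id) (sym (length-filter (rManipPoint? 4 f) V))
  e = p * T
  far′ : ∀ g → NonManipBar g → e ≤ q * disagreement f g
  far′ g nonmanip = subst (λ c → e ≤ q * c) (length-filter (λ σ → ¬? (f σ Fin.≟ g σ)) V) (≤frac⁻ ε≃ T≥1 (far g nonmanip))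
  -- That is ε ≤ 1, since a constant function lies in NONMANIP and is at distance at most 1.
  p≤q : p ≤ q
  p≤q = *-cancelʳ-≤ p q T {{ℕ.>-nonZero T≥1}} (≤-trans (far′ (λ _ → fromℕ< k≥1) (inj₂ (fromℕ< k≥1 , fromℕ< k≥1 , λ _ → inj₁ refl)))
    (*-monoʳ-≤ q (≤-trans (∑-bounded V λ σ → 𝟙≤1 (¬? (f σ Fin.≟ fromℕ< k≥1))) (≤-reflexive (*-identityʳ T)))))
  bound : p * p * (p * p) * T ≤ q * q * (q * q) * (c₂₇ * #manip)
  bound = *-cancelʳ-≤ _ _ (T * T * T) {{m*n≢0 (T * T) T {{m*n≢0 T T {{T≢0}} {{T≢0}}}} {{T≢0}}}} (begin
    p * p * (p * p) * T * (T * T * T)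
      ≡⟨ s₃ p T ⟩
    e * e * (e * e)
      ≤⟨ Far.far-bound f n≥1 k≥1 e q far′ ⟩
    q * q * (q * q) * (K * K * K) * (c₂₇ * #manip)
      ≡⟨ cong (λ t → q * q * (q * q) * (t * t * t) * (c₂₇ * #manip)) T≡K ⟨
    q * q * (q * q) * (T * T * T) * (c₂₇ * #manip)
      ≡⟨ s₄ q T (c₂₇ * #manip) ⟩
    q * q * (q * q) * (c₂₇ * #manip) * (T * T * T) ∎)
    where
    T≢0 = ℕ.>-nonZero T≥1
    s₃ : ∀ p t → p * p * (p * p) * t * (t * t * t) ≡ p * t * (p * t) * (p * t * (p * t))
    s₃ = solve-∀
    s₄ : ∀ q t b → q * q * (q * q) * (t * t * t) * b ≡ q * q * (q * q) * b * (t * t * t)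
    s₄ = solve-∀
  s₁ : ∀ p t → p * p * p * p * p * 1 * t ≡ p * (p * p * (p * p) * t)
  s₁ = solve-∀
  s₂ : ∀ q d m → q * (q * q * (q * q) * (d * m)) ≡ m * (q * q * q * q * q * d)
  s₂ = solve-∀

theorem7p1 : (n k : ℕ) → 2 ℕ.≤ n → 3 ℕ.≤ k → (ε : ℚ) → ℚ.0ℚ ℚ.< ε →
    (f : SCF n k) → (∀ (g : SCF n k) → NonManipBar g → ε ℚ.≤ Dist f g) →
    (Prob (rManipPoint? 4 f) ℚ.≤ Prob (manipPoint? f))
    × (ε ℚ.* ε ℚ.* ε ℚ.* ε ℚ.* ε ℚ.* frac 1 (1000000000 ℕ.* n ℕ.^ 7 ℕ.* k ℕ.^ 46)
    ℚ.≤ Prob (rManipPoint? 4 f))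
theorem7p1 n k n≥2 k≥3 ε ε>0 f far = restricted≤manip , lower-bound 1000000000 (≤ᵇ⇒≤ 528 1000000000 tt)
  (≤-trans (s≤s z≤n) n≥2) (≤-trans (s≤s z≤n) k≥3) ε>0 f far
  where
  V = profiles n k

  restricted≤manip : Prob (rManipPoint? 4 f) ℚ.≤ Prob (manipPoint? f)
  restricted≤manip = frac-mono (length V) (subst₂ _≤_ (sym (length-filter (rManipPoint? 4 f) V)) (sym (length-filter (manipPoint? f) V))
    (∑-mono V λ σ → 𝟙-mono (rManipPoint? 4 f σ) (manipPoint? f σ) λ (i , any) → i , Any.map proj₂ any))
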